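{- Let $p$ be a prime, $q=p^n$, and let $k$ be a positive divisor of $n$. Let $\mathcal{U}\subseteq\mathbb{F}_q$ be an $\mathbb{F}_{p^k}$-vector space such that $1\in\mathcal{U}$ and $\#\mathcal{U}>2$, and let $d\le n/k$ be the smallest positive integer for which $\mathcal{U}\subseteq\mathbb{F}_{p^{dk}}$. If $A(x)=\prod_{u\in\mathcal{U}}(x-u)$, then there exists a monic $p^k$-linearized polynomial $M\in\mathbb{F}_q[x]$ such that $$A(M(x))=M(A(x))=x^{p^{dk}}-x.$$ Moreover, $\mathbb{F}_{p^{dk}}\subseteq\mathbb{F}_q$ and $$\mathcal{P}(\mathcal{U},q)=\{M(f(x)) : f\in\mathcal{P}(\mathbb{F}_{p^{dk}},q)\}.$$
   Context: All finite fields of characteristic $p$ are taken inside a fixed algebraic closure $\overline{\mathbb{F}}_q$ of $\mathbb{F}_q$. For $F\in\mathbb{F}_q[x]$, $V_F=\{F(\alpha):\alpha\in\mathbb{F}_q\}$. A polynomial $F\in\mathbb{F}_q[x]$ of positive degree is a minimal value set polynomial (MVSP) over $\mathbb{F}_q$ if $\#V_F=\lfloor (q-1)/\deg F\rfloor+1$. For a nonempty $S\subseteq\mathbb{F}_q$, $\mathcal{P}(S,q)$ denotes the set of all MVSPs $F\in\mathbb{F}_q[x]$ with $V_F=S$. A polynomial is called $p^k$-linearized if it is of the form $\sum_{i=0}^s a_i x^{p^{ki}}\in\overline{\mathbb{F}}_q[x]$. -}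

module Defs where

open import Algebra.Bundles using (CommutativeRing)
open import Data.List.Base using (List; []; _∷_; _++_; length; map; foldr; replicate; applyUpTo)
import Data.List.Membership.Setoid as Membership
import Data.List.Relation.Unary.Unique.Setoid as Uniqueness
open import Data.Nat.Base as ℕ using (ℕ; zero; suc; NonZero)
open import Data.Nat.DivMod using (_/_)
open import Data.Product.Base using (∃; _×_; _,_)
open import Function.Bundles using (_⇔_)
open import Level using (Level; _⊔_) renaming (suc to lsuc)
open import Relation.Binary.Definitions using (Decidable)
open import Relation.Binary.PropositionalEquality.Core using (_≡_)
open import Relation.Unary using (Pred; _⊆_; _≐_)

-- Equality is required to be decidable.  Classically this is no restriction,
-- and the algebraic closure of a finite field has this property constructively.
record Field (c ℓ : Level) : Set (lsuc (c ⊔ ℓ)) where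
  field
    commutativeRing : CommutativeRing c ℓ
  open CommutativeRing commutativeRing public
  field
    _≟_      : Decidable _≈_
    0≉1      : 0# ≉ 1#
    inverse  : ∀ x → x ≉ 0# → ∃ λ y → x * y ≈ 1#

module Over {c ℓ : Level} (K : Field c ℓ) where

  open Field K public
  open Membership setoid using (_∈_)
  open Uniqueness setoid using (Unique)

  -- A finite set together with a repetition-free list of its elements.
  record Enumeration {s : Level} (S : Pred Carrier s) : Set (c ⊔ ℓ ⊔ s) where
    field
      elements  : List Carrier
      unique    : Unique elements
      correct   : ∀ x → x ∈ elements ⇔ S x

  ∣_∣ : {s : Level} {S : Pred Carrier s} → Enumeration S → ℕ
  ∣ E ∣ = length (Enumeration.elements E)

  HasCardinality : {s : Level} → Pred Carrier s → ℕ → Set (c ⊔ ℓ ⊔ s)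
  HasCardinality S N = ∃ λ (E : Enumeration S) → ∣ E ∣ ≡ N

  record Subfield (N : ℕ) : Set (c ⊔ ℓ) where
    field
      elements  : List Carrier
      unique    : Unique elements
      order     : length elements ≡ N
      0-closed  : 0# ∈ elements
      1-closed  : 1# ∈ elements
      +-closed  : ∀ {x y} → x ∈ elements → y ∈ elements → x + y ∈ elements
      *-closed  : ∀ {x y} → x ∈ elements → y ∈ elements → x * y ∈ elements
      neg-closed : ∀ {x} → x ∈ elements → - x ∈ elements
      inv-closed : ∀ {x y} → x ∈ elements → x * y ≈ 1# → y ∈ elements

  ⟦_⟧ : {N : ℕ} → Subfield N → Pred Carrier (c ⊔ ℓ)
  ⟦ F ⟧ x = x ∈ Subfield.elements F

  -- The finite field with N elements inside K.  In an algebraically closed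
  -- field of characteristic p there is exactly one subfield of each order
  -- p ^ m with m > 0, so the union over all subfields of that order is that
  -- subfield.
  𝔽 : ℕ → Pred Carrier (c ⊔ ℓ)
  𝔽 N x = ∃ λ (F : Subfield N) → ⟦ F ⟧ x

  record IsSubspace {s u : Level} (S : Pred Carrier s) (U : Pred Carrier u)
                    : Set (c ⊔ s ⊔ u) where
    field
      0-closed  : U 0#
      +-closed  : ∀ {x y} → U x → U y → U (x + y)
      ·-closed  : ∀ {a x} → S a → U x → U (a * x)

  -- Coefficient lists, constant term first; trailing zeros are allowed, and
  -- polynomials are compared by _≈ₚ_.
  Poly : Set c
  Poly = List Carrier

  coeff : Poly → ℕ → Carrier
  coeff []       _       = 0#
  coeff (a ∷ _)  zero    = a
  coeff (_ ∷ P)  (suc i) = coeff P i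

  infix 4 _≈ₚ_
  _≈ₚ_ : Poly → Poly → Set ℓ
  P ≈ₚ Q = ∀ i → coeff P i ≈ coeff Q i

  infixl 6 _+ₚ_ _-ₚ_
  infixl 7 _*ₚ_ _·ₚ_
  infixr 9 _∘ₚ_

  _+ₚ_ : Poly → Poly → Poly
  []      +ₚ Q       = Q
  (a ∷ P) +ₚ []      = a ∷ P
  (a ∷ P) +ₚ (b ∷ Q) = (a + b) ∷ (P +ₚ Q)

  _·ₚ_ : Carrier → Poly → Poly
  a ·ₚ P = map (a *_) P

  _-ₚ_ : Poly → Poly → Poly
  P -ₚ Q = P +ₚ map -_ Q

  _*ₚ_ : Poly → Poly → Poly
  []      *ₚ Q = []
  (a ∷ P) *ₚ Q = (a ·ₚ Q) +ₚ (0# ∷ (P *ₚ Q))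

  _∘ₚ_ : Poly → Poly → Poly
  []      ∘ₚ Q = []
  (a ∷ P) ∘ₚ Q = (a ∷ []) +ₚ (Q *ₚ (P ∘ₚ Q))

  eval : Poly → Carrier → Carrier
  eval []      x = 0#
  eval (a ∷ P) x = a + x * eval P x

  constant : Carrier → Poly
  constant a = a ∷ []

  X^_ : ℕ → Poly
  X^ m = replicate m 0# ++ (1# ∷ [])

  X : Poly
  X = X^ 1

  ∑ₚ ∏ₚ : List Poly → Poly
  ∑ₚ = foldr _+ₚ_ []
  ∏ₚ = foldr _*ₚ_ (constant 1#)

  HasDegree : Poly → ℕ → Set ℓ
  HasDegree P m = coeff P m ≉ 0# × (∀ i → m ℕ.< i → coeff P i ≈ 0#)

  Monic : Poly → Set ℓ
  Monic P = ∃ λ m → HasDegree P m × coeff P m ≈ 1#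

  _HasCoefficientsIn_ : {s : Level} → Poly → Pred Carrier s → Set s
  P HasCoefficientsIn S = ∀ i → S (coeff P i)

  -- r-linearized: ∑_{i=0}^{s} aᵢ x^(r^i).  For r = p^k this is the exponent
  -- p^(ki).
  Linearized : ℕ → Poly → Set (c ⊔ ℓ)
  Linearized r P = ∃ λ (s : ℕ) → ∃ λ (a : ℕ → Carrier) →
    P ≈ₚ ∑ₚ (applyUpTo (λ i → a i ·ₚ (X^ (r ℕ.^ i))) (suc s))

  vanishing : {s : Level} {S : Pred Carrier s} → Enumeration S → Poly
  vanishing E = ∏ₚ (map (λ u → X -ₚ constant u) (Enumeration.elements E))

  AlgebraicallyClosed : Set (c ⊔ ℓ)
  AlgebraicallyClosed =
    ∀ P m → 0 ℕ.< m → HasDegree P m → ∃ λ x → eval P x ≈ 0#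

  AlgebraicOver : {s : Level} → Pred Carrier s → Set (c ⊔ ℓ ⊔ s)
  AlgebraicOver S = ∀ x → ∃ λ P → P HasCoefficientsIn S
    × (∃ λ m → HasDegree P m) × eval P x ≈ 0#

  IsAlgebraicClosureOf : {s : Level} → Pred Carrier s → Set (c ⊔ ℓ ⊔ s)
  IsAlgebraicClosureOf S = AlgebraicallyClosed × AlgebraicOver S

  module _ {q : ℕ} (Fq : Subfield q) where

    ValueSet : Poly → Pred Carrier (c ⊔ ℓ)
    ValueSet F y = ∃ λ x → ⟦ Fq ⟧ x × eval F x ≈ y

    record IsMVSP (F : Poly) : Set (c ⊔ ℓ) where
      field
        coefficients : F HasCoefficientsIn ⟦ Fq ⟧
        degree       : ℕ
        hasDegree    : HasDegree F degree
        {{degree>0}} : NonZero degree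
        minimal      : HasCardinality (ValueSet F) ((q ℕ.∸ 1) / degree ℕ.+ 1)

    𝒫 : {s : Level} → Pred Carrier s → Pred Poly (c ⊔ ℓ ⊔ s)
    𝒫 S F = IsMVSP F × ValueSet F ≐ S

-- K is infinite, so polynomials may be compared as functions on K. Write r = p^k, N = #U, Q = p^(dk),
-- q = p^n.
--
-- Existence of M. Replacing L by L^r - L(v)^(r-1) L enlarges the F_r-space of roots of a linearized L
-- by v. Starting from L = x this leads to A, and on from A to x^Q - x, which is therefore M ∘ A for a
-- linearized M. As A has coefficients in F_Q, A(M(A(x))) = A(x)^Q - A(x), and A is surjective on K.
--
-- Compositions. M maps F_Q onto U because A(M(z)) = z^Q - z, and the value set sizes agree because
-- deg M = Q / N.
--
-- Decomposition. Let F be an MVSP with values U, of degree D. Then y = A(F) vanishes on F_q, so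
-- y = (x^q - x) B with deg B < D. At exponents not divisible by r only the linear term of A contributes
-- to y, and comparing coefficients there shows that B is a polynomial in x^r. Consequently, for each e
-- not divisible by r, among the coefficients of y at e, er, er², … at most one besides the
-- first is nonzero. These coefficients form a linearized polynomial A ∘ Φ, where Φ collects the
-- coefficients of F at the same exponents. It cannot be a monomial as A(1) = 0, and if it is
-- η₀ x + η x^(r^j), then 1 ∈ U forces u^(r^j) = u on U and η = - η₀^(r^j). Minimality of d gives
-- d ∣ j, hence y = f^Q - f = A(M(f)) for some f over F_q; so F - M(f) is a constant in U, which can be
-- absorbed into f. Comparing degrees in f^Q - f = (x^q - x) B shows that f is an MVSP with values F_Q.
module Submission where

-- The decomposition turns on the window `q ≤ m < 2 q`. In `y = x^q B - x B` with `deg B < D < q`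
-- and `B` a polynomial in `x^r`, the summand `x B` only has exponents congruent to 1 modulo `r`. So
-- every exponent of `y` divisible by `r` comes from `x^q B` and lies in the window. As `r ≥ 2`,
-- successive members of `e r, e r², …` at least double, and at most one of them fits. The question
-- thereby becomes which composites `A ∘ Φ` of linearized polynomials have at most two terms. The
-- inequality `deg B < D` restates minimality of `F`, while minimality of `f` amounts to
-- `deg B < deg f`, which is stronger in general because `deg f = D / deg M`. It follows from the
-- exponent `deg B + 1`: this is not divisible by `r` and occurs in `y = f^Q - f`, hence in `f`,
-- since `f^Q` only has exponents divisible by `r`.

open import Defs
open import Algebra.Bundles using (CommutativeRing; RawRing)
open import Algebra.Solver.Ring.AlmostCommutativeRing using (_-Raw-AlmostCommutative⟶_; fromCommutativeRing)
open import Data.Empty using (⊥; ⊥-elim)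
open import Data.Fin.Base as Fin using (inject₁; fromℕ)
import Data.Fin.Properties as Finₚ
open import Data.List.Base using (List; []; _∷_; _++_; length; map; foldr; filter; take; replicate; applyUpTo; cartesianProductWith)
import Data.List.Membership.Setoid as Membership
import Data.List.Membership.Setoid.Properties as Membershipₚ
import Data.List.Properties as Listₚ
import Data.List.Relation.Binary.Permutation.Setoid as Permutation
import Data.List.Relation.Binary.Permutation.Setoid.Properties as Permutationₚ
open import Data.List.Relation.Unary.All using ([]; _∷_)
open import Data.List.Relation.Unary.AllPairs using ([]; _∷_)
open import Data.List.Relation.Unary.Any as Any using (here; there)
import Data.List.Relation.Unary.Unique.Setoid as Uniqueness
import Data.List.Relation.Unary.Unique.Setoid.Properties as Uniqueₚ
open import Data.Maybe.Base using (Maybe; just; nothing)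
open import Data.Nat.Base as ℕ using (ℕ; zero; suc; NonZero; _<_; _≤_; _^_; z≤n; s≤s; _!)
open import Data.Nat.Combinatorics using (_C_; nCn≡1; nCk≡n!/k![n-k]!; k![n∸k]!∣n!)
open import Data.Nat.Divisibility as ℕᵈ using (_∣_; _∤_; divides; _∣?_)
open import Data.Nat.DivMod as ℕᵐ using (_/_)
open import Data.Nat.GCD using (gcd; gcd-GCD; gcd[m,n]∣m; gcd[m,n]∣n; gcd[m,n]≢0; module Bézout)
open import Data.Nat.Primality using (Prime; euclidsLemma; ¬prime[0]; ¬prime[1]; prime⇒nonTrivial)
import Data.Nat.Properties as ℕₚ
open import Data.Product.Base using (∃; ∃₂; _×_; _,_; proj₁; proj₂)
open import Data.Sum.Base as Sum using (_⊎_; inj₁; inj₂)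
open import Function.Base using (_∘_)
open import Function.Bundles using (mk⇔; module Equivalence)
open import Level using (Level; _⊔_)
open import Relation.Binary.Bundles using (Setoid)
open import Relation.Binary.Definitions using (tri<; tri≈; tri>)
open import Relation.Binary.PropositionalEquality.Core as ≡ using (_≡_; _≢_)
open import Relation.Nullary using (¬_; Dec; yes; no; contradiction)
open import Relation.Nullary.Decidable using (¬?)
open import Relation.Unary using (Pred; _⊆_; _≐_)

-- The coefficients are integers, the pair (m , n) standing for m − n.
module DifferenceSolver {c ℓ : Level} (R : CommutativeRing c ℓ) where

  open CommutativeRing R hiding (zero)
  open import Algebra.Properties.Ring ring using (-‿distribˡ-*; -‿distribʳ-*)
  open import Algebra.Properties.Group +-group using (⁻¹-involutive; ε⁻¹≈ε)
  open import Algebra.Properties.AbelianGroup +-abelianGroup using (⁻¹-∙-comm)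
  open import Algebra.Properties.CommutativeSemigroup +-commutativeSemigroup using (interchange)
  open import Algebra.Properties.Semiring.Mult.TCOptimised semiring
    using (×-homo-+; ×1-homo-*) renaming (_×_ to _×ᵣ_)
  open import Relation.Binary.Reasoning.Setoid setoid

  differences : RawRing _ _
  differences = record
    { Carrier = ℕ × ℕ
    ; _≈_     = _≡_
    ; _+_     = λ (a , b) (c , d) → a ℕ.+ c , b ℕ.+ d
    ; _*_     = λ (a , b) (c , d) → a ℕ.* c ℕ.+ b ℕ.* d , a ℕ.* d ℕ.+ b ℕ.* c
    ; -_      = λ (a , b) → b , a
    ; 0#      = 0 , 0
    ; 1#      = 1 , 0
    }

  -- The case split lets `con (0 , 0)` and `con (1 , 0)` reduce to `0#` and `1#` with no subtracted
  -- zero. Hence `0-homo` and `1-homo` are `refl`, and solver goals match the equations as they are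
  -- written.
  ⟦_⟧ᵈ : ℕ × ℕ → Carrier
  ⟦ a , zero  ⟧ᵈ = a ×ᵣ 1#
  ⟦ a , suc b ⟧ᵈ = a ×ᵣ 1# - suc b ×ᵣ 1#

  ⟦⟧ᵈ-difference : ∀ x → ⟦ x ⟧ᵈ ≈ proj₁ x ×ᵣ 1# - proj₂ x ×ᵣ 1#
  ⟦⟧ᵈ-difference (a , zero)  = sym (trans (+-congˡ ε⁻¹≈ε) (+-identityʳ _))
  ⟦⟧ᵈ-difference (a , suc b) = refl

  +-difference : ∀ a b c d → (a + c) - (b + d) ≈ (a - b) + (c - d)
  +-difference a b c d = begin
    (a + c) - (b + d)       ≈⟨ +-congˡ (⁻¹-∙-comm b d) ⟨
    (a + c) + (- b + - d)   ≈⟨ interchange a c (- b) (- d) ⟩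
    (a - b) + (c - d)       ∎

  *-difference : ∀ a b c d → (a * c + b * d) - (a * d + b * c) ≈ (a - b) * (c - d)
  *-difference a b c d = begin
    (a * c + b * d) - (a * d + b * c)               ≈⟨ +-difference _ _ _ _ ⟩
    (a * c - a * d) + (b * d - b * c)               ≈⟨ +-cong (+-congˡ (-‿distribʳ-* a d)) (trans (+-comm _ _) (+-congˡ (sym (⁻¹-involutive _)))) ⟩
    (a * c + a * - d) + (- (b * c) - - (b * d))     ≈⟨ +-cong (sym (distribˡ a c (- d))) (+-cong (-‿distribˡ-* b c) (trans (-‿cong (-‿distribˡ-* b d)) (-‿distribʳ-* _ d))) ⟩
    a * (c - d) + (- b * c + - b * - d)             ≈⟨ +-congˡ (distribˡ (- b) c (- d)) ⟨
    a * (c - d) + - b * (c - d)                     ≈⟨ distribʳ (c - d) a (- b) ⟨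
    (a - b) * (c - d)                               ∎

  homomorphism : differences -Raw-AlmostCommutative⟶ fromCommutativeRing R
  homomorphism = record
    { ⟦_⟧    = ⟦_⟧ᵈ
    ; +-homo = λ x@(a , b) y@(c , d) → begin
        ⟦ a ℕ.+ c , b ℕ.+ d ⟧ᵈ                                   ≈⟨ ⟦⟧ᵈ-difference (a ℕ.+ c , b ℕ.+ d) ⟩
        (a ℕ.+ c) ×ᵣ 1# - (b ℕ.+ d) ×ᵣ 1#                        ≈⟨ +-cong (×-homo-+ 1# a c) (-‿cong (×-homo-+ 1# b d)) ⟩
        (a ×ᵣ 1# + c ×ᵣ 1#) - (b ×ᵣ 1# + d ×ᵣ 1#)                ≈⟨ +-difference _ _ _ _ ⟩
        (a ×ᵣ 1# - b ×ᵣ 1#) + (c ×ᵣ 1# - d ×ᵣ 1#)                ≈⟨ +-cong (⟦⟧ᵈ-difference x) (⟦⟧ᵈ-difference y) ⟨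
        ⟦ x ⟧ᵈ + ⟦ y ⟧ᵈ                                          ∎
    ; *-homo = λ x@(a , b) y@(c , d) → begin
        ⟦ a ℕ.* c ℕ.+ b ℕ.* d , a ℕ.* d ℕ.+ b ℕ.* c ⟧ᵈ           ≈⟨ ⟦⟧ᵈ-difference (a ℕ.* c ℕ.+ b ℕ.* d , a ℕ.* d ℕ.+ b ℕ.* c) ⟩
        (a ℕ.* c ℕ.+ b ℕ.* d) ×ᵣ 1# - (a ℕ.* d ℕ.+ b ℕ.* c) ×ᵣ 1# ≈⟨ +-cong (×-homo-+*+ a c b d) (-‿cong (×-homo-+*+ a d b c)) ⟩
        (a ×ᵣ 1# * c ×ᵣ 1# + b ×ᵣ 1# * d ×ᵣ 1#) - (a ×ᵣ 1# * d ×ᵣ 1# + b ×ᵣ 1# * c ×ᵣ 1#) ≈⟨ *-difference _ _ _ _ ⟩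
        (a ×ᵣ 1# - b ×ᵣ 1#) * (c ×ᵣ 1# - d ×ᵣ 1#)                ≈⟨ *-cong (⟦⟧ᵈ-difference x) (⟦⟧ᵈ-difference y) ⟨
        ⟦ x ⟧ᵈ * ⟦ y ⟧ᵈ                                          ∎
    ; -‿homo = λ x@(a , b) → begin
        ⟦ b , a ⟧ᵈ                       ≈⟨ ⟦⟧ᵈ-difference (b , a) ⟩
        b ×ᵣ 1# - a ×ᵣ 1#                ≈⟨ +-comm _ _ ⟩
        - (a ×ᵣ 1#) + b ×ᵣ 1#            ≈⟨ +-congˡ (⁻¹-involutive _) ⟨
        - (a ×ᵣ 1#) - - (b ×ᵣ 1#)        ≈⟨ ⁻¹-∙-comm _ _ ⟩
        - (a ×ᵣ 1# - b ×ᵣ 1#)            ≈⟨ -‿cong (⟦⟧ᵈ-difference x) ⟨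
        - ⟦ x ⟧ᵈ                         ∎
    ; 0-homo = refl
    ; 1-homo = refl
    }
    where
    ×-homo-+*+ : ∀ a b c d → (a ℕ.* b ℕ.+ c ℕ.* d) ×ᵣ 1# ≈ a ×ᵣ 1# * b ×ᵣ 1# + c ×ᵣ 1# * d ×ᵣ 1#
    ×-homo-+*+ a b c d = trans (×-homo-+ 1# (a ℕ.* b) (c ℕ.* d)) (+-cong (×1-homo-* a b) (×1-homo-* c d))

  difference-≈ : ∀ {a b c d} → a + d ≈ c + b → a - b ≈ c - d
  difference-≈ {a} {b} {c} {d} eq = begin
    a - b                  ≈⟨ +-identityʳ _ ⟨
    (a - b) + 0#           ≈⟨ +-congˡ (-‿inverseʳ d) ⟨
    (a - b) + (d - d)      ≈⟨ interchange a (- b) d (- d) ⟩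
    (a + d) + (- b - d)    ≈⟨ +-cong eq (+-comm _ _) ⟩
    (c + b) + (- d - b)    ≈⟨ interchange c b (- d) (- b) ⟩
    (c - d) + (b - b)      ≈⟨ +-congˡ (-‿inverseʳ b) ⟩
    (c - d) + 0#           ≈⟨ +-identityʳ _ ⟩
    c - d                  ∎

  _≟ᵈ_ : ∀ x y → Maybe (⟦ x ⟧ᵈ ≈ ⟦ y ⟧ᵈ)
  x@(a , b) ≟ᵈ y@(c , d) with a ℕ.+ d ℕₚ.≟ c ℕ.+ b
  ... | no _   = nothing
  ... | yes eq = just (begin
    ⟦ x ⟧ᵈ                ≈⟨ ⟦⟧ᵈ-difference x ⟩
    a ×ᵣ 1# - b ×ᵣ 1#     ≈⟨ difference-≈ (begin
      a ×ᵣ 1# + d ×ᵣ 1#     ≈⟨ ×-homo-+ 1# a d ⟨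
      (a ℕ.+ d) ×ᵣ 1#       ≡⟨ ≡.cong (_×ᵣ 1#) eq ⟩
      (c ℕ.+ b) ×ᵣ 1#       ≈⟨ ×-homo-+ 1# c b ⟩
      c ×ᵣ 1# + b ×ᵣ 1#     ∎) ⟩
    c ×ᵣ 1# - d ×ᵣ 1#     ≈⟨ ⟦⟧ᵈ-difference y ⟨
    ⟦ y ⟧ᵈ                ∎)

  open import Algebra.Solver.Ring differences (fromCommutativeRing R) homomorphism _≟ᵈ_ public
    using (solve; con; _:+_; _:*_; _:-_; :-_; _:=_)

-- Binomial coefficients modulo a prime.

prime∤! : ∀ {p} → Prime p → ∀ m → m < p → ¬ p ∣ m !
prime∤! pr zero    _   p∣1 = ¬prime[1] (≡.subst Prime (ℕᵈ.∣1⇒≡1 p∣1) pr)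
prime∤! pr (suc m) m<p p∣  with euclidsLemma (suc m) (m !) pr p∣
... | inj₁ p∣m  = ℕₚ.<⇒≱ m<p (ℕᵈ.∣⇒≤ p∣m)
... | inj₂ p∣m! = prime∤! pr m (ℕₚ.<-trans (ℕₚ.n<1+n m) m<p) p∣m!

-- The product of `p C k` with `k !` and `(p ∸ k) !` is `p !`, which `p` divides, while `p` divides
-- neither factorial because both arguments are below `p`.
prime∣C : ∀ {p k} → Prime p → 0 < k → k < p → p ∣ p C k
prime∣C {suc p-1} {k} pr 0<k k<p = result
  where
  p = suc p-1
  denominator = k ! ℕ.* (p ℕ.∸ k) !
  instance _ = ℕₚ._!*_!≢0 k (p ℕ.∸ k)

  C*k!*[p∸k]!≡p! : (p C k) ℕ.* denominator ≡ p !
  C*k!*[p∸k]!≡p! = ≡.trans (≡.cong (ℕ._* denominator) (nCk≡n!/k![n-k]! (ℕₚ.<⇒≤ k<p)))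
                           (ℕᵐ.m/n*n≡m (k![n∸k]!∣n! (ℕₚ.<⇒≤ k<p)))

  result : p ∣ p C k
  result with euclidsLemma (p C k) denominator pr (≡.subst (p ∣_) (≡.sym C*k!*[p∸k]!≡p!) (ℕᵈ.m∣m*n (p-1 !)))
  ... | inj₁ p∣C = p∣C
  ... | inj₂ p∣d with euclidsLemma (k !) ((p ℕ.∸ k) !) pr p∣d
  ...   | inj₁ p∣k!     = contradiction p∣k! (prime∤! pr k k<p)
  ...   | inj₂ p∣[p∸k]! = contradiction p∣[p∸k]! (prime∤! pr (p ℕ.∸ k) (ℕₚ.∸-monoʳ-< 0<k (ℕₚ.<⇒≤ k<p)))

-- Pigeonhole principles for repetition-free lists.

module UniqueLists {c ℓ : Level} (S : Setoid c ℓ) where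

  open Setoid S
  open Membership S using (_∈_)
  open Uniqueness S using (Unique)
  open Permutation S using (_↭_; ↭-refl; ↭-sym; ↭-trans; ↭-prep; ↭-swap)
  open Permutationₚ S using (∈-resp-↭; xs↭ys⇒|xs|≡|ys|; Unique-resp-↭; ++-identityʳ)

  ∈⇒↭∷ : ∀ {x xs} → x ∈ xs → ∃ λ ys → xs ↭ x ∷ ys
  ∈⇒↭∷ (here x≈y)            = _ , Permutation.prep (sym x≈y) ↭-refl
  ∈⇒↭∷ (there {x = y} x∈xs) with ∈⇒↭∷ x∈xs
  ... | ys , p = y ∷ ys , ↭-trans (↭-prep _ p) (↭-swap _ _ ↭-refl)

  -- Each head of `ys` is extracted from `xs`; uniqueness ensures that the remaining elements of
  -- `ys` are still found in what is left. The leftover `zs` measures the difference of the lengths,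
  -- which yields both counting lemmas below.
  unique⊆⇒↭++ : ∀ {xs} ys → Unique ys → (∀ {y} → y ∈ ys → y ∈ xs) → ∃ λ zs → xs ↭ ys ++ zs
  unique⊆⇒↭++ []       _          _     = _ , ↭-refl
  unique⊆⇒↭++ {xs} (y ∷ ys) (y∉ys ∷ u) ys⊆xs with ∈⇒↭∷ (ys⊆xs (here refl))
  ... | xs′ , p with unique⊆⇒↭++ ys u ys⊆xs′
    where
    ys⊆xs′ : ∀ {z} → z ∈ ys → z ∈ xs′
    ys⊆xs′ z∈ys with ∈-resp-↭ p (ys⊆xs (there z∈ys))
    ... | here z≈y   = ⊥-elim (Membershipₚ.All[≉]⇒∉ S y∉ys (Membershipₚ.∈-resp-≈ S z≈y z∈ys))
    ... | there z∈xs′ = z∈xs′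
  ... | zs , q = zs , ↭-trans p (↭-prep y q)

  unique⊆⇒length≤ : ∀ {xs ys} → Unique ys → (∀ {y} → y ∈ ys → y ∈ xs) → length ys ≤ length xs
  unique⊆⇒length≤ {xs} {ys} u ys⊆xs with unique⊆⇒↭++ ys u ys⊆xs
  ... | zs , p = ≡.subst (length ys ≤_) (≡.sym (≡.trans (xs↭ys⇒|xs|≡|ys| p) (Listₚ.length-++ ys)))
                         (ℕₚ.m≤m+n (length ys) (length zs))

  unique⊆∧length≤⇒↭ : ∀ {xs ys} → Unique ys → (∀ {y} → y ∈ ys → y ∈ xs) → length xs ≤ length ys → xs ↭ ys
  unique⊆∧length≤⇒↭ {xs} {ys} u ys⊆xs xs≤ys with unique⊆⇒↭++ ys u ys⊆xs
  ... | []     , p = ↭-trans p (++-identityʳ ys)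
  ... | z ∷ zs , p = contradiction xs≤ys (ℕₚ.<⇒≱ (≡.subst (length ys <_)
                       (≡.sym (≡.trans (xs↭ys⇒|xs|≡|ys| p) (Listₚ.length-++ ys))) (ℕₚ.m<m+n (length ys) (s≤s z≤n))))

-- Field arithmetic, finite subfields and Frobenius maps.

module FieldProperties {c ℓ : Level} (K : Field c ℓ) where

  open Over K hiding (zero)
  open Membership setoid using (_∈_; _∉_)
  open Uniqueness setoid using (Unique)
  open UniqueLists setoid public
  open Permutation setoid using (_↭_; ↭-sym)
  open Permutationₚ setoid using (∈-resp-↭; xs↭ys⇒|xs|≡|ys|; Unique-resp-↭; foldr-commMonoid)
  open DifferenceSolver commutativeRing public using (solve; con; _:+_; _:*_; _:-_; :-_; _:=_)
  open import Algebra.Properties.Ring ring public using (-‿distribˡ-*)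
  open import Algebra.Properties.Group +-group public
    using () renaming (⁻¹-involutive to -‿involutive; ε⁻¹≈ε to -0≈0; x∙y⁻¹≈ε⇒x≈y to x-y≈0⇒x≈y; x≈y⇒x∙y⁻¹≈ε to x≈y⇒x-y≈0; inverseʳ-unique to x+y≈0⇒y≈-x)
  open import Algebra.Properties.CommutativeSemiring.Exp commutativeSemiring public
    using (^-congˡ; ^-congʳ; ^-assocʳ; ^-distrib-*) renaming (_^_ to infixr 8 _↑_)
  open import Algebra.Properties.Semiring.Mult semiring
    using (×-homo-+; ×1-homo-*; ×-assoc-*; ×-congʳ) renaming (_×_ to _×ᵣ_)
  import Algebra.Properties.CommutativeSemiring.Binomial commutativeSemiring as Binomial
  open import Algebra.Properties.Semiring.Sum semiring using (sum; sum-init-last; sum-cong-≋; sum-replicate-zero)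
  open import Relation.Binary.Reasoning.Setoid setoid

  xy≈0⇒y≈0 : ∀ {x y} → x ≉ 0# → x * y ≈ 0# → y ≈ 0#
  xy≈0⇒y≈0 {x} {y} x≉0 xy≈0 with inverse x x≉0
  ... | z , xz≈1 = begin
    y              ≈⟨ *-identityˡ y ⟨
    1# * y         ≈⟨ *-congʳ xz≈1 ⟨
    x * z * y      ≈⟨ solve 3 (λ x y z → x :* z :* y := z :* (x :* y)) refl x y z ⟩
    z * (x * y)    ≈⟨ *-congˡ xy≈0 ⟩
    z * 0#         ≈⟨ zeroʳ z ⟩
    0#             ∎

  xy≈0⇒x≈0⊎y≈0 : ∀ {x y} → x * y ≈ 0# → x ≈ 0# ⊎ y ≈ 0#
  xy≈0⇒x≈0⊎y≈0 {x} eq with x ≟ 0#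
  ... | yes x≈0 = inj₁ x≈0
  ... | no  x≉0 = inj₂ (xy≈0⇒y≈0 x≉0 eq)

  *-≉0 : ∀ {x y} → x ≉ 0# → y ≉ 0# → x * y ≉ 0#
  *-≉0 x≉0 y≉0 xy≈0 = y≉0 (xy≈0⇒y≈0 x≉0 xy≈0)

  *-cancelˡ : ∀ {x y z} → x ≉ 0# → x * y ≈ x * z → y ≈ z
  *-cancelˡ {x} {y} {z} x≉0 eq = x-y≈0⇒x≈y y z (xy≈0⇒y≈0 x≉0 (begin
    x * (y - z)      ≈⟨ solve 3 (λ x y z → x :* (y :- z) := x :* y :- x :* z) refl x y z ⟩
    x * y - x * z    ≈⟨ x≈y⇒x-y≈0 eq ⟩
    0#               ∎))

  1≉0 : 1# ≉ 0#
  1≉0 1≈0 = 0≉1 (sym 1≈0)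

  0↑n≈0 : ∀ {n} → 0 < n → 0# ↑ n ≈ 0#
  0↑n≈0 {suc n} _ = zeroˡ _

  1↑n≈1 : ∀ n → 1# ↑ n ≈ 1#
  1↑n≈1 zero    = refl
  1↑n≈1 (suc n) = trans (*-identityˡ _) (1↑n≈1 n)

  x↑n≈0⇒x≈0 : ∀ {x} n → x ↑ n ≈ 0# → x ≈ 0#
  x↑n≈0⇒x≈0 zero    1≈0 = ⊥-elim (1≉0 1≈0)
  x↑n≈0⇒x≈0 (suc n) eq with xy≈0⇒x≈0⊎y≈0 eq
  ... | inj₁ x≈0 = x≈0
  ... | inj₂ x↑n≈0 = x↑n≈0⇒x≈0 n x↑n≈0

  sumₗ prodₗ : List Carrier → Carrier
  sumₗ  = foldr _+_ 0#
  prodₗ = foldr _*_ 1#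

  sumₗ-map-+ : ∀ a xs → sumₗ (map (a +_) xs) ≈ length xs ×ᵣ a + sumₗ xs
  sumₗ-map-+ a []       = sym (+-identityˡ 0#)
  sumₗ-map-+ a (x ∷ xs) = trans (+-congˡ (sumₗ-map-+ a xs))
    (solve 4 (λ a x m s → a :+ x :+ (m :+ s) := a :+ m :+ (x :+ s)) refl a x (length xs ×ᵣ a) (sumₗ xs))

  prodₗ-map-* : ∀ a xs → prodₗ (map (a *_) xs) ≈ a ↑ length xs * prodₗ xs
  prodₗ-map-* a []       = sym (*-identityˡ 1#)
  prodₗ-map-* a (x ∷ xs) = trans (*-congˡ (prodₗ-map-* a xs))
    (solve 4 (λ a x m s → a :* x :* (m :* s) := a :* m :* (x :* s)) refl a x (a ↑ length xs) (prodₗ xs))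

  prodₗ≉0 : ∀ xs → (∀ {x} → x ∈ xs → x ≉ 0#) → prodₗ xs ≉ 0#
  prodₗ≉0 []       _   = 1≉0
  prodₗ≉0 (x ∷ xs) ≉0  = *-≉0 (≉0 (here refl)) (prodₗ≉0 xs (≉0 ∘ there))

  prodₗ≈0 : ∀ {xs} → 0# ∈ xs → prodₗ xs ≈ 0#
  prodₗ≈0 (here 0≈x) = trans (*-congʳ (sym 0≈x)) (zeroˡ _)
  prodₗ≈0 (there 0∈) = trans (*-congˡ (prodₗ≈0 0∈)) (zeroʳ _)

  module _ {N : ℕ} (F : Subfield N) where

    open Subfield F

    private
      Unique-map : ∀ {f : Carrier → Carrier} → (∀ {x y} → f x ≈ f y → x ≈ y) →
                   ∀ {xs} → Unique xs → Unique (map f xs)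
      Unique-map inj = Uniqueₚ.map⁺ setoid setoid inj

    -- Translation by 1 permutes the elements, so it leaves their sum unchanged.
    order×1≈0 : N ×ᵣ 1# ≈ 0#
    order×1≈0 = begin
      N ×ᵣ 1#                                          ≡⟨ ≡.cong (_×ᵣ 1#) order ⟨
      n ×ᵣ 1#                                          ≈⟨ solve 2 (λ m s → m := m :+ s :- s) refl (n ×ᵣ 1#) (sumₗ elements) ⟩
      n ×ᵣ 1# + sumₗ elements - sumₗ elements          ≈⟨ +-congʳ (sumₗ-map-+ 1# elements) ⟨
      sumₗ (map (1# +_) elements) - sumₗ elements      ≈⟨ x≈y⇒x-y≈0 (sym (foldr-commMonoid +-isCommutativeMonoid perm)) ⟩
      0#                                               ∎
      where
      n = length elements
      perm : elements ↭ map (1# +_) elements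
      perm = unique⊆∧length≤⇒↭ (Unique-map (λ {x} {y} eq → x-y≈0⇒x≈y x y (begin
          x - y                    ≈⟨ solve 3 (λ o x y → x :- y := o :+ x :- (o :+ y)) refl 1# x y ⟩
          1# + x - (1# + y)        ≈⟨ x≈y⇒x-y≈0 eq ⟩
          0#                       ∎)) unique)
        closed (ℕₚ.≤-reflexive (≡.sym (Listₚ.length-map (1# +_) elements)))
        where
        closed : ∀ {y} → y ∈ map (1# +_) elements → y ∈ elements
        closed y∈ with Membershipₚ.∈-map⁻ setoid setoid y∈
        ... | x , x∈ , y≈1+x = Membershipₚ.∈-resp-≈ setoid (sym y≈1+x) (+-closed 1-closed x∈)

    -- Multiplication by a nonzero `x` permutes the nonzero elements of `F`. Comparing their product
    -- before and after, and cancelling it, gives `x ↑ (N - 1) ≈ 1#`.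
    x∈F⇒x↑N≈x : ∀ {x} → x ∈ elements → x ↑ N ≈ x
    x∈F⇒x↑N≈x {x} x∈F with ∈⇒↭∷ 0-closed | x ≟ 0#
    ... | units , p | yes x≈0 = begin
      x ↑ N      ≈⟨ ^-congˡ N x≈0 ⟩
      0# ↑ N     ≈⟨ 0↑n≈0 (≡.subst (0 <_) (≡.trans (≡.sym (xs↭ys⇒|xs|≡|ys| p)) order) (s≤s z≤n)) ⟩
      0#         ≈⟨ x≈0 ⟨
      x          ∎
    ... | units , p | no x≉0 = begin
      x ↑ N                   ≡⟨ ≡.cong (x ↑_) (≡.trans (≡.sym order) (xs↭ys⇒|xs|≡|ys| p)) ⟩
      x * x ↑ length units    ≈⟨ *-congˡ x↑n≈1 ⟩
      x * 1#                  ≈⟨ *-identityʳ x ⟩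
      x                       ∎
      where
      0∉units : 0# ∉ units
      0∉units with Unique-resp-↭ p unique
      ... | 0∉ ∷ _ = Membershipₚ.All[≉]⇒∉ setoid 0∉

      uniqueUnits : Unique units
      uniqueUnits with Unique-resp-↭ p unique
      ... | _ ∷ u = u

      unit≉0 : ∀ {y} → y ∈ units → y ≉ 0#
      unit≉0 y∈ y≈0 = 0∉units (Membershipₚ.∈-resp-≈ setoid y≈0 y∈)

      closed : ∀ {y} → y ∈ map (x *_) units → y ∈ units
      closed y∈ with Membershipₚ.∈-map⁻ setoid setoid y∈
      ... | z , z∈ , y≈xz with ∈-resp-↭ p (*-closed x∈F (∈-resp-↭ (↭-sym p) (there z∈)))
      ...   | here xz≈0 = ⊥-elim (*-≉0 x≉0 (unit≉0 z∈) xz≈0)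
      ...   | there xz∈ = Membershipₚ.∈-resp-≈ setoid (sym y≈xz) xz∈

      x↑n≈1 : x ↑ length units ≈ 1#
      x↑n≈1 = *-cancelˡ (prodₗ≉0 units unit≉0) (begin
        prodₗ units * x ↑ length units     ≈⟨ *-comm _ _ ⟩
        x ↑ length units * prodₗ units     ≈⟨ prodₗ-map-* x units ⟨
        prodₗ (map (x *_) units)           ≈⟨ foldr-commMonoid *-isCommutativeMonoid
                                               (unique⊆∧length≤⇒↭ (Unique-map (*-cancelˡ x≉0) uniqueUnits) closed
                                                 (ℕₚ.≤-reflexive (≡.sym (Listₚ.length-map (x *_) units)))) ⟨
        prodₗ units                        ≈⟨ *-identityʳ _ ⟨
        prodₗ units * 1#                   ∎)

  -- The characteristic of `K` is not assumed but read off from a subfield with `p ^ n` elements: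
  -- `order×1≈0` supplies the premise, and the absence of zero divisors does the rest.
  p^n×1≈0⇒p×1≈0 : ∀ p n → (p ℕ.^ n) ×ᵣ 1# ≈ 0# → p ×ᵣ 1# ≈ 0#
  p^n×1≈0⇒p×1≈0 p zero    eq = ⊥-elim (1≉0 (trans (sym (+-identityʳ 1#)) eq))
  p^n×1≈0⇒p×1≈0 p (suc n) eq with xy≈0⇒x≈0⊎y≈0 (trans (sym (×1-homo-* p (p ℕ.^ n))) eq)
  ... | inj₁ p×1≈0 = p×1≈0
  ... | inj₂ rest  = p^n×1≈0⇒p×1≈0 p n rest

  Frobenius : ℕ → Set (c ⊔ ℓ)
  Frobenius r = ∀ x y → (x + y) ↑ r ≈ x ↑ r + y ↑ r

  -- In the binomial expansion `p` divides every coefficient except the first and the last, so only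
  -- the two extreme terms survive.
  frobenius-prime : ∀ {p} → Prime p → p ×ᵣ 1# ≈ 0# → Frobenius p
  frobenius-prime {zero}  pr _ = ⊥-elim (¬prime[0] pr)
  frobenius-prime {suc zero}  pr _ = ⊥-elim (¬prime[1] pr)
  frobenius-prime {p@(suc (suc p-2))} pr p×1≈0 x y = begin
    (x + y) ↑ p                                   ≈⟨ Binomial.theorem p x y ⟩
    term Fin.zero + sum (term ∘ Fin.suc)          ≈⟨ +-congˡ (sum-init-last (term ∘ Fin.suc)) ⟩
    term Fin.zero + (sum (term ∘ Fin.suc ∘ inject₁) + term (Fin.suc (fromℕ (suc p-2))))
      ≈⟨ +-cong first (+-cong (trans (sum-cong-≋ middle) (sum-replicate-zero (suc p-2))) last) ⟩
    y ↑ p + (0# + x ↑ p)                          ≈⟨ solve 2 (λ a b → b :+ (con (0 , 0) :+ a) := a :+ b) refl (x ↑ p) (y ↑ p) ⟩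
    x ↑ p + y ↑ p                                 ∎
    where
    term = Binomial.binomialTerm x y p

    first : term Fin.zero ≈ y ↑ p
    first = trans (+-identityʳ _) (*-identityˡ _)

    last : term (Fin.suc (fromℕ (suc p-2))) ≈ x ↑ p
    last rewrite Finₚ.toℕ-fromℕ p-2 | nCn≡1 p | ℕₚ.n∸n≡0 p-2 = trans (+-identityʳ _) (*-identityʳ _)

    p∣m⇒m×x≈0 : ∀ {m} x → p ∣ m → m ×ᵣ x ≈ 0#
    p∣m⇒m×x≈0 x (divides q ≡.refl) = begin
      (q ℕ.* p) ×ᵣ x           ≈⟨ ×-congʳ (q ℕ.* p) (*-identityˡ x) ⟨
      (q ℕ.* p) ×ᵣ (1# * x)    ≈⟨ ×-assoc-* (q ℕ.* p) 1# x ⟨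
      (q ℕ.* p) ×ᵣ 1# * x      ≈⟨ *-congʳ (×1-homo-* q p) ⟩
      q ×ᵣ 1# * p ×ᵣ 1# * x    ≈⟨ *-congʳ (*-congˡ p×1≈0) ⟩
      q ×ᵣ 1# * 0# * x         ≈⟨ solve 2 (λ q x → q :* con (0 , 0) :* x := con (0 , 0)) refl (q ×ᵣ 1#) x ⟩
      0#                       ∎

    middle : ∀ i → term (Fin.suc (inject₁ i)) ≈ 0#
    middle i = p∣m⇒m×x≈0 _ (prime∣C pr (s≤s z≤n)
      (s≤s (≡.subst (_< suc p-2) (≡.sym (Finₚ.toℕ-inject₁ i)) (Finₚ.toℕ<n i))))

  frobenius-^ : ∀ {p} → Frobenius p → ∀ m → Frobenius (p ℕ.^ m)
  frobenius-^ F zero x y = begin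
    (x + y) ↑ 1       ≈⟨ *-identityʳ _ ⟩
    x + y             ≈⟨ +-cong (*-identityʳ x) (*-identityʳ y) ⟨
    x ↑ 1 + y ↑ 1     ∎
  frobenius-^ {p} F (suc m) x y = begin
    (x + y) ↑ (p ℕ.* p ℕ.^ m)                        ≈⟨ ^-assocʳ (x + y) p (p ℕ.^ m) ⟨
    ((x + y) ↑ p) ↑ (p ℕ.^ m)                        ≈⟨ ^-congˡ (p ℕ.^ m) (F x y) ⟩
    (x ↑ p + y ↑ p) ↑ (p ℕ.^ m)                      ≈⟨ frobenius-^ F m _ _ ⟩
    (x ↑ p) ↑ (p ℕ.^ m) + (y ↑ p) ↑ (p ℕ.^ m)        ≈⟨ +-cong (^-assocʳ x p (p ℕ.^ m)) (^-assocʳ y p (p ℕ.^ m)) ⟩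
    x ↑ (p ℕ.* p ℕ.^ m) + y ↑ (p ℕ.* p ℕ.^ m)        ∎

-- Polynomials: evaluation, roots, leading terms, algebraic closedness.

module PolynomialProperties {c ℓ : Level} (K : Field c ℓ) where

  open Over K hiding (zero)
  open Membership setoid using (_∈_; _∉_)
  open Uniqueness setoid using (Unique)
  open FieldProperties K
  open import Relation.Binary.Reasoning.Setoid setoid

  eval-cong : ∀ P {x y} → x ≈ y → eval P x ≈ eval P y
  eval-cong []      _   = refl
  eval-cong (a ∷ P) x≈y = +-congˡ (*-cong x≈y (eval-cong P x≈y))

  eval-≈[] : ∀ P x → P ≈ₚ [] → eval P x ≈ 0#
  eval-≈[] []      x _    = refl
  eval-≈[] (a ∷ P) x P≈[] = begin
    a + x * eval P x    ≈⟨ +-cong (P≈[] 0) (*-congˡ (eval-≈[] P x (P≈[] ∘ suc))) ⟩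
    0# + x * 0#         ≈⟨ solve 1 (λ x → con (0 , 0) :+ x :* con (0 , 0) := con (0 , 0)) refl x ⟩
    0#                  ∎

  eval-≈ₚ : ∀ P Q x → P ≈ₚ Q → eval P x ≈ eval Q x
  eval-≈ₚ []      Q       x P≈Q = sym (eval-≈[] Q x (λ i → sym (P≈Q i)))
  eval-≈ₚ (a ∷ P) []      x P≈Q = eval-≈[] (a ∷ P) x P≈Q
  eval-≈ₚ (a ∷ P) (b ∷ Q) x P≈Q = +-cong (P≈Q 0) (*-congˡ (eval-≈ₚ P Q x (P≈Q ∘ suc)))

  eval-+ : ∀ P Q x → eval (P +ₚ Q) x ≈ eval P x + eval Q x
  eval-+ []      Q       x = sym (+-identityˡ _)
  eval-+ (a ∷ P) []      x = sym (+-identityʳ _)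
  eval-+ (a ∷ P) (b ∷ Q) x = trans (+-congˡ (*-congˡ (eval-+ P Q x)))
    (solve 5 (λ a b x p q → a :+ b :+ x :* (p :+ q) := a :+ x :* p :+ (b :+ x :* q)) refl a b x (eval P x) (eval Q x))

  eval-· : ∀ a P x → eval (a ·ₚ P) x ≈ a * eval P x
  eval-· a []      x = sym (zeroʳ a)
  eval-· a (b ∷ P) x = trans (+-congˡ (*-congˡ (eval-· a P x)))
    (solve 4 (λ a b x p → a :* b :+ x :* (a :* p) := a :* (b :+ x :* p)) refl a b x (eval P x))

  eval-neg : ∀ P x → eval (map -_ P) x ≈ - eval P x
  eval-neg []      x = sym -0≈0
  eval-neg (a ∷ P) x = trans (+-congˡ (*-congˡ (eval-neg P x)))
    (solve 3 (λ a x p → :- a :+ x :* :- p := :- (a :+ x :* p)) refl a x (eval P x))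

  eval-- : ∀ P Q x → eval (P -ₚ Q) x ≈ eval P x - eval Q x
  eval-- P Q x = trans (eval-+ P (map -_ Q) x) (+-congˡ (eval-neg Q x))

  eval-* : ∀ P Q x → eval (P *ₚ Q) x ≈ eval P x * eval Q x
  eval-* []      Q x = sym (zeroˡ _)
  eval-* (a ∷ P) Q x = begin
    eval ((a ·ₚ Q) +ₚ (0# ∷ (P *ₚ Q))) x               ≈⟨ eval-+ (a ·ₚ Q) (0# ∷ (P *ₚ Q)) x ⟩
    eval (a ·ₚ Q) x + (0# + x * eval (P *ₚ Q) x)       ≈⟨ +-cong (eval-· a Q x) (+-congˡ (*-congˡ (eval-* P Q x))) ⟩
    a * eval Q x + (0# + x * (eval P x * eval Q x))    ≈⟨ solve 4 (λ a x p q → a :* q :+ (con (0 , 0) :+ x :* (p :* q)) := (a :+ x :* p) :* q) refl a x (eval P x) (eval Q x) ⟩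
    (a + x * eval P x) * eval Q x                      ∎

  eval-constant : ∀ a x → eval (constant a) x ≈ a
  eval-constant a x = trans (+-congˡ (zeroʳ x)) (+-identityʳ a)

  eval-∘ : ∀ P Q x → eval (P ∘ₚ Q) x ≈ eval P (eval Q x)
  eval-∘ []      Q x = refl
  eval-∘ (a ∷ P) Q x = begin
    eval ((a ∷ []) +ₚ (Q *ₚ (P ∘ₚ Q))) x              ≈⟨ eval-+ (a ∷ []) (Q *ₚ (P ∘ₚ Q)) x ⟩
    eval (a ∷ []) x + eval (Q *ₚ (P ∘ₚ Q)) x          ≈⟨ +-cong (eval-constant a x) (trans (eval-* Q (P ∘ₚ Q) x) (*-congˡ (eval-∘ P Q x))) ⟩
    a + eval Q x * eval P (eval Q x)                  ∎

  eval-X^ : ∀ m x → eval (X^ m) x ≈ x ↑ m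
  eval-X^ zero    x = eval-constant 1# x
  eval-X^ (suc m) x = trans (+-identityˡ _) (*-congˡ (eval-X^ m x))

  eval-X^∘ : ∀ m P x → eval (X^ m ∘ₚ P) x ≈ eval P x ↑ m
  eval-X^∘ m P x = trans (eval-∘ (X^ m) P x) (eval-X^ m _)

  eval-X : ∀ x → eval X x ≈ x
  eval-X x = trans (eval-X^ 1 x) (*-identityʳ x)

  eval-X-constant : ∀ a x → eval (X -ₚ constant a) x ≈ x - a
  eval-X-constant a x = trans (eval-- X (constant a) x) (+-cong (eval-X x) (-‿cong (eval-constant a x)))

  eval-X^-X : ∀ m x → eval (X^ m -ₚ X) x ≈ x ↑ m - x
  eval-X^-X m x = trans (eval-- (X^ m) X x) (+-cong (eval-X^ m x) (-‿cong (eval-X x)))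

  coeff-+ : ∀ P Q i → coeff (P +ₚ Q) i ≈ coeff P i + coeff Q i
  coeff-+ []      Q       i       = sym (+-identityˡ _)
  coeff-+ (a ∷ P) []      i       = sym (+-identityʳ _)
  coeff-+ (a ∷ P) (b ∷ Q) zero    = refl
  coeff-+ (a ∷ P) (b ∷ Q) (suc i) = coeff-+ P Q i

  coeff-· : ∀ a P i → coeff (a ·ₚ P) i ≈ a * coeff P i
  coeff-· a []      i       = sym (zeroʳ a)
  coeff-· a (b ∷ P) zero    = refl
  coeff-· a (b ∷ P) (suc i) = coeff-· a P i

  coeff-neg : ∀ P i → coeff (map -_ P) i ≈ - coeff P i
  coeff-neg []      i       = sym -0≈0
  coeff-neg (a ∷ P) zero    = refl
  coeff-neg (a ∷ P) (suc i) = coeff-neg P i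

  coeff-- : ∀ P Q i → coeff (P -ₚ Q) i ≈ coeff P i - coeff Q i
  coeff-- P Q i = trans (coeff-+ P (map -_ Q) i) (+-congˡ (coeff-neg Q i))

  coeff-take-< : ∀ m P {i} → i < m → coeff (take m P) i ≡ coeff P i
  coeff-take-< (suc m) []      _                   = ≡.refl
  coeff-take-< (suc m) (a ∷ P) {zero}  _           = ≡.refl
  coeff-take-< (suc m) (a ∷ P) {suc i} (s≤s i<m)   = coeff-take-< m P i<m

  coeff-take-≥ : ∀ m P {i} → m ≤ i → coeff (take m P) i ≡ 0#
  coeff-take-≥ zero    P       _                   = ≡.refl
  coeff-take-≥ (suc m) []      _                   = ≡.refl
  coeff-take-≥ (suc m) (a ∷ P) {suc i} (s≤s m≤i)   = coeff-take-≥ m P m≤i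

  coeff-≥length : ∀ P {i} → length P ≤ i → coeff P i ≡ 0#
  coeff-≥length []      _                 = ≡.refl
  coeff-≥length (a ∷ P) {suc i} (s≤s l≤i) = coeff-≥length P l≤i

  coeff-X^-≡ : ∀ m → coeff (X^ m) m ≡ 1#
  coeff-X^-≡ zero    = ≡.refl
  coeff-X^-≡ (suc m) = coeff-X^-≡ m

  coeff-X^-≢ : ∀ m i → ¬ i ≡ m → coeff (X^ m) i ≡ 0#
  coeff-X^-≢ zero    zero    i≢m = ⊥-elim (i≢m ≡.refl)
  coeff-X^-≢ zero    (suc i) i≢m = ≡.refl
  coeff-X^-≢ (suc m) zero    i≢m = ≡.refl
  coeff-X^-≢ (suc m) (suc i) i≢m = coeff-X^-≢ m i (i≢m ∘ ≡.cong suc)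

  -- The values at b of the successive tails of P are the Horner coefficients of the quotient of
  -- x P(x) by x - b.
  tailValues : Carrier → Poly → Poly
  tailValues b []      = []
  tailValues b (a ∷ P) = eval (a ∷ P) b ∷ tailValues b P

  length-tailValues : ∀ b P → length (tailValues b P) ≡ length P
  length-tailValues b []      = ≡.refl
  length-tailValues b (a ∷ P) = ≡.cong suc (length-tailValues b P)

  eval-tailValues : ∀ b P x → x * eval P x - b * eval P b ≈ (x - b) * eval (tailValues b P) x
  eval-tailValues b []      x = solve 2 (λ x b → x :* con (0 , 0) :- b :* con (0 , 0) := (x :- b) :* con (0 , 0)) refl x b
  eval-tailValues b (a ∷ P) x = begin
    x * (a + x * p) - b * (a + b * p′)
      ≈⟨ solve 5 (λ x b a p p′ → x :* (a :+ x :* p) :- b :* (a :+ b :* p′) := (x :- b) :* (a :+ b :* p′) :+ x :* (x :* p :- b :* p′)) refl x b a p p′ ⟩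
    (x - b) * (a + b * p′) + x * (x * p - b * p′)
      ≈⟨ +-congˡ (*-congˡ (eval-tailValues b P x)) ⟩
    (x - b) * (a + b * p′) + x * ((x - b) * t)
      ≈⟨ solve 4 (λ x b v t → (x :- b) :* v :+ x :* ((x :- b) :* t) := (x :- b) :* (v :+ x :* t)) refl x b (a + b * p′) t ⟩
    (x - b) * (a + b * p′ + x * t) ∎
    where
    p = eval P x
    p′ = eval P b
    t = eval (tailValues b P) x

  tailValues≈[] : ∀ b P → tailValues b P ≈ₚ [] → P ≈ₚ []
  tailValues≈[] b []      _  i       = refl
  tailValues≈[] b (a ∷ P) t≈ (suc i) = tailValues≈[] b P (t≈ ∘ suc) i
  tailValues≈[] b (a ∷ P) t≈ zero    = begin
    a                  ≈⟨ +-identityʳ a ⟨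
    a + 0#             ≈⟨ +-congˡ (zeroʳ b) ⟨
    a + b * 0#         ≈⟨ +-congˡ (*-congˡ (eval-≈[] P b (tailValues≈[] b P (t≈ ∘ suc)))) ⟨
    a + b * eval P b   ≈⟨ t≈ 0 ⟩
    0#                 ∎

  -- The vanishing value at `b` may be subtracted for free, which cancels `a` and leaves
  -- `x P(x) - b P(b)`. The quotient is built from the tail alone and so has one coefficient less,
  -- which drives the inductions over roots below.
  root⇒factor : ∀ b a P → eval (a ∷ P) b ≈ 0# → ∀ x → eval (a ∷ P) x ≈ (x - b) * eval (tailValues b P) x
  root⇒factor b a P root x = begin
    a + x * eval P x
      ≈⟨ solve 3 (λ a u v → a :+ u := (a :+ v) :+ (u :- v)) refl a (x * eval P x) (b * eval P b) ⟩
    (a + b * eval P b) + (x * eval P x - b * eval P b)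
      ≈⟨ +-cong root (eval-tailValues b P x) ⟩
    0# + (x - b) * eval (tailValues b P) x
      ≈⟨ +-identityˡ _ ⟩
    (x - b) * eval (tailValues b P) x ∎

  factor-root : ∀ {b x y} → b ≉ x → (x - b) * y ≈ 0# → y ≈ 0#
  factor-root b≉x = xy≈0⇒y≈0 (λ x-b≈0 → b≉x (sym (x-y≈0⇒x≈y _ _ x-b≈0)))

  private
    quotient-roots : ∀ {b a P bs} → (∀ {x} → x ∈ b ∷ bs → eval (a ∷ P) x ≈ 0#) → Unique (b ∷ bs) →
                     ∀ {x} → x ∈ bs → eval (tailValues b P) x ≈ 0#
    quotient-roots {b} {a} {P} roots (b∉ ∷ _) {x} x∈ = factor-root
      (λ b≈x → Membershipₚ.All[≉]⇒∉ setoid b∉ (Membershipₚ.∈-resp-≈ setoid (sym b≈x) x∈))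
      (trans (sym (root⇒factor b a P (roots (here refl)) x)) (roots (there x∈)))

  -- Dividing by one root shortens the list by one and keeps the other roots. Measuring by the
  -- length of the list, trailing zeros included, avoids having to know a degree.
  length≤roots⇒≈[] : ∀ P {bs} → Unique bs → (∀ {x} → x ∈ bs → eval P x ≈ 0#) → length P ≤ length bs → P ≈ₚ []
  length≤roots⇒≈[] []      _ _ _ i = refl
  length≤roots⇒≈[] (a ∷ P) {b ∷ bs} u@(_ ∷ u′) roots (s≤s P≤bs) = λ where
      zero    → begin
        a                  ≈⟨ +-identityʳ a ⟨
        a + 0#             ≈⟨ +-congˡ (zeroʳ b) ⟨
        a + b * 0#         ≈⟨ +-congˡ (*-congˡ (eval-≈[] P b P≈[])) ⟨
        a + b * eval P b   ≈⟨ roots (here refl) ⟩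
        0#                 ∎
      (suc i) → P≈[] i
    where
    P≈[] : P ≈ₚ []
    P≈[] = tailValues≈[] b P (length≤roots⇒≈[] (tailValues b P) u′ (quotient-roots {b} {a} {P} roots u)
      (≡.subst (_≤ length bs) (≡.sym (length-tailValues b P)) P≤bs))

  roots⇒factors : ∀ P {bs} → Unique bs → (∀ {x} → x ∈ bs → eval P x ≈ 0#) →
                  ∃ λ B → ∀ x → eval P x ≈ prodₗ (map (λ b → x - b) bs) * eval B x
  roots⇒factors P       {[]}     _ _     = P , λ x → sym (*-identityˡ (eval P x))
  roots⇒factors []      {b ∷ bs} _ _     = [] , λ x → sym (zeroʳ (prodₗ (map (λ b → x - b) (b ∷ bs))))
  roots⇒factors (a ∷ P) {b ∷ bs} u@(_ ∷ u′) roots =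
    let B , P≈ = roots⇒factors (tailValues b P) u′ (quotient-roots {b} {a} {P} roots u)
    in B , λ x → trans (root⇒factor b a P (roots (here refl)) x) (trans (*-congˡ (P≈ x)) (sym (*-assoc _ _ _)))

  vanishesFrom⇒≈[] : ∀ P {m bs} → (∀ i → m ≤ i → coeff P i ≈ 0#) → Unique bs →
                     (∀ {x} → x ∈ bs → eval P x ≈ 0#) → m ≤ length bs → P ≈ₚ []
  vanishesFrom⇒≈[] P {m} {bs} high u roots m≤bs i = trans (sym (take≈P i))
    (length≤roots⇒≈[] (take m P) u (λ x∈ → trans (eval-≈ₚ (take m P) P _ take≈P) (roots x∈))
      (ℕₚ.≤-trans (≡.subst (_≤ m) (≡.sym (Listₚ.length-take m P)) (ℕₚ.m⊓n≤m m (length P))) m≤bs) i)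
    where
    take≈P : take m P ≈ₚ P
    take≈P i with i ℕₚ.<? m
    ... | yes i<m = reflexive (coeff-take-< m P i<m)
    ... | no  i≮m = trans (reflexive (coeff-take-≥ m P (ℕₚ.≮⇒≥ i≮m))) (sym (high i (ℕₚ.≮⇒≥ i≮m)))

  -- Unlike in `HasDegree`, the coefficient `a` may be zero. Leading terms can thus be added,
  -- multiplied and composed without case distinctions, and nonvanishing is only asked for when
  -- degrees are compared.
  HasLeadingTerm : Poly → ℕ → Carrier → Set ℓ
  HasLeadingTerm P m a = coeff P m ≈ a × (∀ i → m < i → coeff P i ≈ 0#)

  leading-≈ : ∀ {P m a b} → a ≈ b → HasLeadingTerm P m a → HasLeadingTerm P m b
  leading-≈ a≈b (lead , high) = trans lead a≈b , high

  leading-≈ₚ : ∀ {P Q m a} → P ≈ₚ Q → HasLeadingTerm P m a → HasLeadingTerm Q m a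
  leading-≈ₚ P≈Q (lead , high) = trans (sym (P≈Q _)) lead , λ i m<i → trans (sym (P≈Q i)) (high i m<i)

  leading-unique : ∀ {P m n a b} → HasLeadingTerm P m a → HasLeadingTerm P n b → a ≉ 0# → b ≉ 0# → m ≡ n × a ≈ b
  leading-unique {P} {m} {n} (lead , high) (lead′ , high′) a≉0 b≉0 with ℕₚ.<-cmp m n
  ... | tri< m<n _ _ = ⊥-elim (b≉0 (trans (sym lead′) (high n m<n)))
  ... | tri> _ _ n<m = ⊥-elim (a≉0 (trans (sym lead) (high′ m n<m)))
  ... | tri≈ _ ≡.refl _ = ≡.refl , trans (sym lead) lead′

  leading-+ˡ : ∀ {P Q m a} → HasLeadingTerm P m a → (∀ i → m ≤ i → coeff Q i ≈ 0#) → HasLeadingTerm (P +ₚ Q) m a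
  leading-+ˡ {P} {Q} {m} (lead , high) Q-high =
    trans (coeff-+ P Q m) (trans (+-cong lead (Q-high m ℕₚ.≤-refl)) (+-identityʳ _)) ,
    λ i m<i → trans (coeff-+ P Q i) (trans (+-cong (high i m<i) (Q-high i (ℕₚ.<⇒≤ m<i))) (+-identityʳ _))

  leading-+ʳ : ∀ {P Q m a} → (∀ i → m ≤ i → coeff P i ≈ 0#) → HasLeadingTerm Q m a → HasLeadingTerm (P +ₚ Q) m a
  leading-+ʳ {P} {Q} {m} P-high (lead , high) =
    trans (coeff-+ P Q m) (trans (+-cong (P-high m ℕₚ.≤-refl) lead) (+-identityˡ _)) ,
    λ i m<i → trans (coeff-+ P Q i) (trans (+-cong (P-high i (ℕₚ.<⇒≤ m<i)) (high i m<i)) (+-identityˡ _))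

  leading-- : ∀ {P Q m a} → HasLeadingTerm P m a → (∀ i → m ≤ i → coeff Q i ≈ 0#) → HasLeadingTerm (P -ₚ Q) m a
  leading-- {P} {Q} lead Q-high = leading-+ˡ {P} {map -_ Q} lead
    (λ i m≤i → trans (coeff-neg Q i) (trans (-‿cong (Q-high i m≤i)) -0≈0))

  leading-· : ∀ {P m b} a → HasLeadingTerm P m b → HasLeadingTerm (a ·ₚ P) m (a * b)
  leading-· {P} a (lead , high) = trans (coeff-· a P _) (*-congˡ lead) ,
    λ i m<i → trans (coeff-· a P i) (trans (*-congˡ (high i m<i)) (zeroʳ a))

  leading-constant : ∀ a → HasLeadingTerm (constant a) 0 a
  leading-constant a = refl , λ { (suc i) _ → refl }

  leading-X^ : ∀ m → HasLeadingTerm (X^ m) m 1#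
  leading-X^ m = reflexive (coeff-X^-≡ m) , λ i m<i → reflexive (coeff-X^-≢ m i (λ i≡m → ℕₚ.<-irrefl (≡.sym i≡m) m<i))

  leading-X-constant : ∀ a → HasLeadingTerm (X -ₚ constant a) 1 1#
  leading-X-constant a = leading-- {X} {constant a} (leading-X^ 1) (λ { (suc i) _ → refl })

  leading-X^-X : ∀ {m} → 1 < m → HasLeadingTerm (X^ m -ₚ X) m 1#
  leading-X^-X {m} 1<m = leading-- {X^ m} {X} (leading-X^ m) (λ i m≤i → proj₂ (leading-X^ 1) i (ℕₚ.<-≤-trans 1<m m≤i))

  *ₚ-≈[]ˡ : ∀ P Q → P ≈ₚ [] → P *ₚ Q ≈ₚ []
  *ₚ-≈[]ˡ []      Q _    i = refl
  *ₚ-≈[]ˡ (a ∷ P) Q P≈[] i = trans (coeff-+ (a ·ₚ Q) (0# ∷ (P *ₚ Q)) i) (trans (+-cong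
    (trans (coeff-· a Q i) (trans (*-congʳ (P≈[] 0)) (zeroˡ _))) (shift i)) (+-identityʳ 0#))
    where
    shift : ∀ i → coeff (0# ∷ (P *ₚ Q)) i ≈ 0#
    shift zero    = refl
    shift (suc i) = *ₚ-≈[]ˡ P Q (P≈[] ∘ suc) i

  leading-shift : ∀ {P m a} → HasLeadingTerm P m a → HasLeadingTerm (0# ∷ P) (suc m) a
  leading-shift (lead , high) = lead , λ { (suc i) (s≤s m<i) → high i m<i }

  leading-* : ∀ P Q {m n a b} → HasLeadingTerm P m a → HasLeadingTerm Q n b → HasLeadingTerm (P *ₚ Q) (m ℕ.+ n) (a * b)
  leading-* []      Q {m} {n} {a} {b} (0≈a , _) _ = sym (trans (*-congʳ (sym 0≈a)) (zeroˡ b)) , λ _ _ → refl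
  leading-* (c ∷ P) Q {zero}  {n} (c≈a , high) Q-lead = leading-+ˡ {c ·ₚ Q} {0# ∷ (P *ₚ Q)} (leading-≈ {c ·ₚ Q} (*-congʳ c≈a) (leading-· {Q} c Q-lead)) shift
    where
    shift : ∀ i → n ≤ i → coeff (0# ∷ (P *ₚ Q)) i ≈ 0#
    shift zero    _ = refl
    shift (suc i) _ = *ₚ-≈[]ˡ P Q (λ j → high (suc j) (s≤s z≤n)) i
  leading-* (c ∷ P) Q {suc m} {n} (lead , high) Q-lead = leading-+ʳ {c ·ₚ Q} {0# ∷ (P *ₚ Q)}
    (λ i m+n<i → proj₂ (leading-· {Q} c Q-lead) i (ℕₚ.≤-<-trans (ℕₚ.m≤n+m n m) m+n<i))
    (leading-shift {P *ₚ Q} (leading-* P Q (lead , λ i m<i → high (suc i) (s≤s m<i)) Q-lead))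

  ∘ₚ-≈[]ˡ : ∀ P Q → P ≈ₚ [] → P ∘ₚ Q ≈ₚ []
  *ₚ-≈[]ʳ : ∀ P Q → Q ≈ₚ [] → P *ₚ Q ≈ₚ []
  *ₚ-≈[]ʳ []      Q _    i = refl
  *ₚ-≈[]ʳ (a ∷ P) Q Q≈[] i = trans (coeff-+ (a ·ₚ Q) (0# ∷ (P *ₚ Q)) i) (trans (+-cong
    (trans (coeff-· a Q i) (trans (*-congˡ (Q≈[] i)) (zeroʳ _))) (shift i)) (+-identityʳ 0#))
    where
    shift : ∀ i → coeff (0# ∷ (P *ₚ Q)) i ≈ 0#
    shift zero    = refl
    shift (suc i) = *ₚ-≈[]ʳ P Q Q≈[] i

  ∘ₚ-≈[]ˡ []      Q _    i = refl
  ∘ₚ-≈[]ˡ (a ∷ P) Q P≈[] i = trans (coeff-+ (a ∷ []) (Q *ₚ (P ∘ₚ Q)) i)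
    (trans (+-cong (a≈0 i) (*ₚ-≈[]ʳ Q (P ∘ₚ Q) (∘ₚ-≈[]ˡ P Q (P≈[] ∘ suc)) i)) (+-identityʳ 0#))
    where
    a≈0 : ∀ i → coeff (a ∷ []) i ≈ 0#
    a≈0 zero    = P≈[] 0
    a≈0 (suc i) = refl

  leading-∘ : ∀ P Q {m n a b} → 0 < n → HasLeadingTerm P m a → HasLeadingTerm Q n b →
              HasLeadingTerm (P ∘ₚ Q) (m ℕ.* n) (a * b ↑ m)
  leading-∘ []      Q {m} {n} {a} {b} _ (0≈a , _) _ = sym (trans (*-congʳ (sym 0≈a)) (zeroˡ _)) , λ _ _ → refl
  leading-∘ (c ∷ P) Q {zero} {n} {a} {b} _ (c≈a , high) _ = leading-+ˡ {c ∷ []} {Q *ₚ (P ∘ₚ Q)}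
    (leading-≈ {c ∷ []} (trans c≈a (sym (*-identityʳ a))) (leading-constant c))
    (λ i _ → *ₚ-≈[]ʳ Q (P ∘ₚ Q) (∘ₚ-≈[]ˡ P Q (λ j → high (suc j) (s≤s z≤n))) i)
  leading-∘ (c ∷ P) Q {suc m} {n} {a} {b} 0<n (lead , high) Q-lead = leading-+ʳ {c ∷ []} {Q *ₚ (P ∘ₚ Q)}
    (λ i n+mn≤i → proj₂ (leading-constant c) i (ℕₚ.<-≤-trans 0<n (ℕₚ.≤-trans (ℕₚ.m≤m+n n (m ℕ.* n)) n+mn≤i)))
    (leading-≈ {Q *ₚ (P ∘ₚ Q)} (solve 3 (λ a b e → b :* (a :* e) := a :* (b :* e)) refl a b (b ↑ m))
      (leading-* Q (P ∘ₚ Q) Q-lead (leading-∘ P Q 0<n (lead , λ i m<i → high (suc i) (s≤s m<i)) Q-lead)))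

  degree⇒leading : ∀ {P m} → HasDegree P m → HasLeadingTerm P m (coeff P m)
  degree⇒leading (_ , high) = refl , high

  leading⇒degree : ∀ {P m a} → a ≉ 0# → HasLeadingTerm P m a → HasDegree P m
  leading⇒degree a≉0 (lead , high) = (λ P≈0 → a≉0 (trans (sym lead) P≈0)) , high

  ≈[]⊎degree : ∀ P → P ≈ₚ [] ⊎ ∃ (HasDegree P)
  ≈[]⊎degree []      = inj₁ λ i → refl
  ≈[]⊎degree (a ∷ P) with ≈[]⊎degree P
  ... | inj₂ (m , lead , high) = inj₂ (suc m , lead , λ { (suc i) (s≤s m<i) → high i m<i })
  ... | inj₁ P≈[] with a ≟ 0#
  ...   | yes a≈0 = inj₁ λ { zero → a≈0 ; (suc i) → P≈[] i }
  ...   | no  a≉0 = inj₂ (0 , a≉0 , λ { (suc i) _ → P≈[] i })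

  rootCount≤degree : ∀ P {m bs} → HasDegree P m → Unique bs → (∀ {x} → x ∈ bs → eval P x ≈ 0#) → length bs ≤ m
  rootCount≤degree P {m} {bs} (lead , high) u roots with length bs ℕₚ.≤? m
  ... | yes bs≤m = bs≤m
  ... | no  bs≰m = ⊥-elim (lead (vanishesFrom⇒≈[] P high u roots (ℕₚ.≰⇒> bs≰m) m))

  -- The leading terms cancel in `P -ₚ Q`, so `m` points of agreement suffice instead of `m + 1`. In
  -- this form a monic polynomial of degree `m` is determined by `m` distinct roots.
  leadingTerms-agree⇒≈ₚ : ∀ P Q {m a bs} → HasLeadingTerm P m a → HasLeadingTerm Q m a → Unique bs → m ≤ length bs →
    (∀ {x} → x ∈ bs → eval P x ≈ eval Q x) → P ≈ₚ Q
  leadingTerms-agree⇒≈ₚ P Q {m} (P-lead , P-high) (Q-lead , Q-high) u m≤bs agree i =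
    x-y≈0⇒x≈y _ _ (trans (sym (coeff-- P Q i)) (vanishesFrom⇒≈[] (P -ₚ Q)
      (λ j m≤j → trans (coeff-- P Q j) (x≈y⇒x-y≈0 (high j m≤j))) u
      (λ x∈ → trans (eval-- P Q _) (x≈y⇒x-y≈0 (agree x∈))) m≤bs i))
    where
    high : ∀ j → m ≤ j → coeff P j ≈ coeff Q j
    high j m≤j with ℕₚ.m≤n⇒m<n∨m≡n m≤j
    ... | inj₁ m<j    = trans (P-high j m<j) (sym (Q-high j m<j))
    ... | inj₂ ≡.refl = trans P-lead (sym Q-lead)

  ∏X- : List Carrier → Poly
  ∏X- bs = ∏ₚ (map (λ b → X -ₚ constant b) bs)

  eval-∏X- : ∀ bs x → eval (∏X- bs) x ≈ prodₗ (map (λ b → x - b) bs)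
  eval-∏X- []       x = eval-constant 1# x
  eval-∏X- (b ∷ bs) x = trans (eval-* (X -ₚ constant b) (∏X- bs) x) (*-cong (eval-X-constant b x) (eval-∏X- bs x))

  leading-∏X- : ∀ bs → HasLeadingTerm (∏X- bs) (length bs) 1#
  leading-∏X- []       = leading-constant 1#
  leading-∏X- (b ∷ bs) = leading-≈ {∏X- (b ∷ bs)} (*-identityˡ 1#)
    (leading-* (X -ₚ constant b) (∏X- bs) (leading-X-constant b) (leading-∏X- bs))

  root-∏X- : ∀ {x bs} → x ∈ bs → eval (∏X- bs) x ≈ 0#
  root-∏X- {x} {bs} x∈ = trans (eval-∏X- bs x) (prodₗ≈0 (0∈ x∈))
    where
    0∈ : ∀ {bs} → x ∈ bs → 0# ∈ map (λ b → x - b) bs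
    0∈ (here x≈b) = here (sym (x≈y⇒x-y≈0 x≈b))
    0∈ (there x∈) = there (0∈ x∈)

  root-∏X-⁻ : ∀ {x} bs → eval (∏X- bs) x ≈ 0# → x ∈ bs
  root-∏X-⁻ {x} []       root = ⊥-elim (1≉0 (trans (sym (eval-constant 1# x)) root))
  root-∏X-⁻ {x} (b ∷ bs) root = Sum.[ (λ x-b≈0 → here (x-y≈0⇒x≈y x b (trans (sym (eval-X-constant b x)) x-b≈0)))
                                    , (λ rest → there (root-∏X-⁻ bs rest)) ]
    (xy≈0⇒x≈0⊎y≈0 (trans (sym (eval-* (X -ₚ constant b) (∏X- bs) x)) root))

  eval-0 : ∀ P → eval P 0# ≈ coeff P 0
  eval-0 []      = refl
  eval-0 (a ∷ P) = trans (+-congˡ (zeroˡ _)) (+-identityʳ a)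

  -- Stated for any subset closed under the operations, it serves both `Fq`, which is given by a
  -- list, and the fixed points of `x ↦ x ↑ Q`, which are given by an equation.
  module ClosedCoefficients {s : Level} (S : Pred Carrier s)
    (S-resp : ∀ {x y} → x ≈ y → S x → S y) (S-0 : S 0#)
    (S-+ : ∀ {x y} → S x → S y → S (x + y)) (S-* : ∀ {x y} → S x → S y → S (x * y)) where

    +ₚ-closed : ∀ P Q → P HasCoefficientsIn S → Q HasCoefficientsIn S → (P +ₚ Q) HasCoefficientsIn S
    +ₚ-closed P Q SP SQ i = S-resp (sym (coeff-+ P Q i)) (S-+ (SP i) (SQ i))

    ·ₚ-closed : ∀ {a} P → S a → P HasCoefficientsIn S → (a ·ₚ P) HasCoefficientsIn S
    ·ₚ-closed P Sa SP i = S-resp (sym (coeff-· _ P i)) (S-* Sa (SP i))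

    ∷-closed : ∀ {a P} → S a → P HasCoefficientsIn S → (a ∷ P) HasCoefficientsIn S
    ∷-closed Sa SP zero    = Sa
    ∷-closed Sa SP (suc i) = SP i

    []-closed : [] HasCoefficientsIn S
    []-closed i = S-0

    *ₚ-closed : ∀ P Q → P HasCoefficientsIn S → Q HasCoefficientsIn S → (P *ₚ Q) HasCoefficientsIn S
    *ₚ-closed []      Q SP SQ = []-closed
    *ₚ-closed (a ∷ P) Q SP SQ = +ₚ-closed (a ·ₚ Q) (0# ∷ (P *ₚ Q)) (·ₚ-closed Q (SP 0) SQ)
      (∷-closed S-0 (*ₚ-closed P Q (SP ∘ suc) SQ))

    ∘ₚ-closed : ∀ P Q → P HasCoefficientsIn S → Q HasCoefficientsIn S → (P ∘ₚ Q) HasCoefficientsIn S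
    ∘ₚ-closed []      Q SP SQ = []-closed
    ∘ₚ-closed (a ∷ P) Q SP SQ = +ₚ-closed (a ∷ []) (Q *ₚ (P ∘ₚ Q)) (∷-closed (SP 0) []-closed)
      (*ₚ-closed Q (P ∘ₚ Q) SQ (∘ₚ-closed P Q (SP ∘ suc) SQ))

    X^-closed : S 1# → ∀ m → (X^ m) HasCoefficientsIn S
    X^-closed S-1 zero    = ∷-closed S-1 []-closed
    X^-closed S-1 (suc m) = ∷-closed S-0 (X^-closed S-1 m)

    eval-closed : ∀ P {x} → P HasCoefficientsIn S → S x → S (eval P x)
    eval-closed []      SP Sx = S-0
    eval-closed (a ∷ P) SP Sx = S-+ (SP 0) (S-* Sx (eval-closed P (SP ∘ suc) Sx))

    ↑-closed : S 1# → ∀ {x} m → S x → S (x ↑ m)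
    ↑-closed S-1 zero    Sx = S-1
    ↑-closed S-1 (suc m) Sx = S-* Sx (↑-closed S-1 m Sx)

  module AlgebraicallyClosedField (closed : AlgebraicallyClosed) where

    degree⇒surjective : ∀ P {m} → 0 < m → HasDegree P m → ∀ z → ∃ λ x → eval P x ≈ z
    degree⇒surjective P {m} 0<m deg z =
      let x , root = closed (P -ₚ constant z) m 0<m (leading⇒degree {P -ₚ constant z} (proj₁ deg) lead)
      in x , trans (x-y≈0⇒x≈y _ _ (trans (sym (eval-- P (constant z) x)) root)) (eval-constant z x)
      where
      lead : HasLeadingTerm (P -ₚ constant z) m (coeff P m)
      lead = leading-- {P} {constant z} (degree⇒leading {P} deg)
        (λ i m≤i → proj₂ (leading-constant z) i (ℕₚ.<-≤-trans 0<m m≤i))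

    -- Decidable equality makes the degree computable. The dichotomy is the form in which algebraic
    -- closedness is used when only values are known: a polynomial that misses some value must be
    -- constant.
    constant⊎surjective : ∀ P → (∀ x → eval P x ≈ coeff P 0) ⊎ (∀ z → ∃ λ x → eval P x ≈ z)
    constant⊎surjective []      = inj₁ λ x → refl
    constant⊎surjective (a ∷ P) = Sum.map
      (λ P≈[] x → trans (+-congˡ (trans (*-congˡ (eval-≈[] P x P≈[])) (zeroʳ x))) (+-identityʳ a))
      (λ (m , lead , high) → degree⇒surjective (a ∷ P) {suc m} (s≤s z≤n) (lead , λ { (suc i) (s≤s m<i) → high i m<i }))
      (≈[]⊎degree P)

    -- A point at which the product of all `x - b` takes the value `1#` is none of the `b`.
    ∃∉ : ∀ bs → ∃ (_∉ bs)
    ∃∉ []           = 0# , λ ()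
    ∃∉ bs@(_ ∷ _) =
      let x , ∏≈1 = degree⇒surjective (∏X- bs) (s≤s z≤n) (leading⇒degree {∏X- bs} 1≉0 (leading-∏X- bs)) 1#
      in x , λ x∈ → 1≉0 (trans (sym ∏≈1) (root-∏X- x∈))

    uniqueOfLength : ∀ n → ∃ λ bs → Unique bs × length bs ≡ n
    uniqueOfLength zero    = [] , [] , ≡.refl
    uniqueOfLength (suc n) =
      let bs , u , eq = uniqueOfLength n
          b , b∉ = ∃∉ bs
      in b ∷ bs , Membershipₚ.∉⇒All[≉] setoid b∉ ∷ u , ≡.cong suc eq

    eval≈0⇒≈[] : ∀ P → (∀ x → eval P x ≈ 0#) → P ≈ₚ []
    eval≈0⇒≈[] P P≈0 =
      let bs , u , eq = uniqueOfLength (length P)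
      in length≤roots⇒≈[] P u (λ _ → P≈0 _) (ℕₚ.≤-reflexive (≡.sym eq))

    eval-injective : ∀ P Q → (∀ x → eval P x ≈ eval Q x) → P ≈ₚ Q
    eval-injective P Q P≈Q i = x-y≈0⇒x≈y _ _ (trans (sym (coeff-- P Q i))
      (eval≈0⇒≈[] (P -ₚ Q) (λ x → trans (eval-- P Q x) (x≈y⇒x-y≈0 (P≈Q x))) i))

    Monomial : Poly → Set (c ⊔ ℓ)
    Monomial S = ∃₂ λ σ m → ∀ x → eval S x ≈ σ * x ↑ m

    -- Factors `x` are split off as long as the constant term vanishes. Once it does not, no root is
    -- left: a root could only be `0#`, where the value is the constant term. Being without roots,
    -- the remaining polynomial is constant.
    onlyZeroRoot⇒monomial : ∀ S → (∀ x → eval S x ≈ 0# → x ≈ 0#) → Monomial S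
    onlyZeroRoot⇒monomial []      only = ⊥-elim (1≉0 (only 1# refl))
    onlyZeroRoot⇒monomial (a ∷ S) only = cases (a ≟ 0#)
      where
      shift : (∀ x → eval (a ∷ S) x ≈ x * eval S x) → Monomial S → Monomial (a ∷ S)
      shift eval≈ (σ , m , S≈) = σ , suc m , λ x → trans (eval≈ x) (trans (*-congˡ (S≈ x))
        (solve 3 (λ x σ e → x :* (σ :* e) := σ :* (x :* e)) refl x σ (x ↑ m)))

      nonzeroConstantTerm : a ≉ 0# → (∀ x → eval (a ∷ S) x ≈ a) ⊎ (∀ z → ∃ λ x → eval (a ∷ S) x ≈ z) → Monomial (a ∷ S)
      nonzeroConstantTerm a≉0 (inj₁ const) = a , 0 , λ x → trans (const x) (sym (*-identityʳ a))
      nonzeroConstantTerm a≉0 (inj₂ surj)  = let x , root = surj 0# in ⊥-elim (a≉0 (begin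
        a                     ≈⟨ +-identityʳ a ⟨
        a + 0#                ≈⟨ +-congˡ (zeroˡ (eval S x)) ⟨
        a + 0# * eval S x     ≈⟨ +-congˡ (*-congʳ (only x root)) ⟨
        a + x * eval S x      ≈⟨ root ⟩
        0#                    ∎))

      cases : Dec (a ≈ 0#) → Monomial (a ∷ S)
      cases (no  a≉0) = nonzeroConstantTerm a≉0 (constant⊎surjective (a ∷ S))
      cases (yes a≈0) = shift eval≈ (onlyZeroRoot⇒monomial S
        (λ x Sx≈0 → only x (trans (eval≈ x) (trans (*-congˡ Sx≈0) (zeroʳ x)))))
        where
        eval≈ : ∀ x → eval (a ∷ S) x ≈ x * eval S x
        eval≈ x = trans (+-congʳ a≈0) (+-identityˡ _)

-- Finite subfields as fixed points of power maps.

module FixedPoints {c ℓ : Level} (K : Field c ℓ) where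

  open Over K hiding (zero)
  open Membership setoid using (_∈_)
  open Uniqueness setoid using (Unique)
  open FieldProperties K
  open PolynomialProperties K
  open import Relation.Binary.Reasoning.Setoid setoid

  -- Membership in `𝔽 N` carries a subfield as witness. This equation is decidable and follows from
  -- membership; once some `Subfield N` is at hand it is equivalent to it, see `𝔽⇒Fixed` and
  -- `Fixed⇒𝔽`.
  Fixed : ℕ → Carrier → Set ℓ
  Fixed N x = x ↑ N ≈ x

  Fixed? : ∀ N x → Dec (Fixed N x)
  Fixed? N x = (x ↑ N) ≟ x

  Fixed-resp : ∀ {N x y} → x ≈ y → Fixed N x → Fixed N y
  Fixed-resp {N} x≈y fx = trans (^-congˡ N (sym x≈y)) (trans fx x≈y)

  Fixed-* : ∀ {N x y} → Fixed N x → Fixed N y → Fixed N (x * y)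
  Fixed-* {N} fx fy = trans (^-distrib-* _ _ N) (*-cong fx fy)

  Fixed-↑ : ∀ {N x} m → Fixed N x → Fixed N (x ↑ m)
  Fixed-↑ {N} zero    _  = 1↑n≈1 N
  Fixed-↑ {N} (suc m) fx = Fixed-* {N} fx (Fixed-↑ {N} m fx)

  Fixed-^ : ∀ {N x} m → Fixed N x → Fixed (N ℕ.^ m) x
  Fixed-^         zero    _  = *-identityʳ _
  Fixed-^ {N} {x} (suc m) fx = begin
    x ↑ (N ℕ.* N ℕ.^ m)      ≈⟨ ^-assocʳ x N (N ℕ.^ m) ⟨
    (x ↑ N) ↑ (N ℕ.^ m)      ≈⟨ ^-congˡ (N ℕ.^ m) fx ⟩
    x ↑ (N ℕ.^ m)            ≈⟨ Fixed-^ m fx ⟩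
    x                        ∎

  ↑-↑-comm : ∀ x m n → (x ↑ m) ↑ n ≈ (x ↑ n) ↑ m
  ↑-↑-comm x m n = trans (^-assocʳ x m n) (trans (^-congʳ x (ℕₚ.*-comm m n)) (sym (^-assocʳ x n m)))

  Fixed-gcd : ∀ {r x} a b → Fixed (r ℕ.^ a) x → Fixed (r ℕ.^ b) x → Fixed (r ℕ.^ gcd a b) x
  Fixed-gcd {r} {x} a b fa fb = cases (Bézout.identity (gcd-GCD a b))
    where
    multiple : ∀ m k → Fixed (r ℕ.^ m) x → Fixed (r ℕ.^ (k ℕ.* m)) x
    multiple m k fm = ≡.subst (λ e → Fixed e x)
      (≡.trans (ℕₚ.^-*-assoc r m k) (≡.cong (r ℕ.^_) (ℕₚ.*-comm m k))) (Fixed-^ k fm)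

    cancel : ∀ g y {z} → g ℕ.+ y ≡ z → Fixed (r ℕ.^ y) x → Fixed (r ℕ.^ z) x → Fixed (r ℕ.^ g) x
    cancel g y ≡.refl fy fz = begin
      x ↑ (r ℕ.^ g)                      ≈⟨ ^-congˡ (r ℕ.^ g) fy ⟨
      (x ↑ (r ℕ.^ y)) ↑ (r ℕ.^ g)        ≈⟨ ^-assocʳ x (r ℕ.^ y) (r ℕ.^ g) ⟩
      x ↑ (r ℕ.^ y ℕ.* r ℕ.^ g)          ≡⟨ ≡.cong (x ↑_) (≡.trans (ℕₚ.*-comm (r ℕ.^ y) (r ℕ.^ g)) (≡.sym (ℕₚ.^-distribˡ-+-* r g y))) ⟩
      x ↑ (r ℕ.^ (g ℕ.+ y))              ≈⟨ fz ⟩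
      x                                  ∎

    cases : Bézout.Identity (gcd a b) a b → Fixed (r ℕ.^ gcd a b) x
    cases (Bézout.+- i j eq) = cancel (gcd a b) (j ℕ.* b) eq (multiple b j fb) (multiple a i fa)
    cases (Bézout.-+ i j eq) = cancel (gcd a b) (i ℕ.* a) eq (multiple a i fa) (multiple b j fb)

  module _ {N : ℕ} (0<N : 0 < N) (frobenius : Frobenius N) where

    frobenius-neg : ∀ x → (- x) ↑ N ≈ - (x ↑ N)
    frobenius-neg x = x+y≈0⇒y≈-x _ _ (begin
      x ↑ N + (- x) ↑ N     ≈⟨ frobenius x (- x) ⟨
      (x - x) ↑ N           ≈⟨ ^-congˡ N (-‿inverseʳ x) ⟩
      0# ↑ N                ≈⟨ 0↑n≈0 0<N ⟩
      0#                    ∎)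

    frobenius-- : ∀ x y → (x - y) ↑ N ≈ x ↑ N - y ↑ N
    frobenius-- x y = trans (frobenius x (- y)) (+-congˡ (frobenius-neg y))

    Fixed-0 : Fixed N 0#
    Fixed-0 = 0↑n≈0 0<N

    Fixed-1 : Fixed N 1#
    Fixed-1 = 1↑n≈1 N

    Fixed-+ : ∀ {x y} → Fixed N x → Fixed N y → Fixed N (x + y)
    Fixed-+ fx fy = trans (frobenius _ _) (+-cong fx fy)

    Fixed-neg : ∀ {x} → Fixed N x → Fixed N (- x)
    Fixed-neg fx = trans (frobenius-neg _) (-‿cong fx)

    Fixed-inverse : ∀ {x y} → Fixed N x → x * y ≈ 1# → Fixed N y
    Fixed-inverse {x} {y} fx xy≈1 = *-cancelˡ x≉0 (begin
      x * y ↑ N         ≈⟨ *-congʳ fx ⟨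
      x ↑ N * y ↑ N     ≈⟨ ^-distrib-* x y N ⟨
      (x * y) ↑ N       ≈⟨ ^-congˡ N xy≈1 ⟩
      1# ↑ N            ≈⟨ 1↑n≈1 N ⟩
      1#                ≈⟨ xy≈1 ⟨
      x * y             ∎)
      where
      x≉0 : x ≉ 0#
      x≉0 x≈0 = 1≉0 (trans (sym xy≈1) (trans (*-congʳ x≈0) (zeroˡ y)))

  Fixed⇒X^-X-root : ∀ {N x} → Fixed N x → eval (X^ N -ₚ X) x ≈ 0#
  Fixed⇒X^-X-root {N} {x} fx = trans (eval-X^-X N x) (x≈y⇒x-y≈0 fx)

  fixedCount≤ : ∀ {N} → 1 < N → ∀ {bs} → Unique bs → (∀ {x} → x ∈ bs → Fixed N x) → length bs ≤ N
  fixedCount≤ {N} 1<N u fixed = rootCount≤degree (X^ N -ₚ X)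
    (leading⇒degree {X^ N -ₚ X} 1≉0 (leading-X^-X 1<N)) u (λ x∈ → Fixed⇒X^-X-root {N} (fixed x∈))

  module _ {N : ℕ} (F : Subfield N) where

    open Subfield F

    1<order : 1 < N
    1<order = ≡.subst (2 ≤_) order (unique⊆⇒length≤ {elements} {0# ∷ 1# ∷ []}
      ((0≉1 ∷ []) ∷ [] ∷ []) λ { (here x≈0) → Membershipₚ.∈-resp-≈ setoid (sym x≈0) 0-closed
                               ; (there (here x≈1)) → Membershipₚ.∈-resp-≈ setoid (sym x≈1) 1-closed })

    -- An `x` outside the list would be one root too many for `X^ N -ₚ X`, which already has the `N`
    -- elements of `F` as roots.
    Fixed⇒∈ : ∀ {x} → Fixed N x → x ∈ elements
    Fixed⇒∈ {x} fx = cases (Any.any? (x ≟_) elements)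
      where
      cases : Dec (x ∈ elements) → x ∈ elements
      cases (yes x∈) = x∈
      cases (no  x∉) = contradiction
        (fixedCount≤ 1<order (Membershipₚ.∉⇒All[≉] setoid x∉ ∷ unique)
          λ { (here y≈x) → Fixed-resp {N} (sym y≈x) fx ; (there y∈) → x∈F⇒x↑N≈x F y∈ })
        (ℕₚ.<⇒≱ (s≤s (ℕₚ.≤-reflexive (≡.sym order))))

    Fixed⇒𝔽 : ∀ {x} → Fixed N x → 𝔽 N x
    Fixed⇒𝔽 fx = F , Fixed⇒∈ fx

  𝔽⇒Fixed : ∀ {N x} → 𝔽 N x → Fixed N x
  𝔽⇒Fixed (F , x∈F) = x∈F⇒x↑N≈x F x∈F

  module _ {G : ℕ} (1<G : 1 < G) (frobenius : Frobenius G) where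

    -- The cofactors (x^(G^h) - x) / (x^G - x), h ≥ 1, by x^(G^(h+1)) - x = (x^(G^h) - x)^G + (x^G - x).
    cofactor : ℕ → Poly
    cofactor zero    = []
    cofactor (suc h) = constant 1# +ₚ (X^ (G ℕ.∸ 1) ∘ₚ (X^ G -ₚ X)) *ₚ (X^ G ∘ₚ cofactor h)

    eval-cofactor : ∀ h x → (x ↑ G - x) * eval (cofactor h) x ≈ x ↑ (G ℕ.^ h) - x
    eval-cofactor zero    x = trans (zeroʳ _) (sym (x≈y⇒x-y≈0 (*-identityʳ x)))
    eval-cofactor (suc h) x = begin
      b * eval (cofactor (suc h)) x
        ≈⟨ *-congˡ (eval-+ (constant 1#) (P *ₚ R) x) ⟩
      b * (eval (constant 1#) x + eval (P *ₚ R) x)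
        ≈⟨ *-congˡ (+-cong (eval-constant 1# x) (trans (eval-* P R x) (*-cong
             (trans (eval-X^∘ (G ℕ.∸ 1) (X^ G -ₚ X) x) (^-congˡ (G ℕ.∸ 1) (eval-X^-X G x))) (eval-X^∘ G (cofactor h) x)))) ⟩
      b * (1# + b ↑ (G ℕ.∸ 1) * e ↑ G)
        ≈⟨ solve 3 (λ b c e → b :* (con (1 , 0) :+ c :* e) := b :* c :* e :+ b) refl b (b ↑ (G ℕ.∸ 1)) (e ↑ G) ⟩
      b * b ↑ (G ℕ.∸ 1) * e ↑ G + b
        ≈⟨ +-congʳ (*-congʳ (^-congʳ b suc[G-1]≡G)) ⟩
      b ↑ G * e ↑ G + b
        ≈⟨ +-congʳ (^-distrib-* b e G) ⟨
      (b * e) ↑ G + b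
        ≈⟨ +-congʳ (trans (^-congˡ G (eval-cofactor h x)) (frobenius-- 0<G frobenius _ _)) ⟩
      ((x ↑ (G ℕ.^ h)) ↑ G - x ↑ G) + (x ↑ G - x)
        ≈⟨ +-congʳ (+-congʳ (trans (^-assocʳ x (G ℕ.^ h) G) (^-congʳ x (ℕₚ.*-comm (G ℕ.^ h) G)))) ⟩
      (x ↑ (G ℕ.* G ℕ.^ h) - x ↑ G) + (x ↑ G - x)
        ≈⟨ solve 3 (λ a b c → (a :- b) :+ (b :- c) := a :- c) refl (x ↑ (G ℕ.* G ℕ.^ h)) (x ↑ G) x ⟩
      x ↑ (G ℕ.* G ℕ.^ h) - x ∎
      where
      P = X^ (G ℕ.∸ 1) ∘ₚ (X^ G -ₚ X)
      R = X^ G ∘ₚ cofactor h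
      b = x ↑ G - x
      e = eval (cofactor h) x
      0<G : 0 < G
      0<G = ℕₚ.<-trans (s≤s z≤n) 1<G
      suc[G-1]≡G : suc (G ℕ.∸ 1) ≡ G
      suc[G-1]≡G = ℕₚ.m+[n∸m]≡n 0<G

    -- The elements of the big subfield not fixed by x ↦ x^G are roots of the cofactor, so at
    -- least G elements are fixed.
    subfieldOfPower : AlgebraicallyClosed → ∀ {Q} h → 0 < h → Q ≡ G ℕ.^ h → Subfield Q → Subfield G
    subfieldOfPower closed {Q} h 0<h ≡.refl F = record
      { elements   = fixed
      ; unique     = Uniqueₚ.filter⁺ setoid (Fixed? G) unique
      ; order      = ℕₚ.≤-antisym
          (fixedCount≤ 1<G (Uniqueₚ.filter⁺ setoid (Fixed? G) unique) (λ x∈ → proj₂ (∈fixed⁻ x∈)))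
          (ℕₚ.+-cancelʳ-≤ (length unfixed) G (length fixed) (ℕₚ.≤-trans G+unfixed≤Q (ℕₚ.≤-reflexive (≡.sym split))))
      ; 0-closed   = ∈fixed⁺ 0-closed (Fixed-0 0<G frobenius)
      ; 1-closed   = ∈fixed⁺ 1-closed (Fixed-1 0<G frobenius)
      ; +-closed   = λ x∈ y∈ → ∈fixed⁺ (+-closed (proj₁ (∈fixed⁻ x∈)) (proj₁ (∈fixed⁻ y∈)))
                                       (Fixed-+ 0<G frobenius (proj₂ (∈fixed⁻ x∈)) (proj₂ (∈fixed⁻ y∈)))
      ; *-closed   = λ x∈ y∈ → ∈fixed⁺ (*-closed (proj₁ (∈fixed⁻ x∈)) (proj₁ (∈fixed⁻ y∈)))
                                       (Fixed-* {G} (proj₂ (∈fixed⁻ x∈)) (proj₂ (∈fixed⁻ y∈)))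
      ; neg-closed = λ x∈ → ∈fixed⁺ (neg-closed (proj₁ (∈fixed⁻ x∈))) (Fixed-neg 0<G frobenius (proj₂ (∈fixed⁻ x∈)))
      ; inv-closed = λ x∈ xy≈1 → ∈fixed⁺ (inv-closed (proj₁ (∈fixed⁻ x∈)) xy≈1) (Fixed-inverse 0<G frobenius (proj₂ (∈fixed⁻ x∈)) xy≈1)
      }
      where
      open Subfield F
      open AlgebraicallyClosedField closed
      open Permutationₚ setoid using (partition-↭; xs↭ys⇒|xs|≡|ys|)

      0<G : 0 < G
      0<G = ℕₚ.<-trans (s≤s z≤n) 1<G

      fixed unfixed : List Carrier
      fixed   = filter (Fixed? G) elements
      unfixed = filter (¬? ∘ Fixed? G) elements

      ∈fixed⁺ : ∀ {x} → x ∈ elements → Fixed G x → x ∈ fixed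
      ∈fixed⁺ = Membershipₚ.∈-filter⁺ setoid (Fixed? G) (Fixed-resp {G})

      ∈fixed⁻ : ∀ {x} → x ∈ fixed → x ∈ elements × Fixed G x
      ∈fixed⁻ = Membershipₚ.∈-filter⁻ setoid (Fixed? G) (Fixed-resp {G})

      split : length fixed ℕ.+ length unfixed ≡ Q
      split = ≡.trans (≡.sym (Listₚ.length-++ fixed)) (≡.trans (≡.sym (≡.trans (xs↭ys⇒|xs|≡|ys| (partition-↭ (Fixed? G) elements))
        (≡.cong (λ (xs , ys) → length (xs ++ ys)) (Listₚ.partition-defn (Fixed? G) elements)))) order)

      cofactor-root : ∀ {x} → x ∈ unfixed → eval (cofactor h) x ≈ 0#
      cofactor-root {x} x∈ =
        let x∈F , ¬fixed = Membershipₚ.∈-filter⁻ setoid (¬? ∘ Fixed? G) (λ x≈y ¬fx fy → ¬fx (Fixed-resp {G} (sym x≈y) fy)) x∈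
        in xy≈0⇒y≈0 (λ eq → ¬fixed (x-y≈0⇒x≈y _ _ eq))
             (trans (eval-cofactor h x) (x≈y⇒x-y≈0 (x∈F⇒x↑N≈x F x∈F)))

      product≈ : (X^ G -ₚ X) *ₚ cofactor h ≈ₚ X^ Q -ₚ X
      product≈ = eval-injective ((X^ G -ₚ X) *ₚ cofactor h) (X^ Q -ₚ X) λ x →
        trans (eval-* (X^ G -ₚ X) (cofactor h) x) (trans (*-congʳ (eval-X^-X G x)) (trans (eval-cofactor h x) (sym (eval-X^-X Q x))))

      X^Q-X-leading : HasLeadingTerm (X^ Q -ₚ X) Q 1#
      X^Q-X-leading = leading-X^-X (1<order F)

      G+unfixed≤Q : G ℕ.+ length unfixed ≤ Q
      G+unfixed≤Q = cases (≈[]⊎degree (cofactor h))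
        where
        cases : cofactor h ≈ₚ [] ⊎ ∃ (HasDegree (cofactor h)) → G ℕ.+ length unfixed ≤ Q
        cases (inj₁ zero≈) = ⊥-elim (1≉0 (trans (sym (proj₁ X^Q-X-leading))
          (trans (sym (product≈ Q)) (*ₚ-≈[]ʳ (X^ G -ₚ X) (cofactor h) zero≈ Q))))
        cases (inj₂ (m , deg)) = ≡.subst (G ℕ.+ length unfixed ≤_)
          (proj₁ (leading-unique {X^ Q -ₚ X}
            (leading-≈ₚ {(X^ G -ₚ X) *ₚ cofactor h} {X^ Q -ₚ X} product≈ (leading-* (X^ G -ₚ X) (cofactor h) (leading-X^-X 1<G) (degree⇒leading {cofactor h} deg)))
            X^Q-X-leading (*-≉0 1≉0 (proj₁ deg)) 1≉0))
          (ℕₚ.+-monoʳ-≤ G (rootCount≤degree (cofactor h) deg (Uniqueₚ.filter⁺ setoid (¬? ∘ Fixed? G) unique) cofactor-root))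

-- The list a₀ , a₁ , … encodes the linearized polynomial Σ aᵢ x^(r^i).
module LinearizedPolynomials {c ℓ : Level} (K : Field c ℓ) (closed : Over.AlgebraicallyClosed K)
  {r : ℕ} (1<r : 1 < r) (frobenius : FieldProperties.Frobenius K r) where

  open Over K hiding (zero)
  open Membership setoid using (_∈_)
  open Uniqueness setoid using (Unique)
  open FieldProperties K
  open PolynomialProperties K
  open AlgebraicallyClosedField closed
  open FixedPoints K
  open import Relation.Binary.Reasoning.Setoid setoid

  private
    0<r : 0 < r
    0<r = ℕₚ.<-trans (s≤s z≤n) 1<r

  evalLin : List Carrier → Carrier → Carrier
  evalLin []       x = 0#
  evalLin (a ∷ as) x = a * x + evalLin as (x ↑ r)

  evalLin-cong : ∀ as {x y} → x ≈ y → evalLin as x ≈ evalLin as y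
  evalLin-cong []       _   = refl
  evalLin-cong (a ∷ as) x≈y = +-cong (*-congˡ x≈y) (evalLin-cong as (^-congˡ r x≈y))

  evalLin-≈[] : ∀ as x → as ≈ₚ [] → evalLin as x ≈ 0#
  evalLin-≈[] []       x _     = refl
  evalLin-≈[] (a ∷ as) x as≈[] = trans (+-cong (trans (*-congʳ (as≈[] 0)) (zeroˡ x)) (evalLin-≈[] as (x ↑ r) (as≈[] ∘ suc))) (+-identityˡ 0#)

  evalLin-≈ₚ : ∀ as bs x → as ≈ₚ bs → evalLin as x ≈ evalLin bs x
  evalLin-≈ₚ []       bs       x eq = sym (evalLin-≈[] bs x (λ i → sym (eq i)))
  evalLin-≈ₚ (a ∷ as) []       x eq = evalLin-≈[] (a ∷ as) x eq
  evalLin-≈ₚ (a ∷ as) (b ∷ bs) x eq = +-cong (*-congʳ (eq 0)) (evalLin-≈ₚ as bs (x ↑ r) (eq ∘ suc))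

  evalLin-+ₚ : ∀ as bs x → evalLin (as +ₚ bs) x ≈ evalLin as x + evalLin bs x
  evalLin-+ₚ []       bs       x = sym (+-identityˡ _)
  evalLin-+ₚ (a ∷ as) []       x = sym (+-identityʳ _)
  evalLin-+ₚ (a ∷ as) (b ∷ bs) x = trans (+-congˡ (evalLin-+ₚ as bs (x ↑ r)))
    (solve 5 (λ a b x p q → (a :+ b) :* x :+ (p :+ q) := (a :* x :+ p) :+ (b :* x :+ q)) refl a b x (evalLin as (x ↑ r)) (evalLin bs (x ↑ r)))

  evalLin-·ₚ : ∀ a bs x → evalLin (a ·ₚ bs) x ≈ a * evalLin bs x
  evalLin-·ₚ a []       x = sym (zeroʳ a)
  evalLin-·ₚ a (b ∷ bs) x = trans (+-congˡ (evalLin-·ₚ a bs (x ↑ r)))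
    (solve 4 (λ a b x p → a :* b :* x :+ a :* p := a :* (b :* x :+ p)) refl a b x (evalLin bs (x ↑ r)))

  frobLin : List Carrier → List Carrier
  frobLin as = 0# ∷ map (_↑ r) as

  evalLin-frobLin : ∀ as x → evalLin (frobLin as) x ≈ evalLin as x ↑ r
  evalLin-frobLin as x = trans (+-cong (zeroˡ x) (shifted as x)) (+-identityˡ _)
    where
    shifted : ∀ as x → evalLin (map (_↑ r) as) (x ↑ r) ≈ evalLin as x ↑ r
    shifted []       x = sym (0↑n≈0 0<r)
    shifted (a ∷ as) x = trans (+-cong (sym (^-distrib-* a x r)) (shifted as (x ↑ r))) (sym (frobenius _ _))

  coeff-frobLin : ∀ as i → coeff (frobLin as) (suc i) ≈ coeff as i ↑ r
  coeff-frobLin []       i       = sym (0↑n≈0 0<r)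
  coeff-frobLin (a ∷ as) zero    = refl
  coeff-frobLin (a ∷ as) (suc i) = coeff-frobLin as i

  evalLin-+ : ∀ as x y → evalLin as (x + y) ≈ evalLin as x + evalLin as y
  evalLin-+ []       x y = sym (+-identityˡ 0#)
  evalLin-+ (a ∷ as) x y = trans (+-congˡ (trans (evalLin-cong as (frobenius x y)) (evalLin-+ as (x ↑ r) (y ↑ r))))
    (solve 5 (λ a x y p q → a :* (x :+ y) :+ (p :+ q) := (a :* x :+ p) :+ (a :* y :+ q)) refl a x y (evalLin as (x ↑ r)) (evalLin as (y ↑ r)))

  evalLin-0 : ∀ as → evalLin as 0# ≈ 0#
  evalLin-0 []       = refl
  evalLin-0 (a ∷ as) = trans (+-cong (zeroʳ a) (trans (evalLin-cong as (0↑n≈0 0<r)) (evalLin-0 as))) (+-identityˡ 0#)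

  evalLin-neg : ∀ as x → evalLin as (- x) ≈ - evalLin as x
  evalLin-neg as x = x+y≈0⇒y≈-x _ _ (begin
    evalLin as x + evalLin as (- x)    ≈⟨ evalLin-+ as x (- x) ⟨
    evalLin as (x - x)                 ≈⟨ evalLin-cong as (-‿inverseʳ x) ⟩
    evalLin as 0#                      ≈⟨ evalLin-0 as ⟩
    0#                                 ∎)

  evalLin-- : ∀ as x y → evalLin as (x - y) ≈ evalLin as x - evalLin as y
  evalLin-- as x y = trans (evalLin-+ as x (- y)) (+-congˡ (evalLin-neg as y))

  evalLin-homogeneous : ∀ as {a} x → Fixed r a → evalLin as (a * x) ≈ a * evalLin as x
  evalLin-homogeneous []       {a} x fa = sym (zeroʳ a)
  evalLin-homogeneous (b ∷ as) {a} x fa = trans (+-congˡ (trans (evalLin-cong as (trans (^-distrib-* a x r) (*-congʳ fa)))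
      (evalLin-homogeneous as (x ↑ r) fa)))
    (solve 4 (λ a b x p → b :* (a :* x) :+ a :* p := a :* (b :* x :+ p)) refl a b x (evalLin as (x ↑ r)))

  linearized : List Carrier → Poly
  linearized []       = []
  linearized (a ∷ as) = a ·ₚ X +ₚ linearized as ∘ₚ X^ r

  eval-linearized : ∀ as x → eval (linearized as) x ≈ evalLin as x
  eval-linearized []       x = refl
  eval-linearized (a ∷ as) x = begin
    eval (a ·ₚ X +ₚ linearized as ∘ₚ X^ r) x           ≈⟨ eval-+ (a ·ₚ X) (linearized as ∘ₚ X^ r) x ⟩
    eval (a ·ₚ X) x + eval (linearized as ∘ₚ X^ r) x   ≈⟨ +-cong (trans (eval-· a X x) (*-congˡ (eval-X x))) (trans (eval-∘ (linearized as) (X^ r) x)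
                                                          (trans (eval-linearized as _) (evalLin-cong as (eval-X^ r x)))) ⟩
    a * x + evalLin as (x ↑ r)                         ∎

  leading-linearized : ∀ as {t a} → HasLeadingTerm as t a → HasLeadingTerm (linearized as) (r ℕ.^ t) a
  leading-linearized [] {t} (0≈a , _) = 0≈a , λ _ _ → refl
  leading-linearized (b ∷ as) {zero} {a} (b≈a , high) = leading-+ˡ {b ·ₚ X} {linearized as ∘ₚ X^ r}
    (leading-≈ {b ·ₚ X} (trans (*-identityʳ b) b≈a) (leading-· {X} b (leading-X^ 1)))
    (λ i _ → ∘ₚ-≈[]ˡ (linearized as) (X^ r) (eval≈0⇒≈[] (linearized as)
      (λ x → trans (eval-linearized as x) (evalLin-≈[] as x (λ j → high (suc j) (s≤s z≤n))))) i)
  leading-linearized (b ∷ as) {suc t} {a} (lead , high) = leading-+ʳ {b ·ₚ X} {linearized as ∘ₚ X^ r}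
    (λ i r^t≤i → proj₂ (leading-· {X} b (leading-X^ 1)) i
      (ℕₚ.<-≤-trans (≡.subst (_< r ℕ.^ suc t) (ℕₚ.^-zeroˡ 0) (ℕₚ.^-monoʳ-< r 1<r {0} {suc t} (s≤s z≤n))) r^t≤i))
    (≡.subst (λ e → HasLeadingTerm (linearized as ∘ₚ X^ r) e a) (ℕₚ.*-comm (r ℕ.^ t) r)
      (leading-≈ {linearized as ∘ₚ X^ r} (trans (*-congˡ (1↑n≈1 (r ℕ.^ t))) (*-identityʳ a))
        (leading-∘ (linearized as) (X^ r) 0<r (leading-linearized as (lead , λ i t<i → high (suc i) (s≤s t<i))) (leading-X^ r))))

  -- Allowing arbitrary exponents `e` and a second point `y` makes the induction possible: dropping
  -- the first summand shifts `e`, and this is matched by passing from `y` to `y ↑ r`.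
  eval-∑ : ∀ as (e : ℕ → ℕ) n {x y} → (∀ i → x ↑ e i ≈ y ↑ (r ℕ.^ i)) → length as ≤ n →
    eval (∑ₚ (applyUpTo (λ i → coeff as i ·ₚ (X^ e i)) n)) x ≈ evalLin as y
  eval-∑ []       e zero    _  _ = refl
  eval-∑ []       e (suc n) {x} {y} eq _ = trans (eval-+ (0# ·ₚ (X^ e 0)) _ x)
    (trans (+-cong (trans (eval-· 0# (X^ e 0) x) (zeroˡ _)) (eval-∑ [] (e ∘ suc) n {x} {y ↑ r}
      (λ i → trans (eq (suc i)) (sym (^-assocʳ y r (r ℕ.^ i)))) z≤n)) (+-identityˡ 0#))
  eval-∑ (a ∷ as) e (suc n) {x} {y} eq (s≤s as≤n) = trans (eval-+ (a ·ₚ (X^ e 0)) _ x)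
    (+-cong (trans (eval-· a (X^ e 0) x) (*-congˡ (trans (eval-X^ (e 0) x) (trans (eq 0) (*-identityʳ y)))))
      (eval-∑ as (e ∘ suc) n {x} {y ↑ r} (λ i → trans (eq (suc i)) (sym (^-assocʳ y r (r ℕ.^ i)))) as≤n))

  linearized-Linearized : ∀ as → Linearized r (linearized as)
  -- The upper index `length as` gives one summand more than there are listed coefficients. Its
  -- coefficient is zero, and the empty list needs no separate treatment.
  linearized-Linearized as = length as , coeff as , eval-injective (linearized as)
    (∑ₚ (applyUpTo (λ i → coeff as i ·ₚ (X^ (r ℕ.^ i))) (suc (length as)))) λ x →
    trans (eval-linearized as x) (sym (eval-∑ as (r ℕ.^_) (suc (length as)) (λ i → refl) (ℕₚ.n≤1+n _)))

  -- The coefficient list of (τ - γ) ∘ L, where τ is the r-th power map and L is encoded by as.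
  frobeniusMinus : Carrier → List Carrier → List Carrier
  frobeniusMinus γ as = (- γ ·ₚ as) +ₚ frobLin as

  evalLin-frobeniusMinus : ∀ γ as x → evalLin (frobeniusMinus γ as) x ≈ evalLin as x ↑ r - γ * evalLin as x
  evalLin-frobeniusMinus γ as x = begin
    evalLin (frobeniusMinus γ as) x                            ≈⟨ evalLin-+ₚ (- γ ·ₚ as) (frobLin as) x ⟩
    evalLin (- γ ·ₚ as) x + evalLin (frobLin as) x             ≈⟨ +-cong (evalLin-·ₚ (- γ) as x) (evalLin-frobLin as x) ⟩
    - γ * evalLin as x + evalLin as x ↑ r                      ≈⟨ solve 3 (λ g l e → :- g :* l :+ e := e :- g :* l) refl γ (evalLin as x) (evalLin as x ↑ r) ⟩
    evalLin as x ↑ r - γ * evalLin as x                        ∎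

  leading-frobeniusMinus : ∀ γ as {t} → HasLeadingTerm as t 1# → HasLeadingTerm (frobeniusMinus γ as) (suc t) 1#
  leading-frobeniusMinus γ as {t} (lead , high) = leading-+ʳ { - γ ·ₚ as} {frobLin as}
    (λ i t<i → trans (coeff-· (- γ) as i) (trans (*-congˡ (high i t<i)) (zeroʳ _)))
    (trans (coeff-frobLin as t) (trans (^-congˡ r lead) (1↑n≈1 r)) ,
     λ { (suc i) (s≤s t<i) → trans (coeff-frobLin as i) (trans (^-congˡ r (high i t<i)) (0↑n≈0 0<r)) })

  -- If L vanishes on an F-subspace of V but not at x ∈ V, then L^r - L(x)^(r-1) L vanishes on the
  -- span of that subspace and x. Starting from as₀ this exhausts V, keeping the coefficients in the
  -- subring C.
  module Extend {v s : Level} (F : Subfield r) (V : Pred Carrier v)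
    (V-resp : ∀ {x y} → x ≈ y → V x → V y)
    (V-+ : ∀ {x y} → V x → V y → V (x + y)) (V-· : ∀ {a x} → Fixed r a → V x → V (a * x))
    (C : Pred Carrier s) (C-resp : ∀ {x y} → x ≈ y → C x → C y) (C-0 : C 0#) (C-1 : C 1#)
    (C-+ : ∀ {x y} → C x → C y → C (x + y)) (C-* : ∀ {x y} → C x → C y → C (x * y))
    (C-neg : ∀ {x} → C x → C (- x)) (V⊆C : ∀ {x} → V x → C x)
    (as₀ : List Carrier) (t₀ : ℕ) where

    open Subfield F using () renaming (elements to scalars; unique to scalars-unique; order to scalars-order)
    open ClosedCoefficients C C-resp C-0 C-+ C-*

    -- The list `roots` holds as many distinct roots in `V` as the degree of `composite`. For finite
    -- `V` this bounds the degree by the size of `V`, and once every element of `V` is a root the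
    -- two numbers agree.
    record Extension : Set (c ⊔ ℓ ⊔ v ⊔ s) where
      field
        outer composite   : List Carrier
        outerDegree       : ℕ
        evalLin-composite : ∀ x → evalLin outer (evalLin as₀ x) ≈ evalLin composite x
        outer-leading     : HasLeadingTerm outer outerDegree 1#
        composite-leading : HasLeadingTerm composite (outerDegree ℕ.+ t₀) 1#
        outer-closed      : outer HasCoefficientsIn C
        composite-closed  : composite HasCoefficientsIn C
        roots             : List Carrier
        roots-unique      : Unique roots
        roots-length      : length roots ≡ r ℕ.^ (outerDegree ℕ.+ t₀)
        roots∈V           : ∀ {x} → x ∈ roots → V x
        roots-vanish      : ∀ {x} → x ∈ roots → evalLin composite x ≈ 0#

    open Extension

    evalLin-closed : ∀ as {x} → as HasCoefficientsIn C → C x → C (evalLin as x)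
    evalLin-closed []       Cas Cx = C-0
    evalLin-closed (a ∷ as) Cas Cx = C-+ (C-* (Cas 0) Cx) (evalLin-closed as (Cas ∘ suc) (↑-closed C-1 r Cx))

    frobeniusMinus-closed : ∀ γ as → C γ → as HasCoefficientsIn C → frobeniusMinus γ as HasCoefficientsIn C
    frobeniusMinus-closed γ as Cγ Cas = +ₚ-closed (- γ ·ₚ as) (frobLin as) (·ₚ-closed as (C-neg Cγ) Cas)
      λ { zero → C-0 ; (suc i) → C-resp (sym (coeff-frobLin as i)) (↑-closed C-1 r (Cas i)) }

    _≼_ : Extension → Extension → Set (c ⊔ ℓ)
    E ≼ E′ = ∀ {x} → evalLin (composite E) x ≈ 0# → evalLin (composite E′) x ≈ 0#

    extend : ∀ E {x} → V x → ∃ λ E′ → evalLin (composite E′) x ≈ 0# × E ≼ E′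
    extend E {x} Vx = cases (L x ≟ 0#)
      where
      L : Carrier → Carrier
      L = evalLin (composite E)

      γ = L x ↑ (r ℕ.∸ 1)
      outer′ = frobeniusMinus γ (outer E)
      composite′ = frobeniusMinus γ (composite E)

      step : ∀ y → evalLin composite′ y ≈ L y ↑ r - γ * L y
      step = evalLin-frobeniusMinus γ (composite E)

      kernel : ∀ {y} → L y ≈ 0# → evalLin composite′ y ≈ 0#
      kernel {y} Ly≈0 = begin
        evalLin composite′ y    ≈⟨ step y ⟩
        L y ↑ r - γ * L y       ≈⟨ +-cong (trans (^-congˡ r Ly≈0) (0↑n≈0 0<r)) (-‿cong (*-congˡ Ly≈0)) ⟩
        0# - γ * 0#             ≈⟨ solve 1 (λ g → con (0 , 0) :- g :* con (0 , 0) := con (0 , 0)) refl γ ⟩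
        0#                      ∎

      scaled : ∀ {a} → Fixed r a → evalLin composite′ (a * x) ≈ 0#
      scaled {a} fa = begin
        evalLin composite′ (a * x)          ≈⟨ evalLin-homogeneous composite′ x fa ⟩
        a * evalLin composite′ x            ≈⟨ *-congˡ (step x) ⟩
        a * (L x ↑ r - γ * L x)             ≈⟨ *-congˡ (x≈y⇒x-y≈0 (trans (^-congʳ (L x) (≡.sym (ℕₚ.m+[n∸m]≡n 0<r))) (*-comm _ _))) ⟩
        a * 0#                              ≈⟨ zeroʳ a ⟩
        0#                                  ∎

      cases : Dec (L x ≈ 0#) → ∃ λ E′ → evalLin (composite E′) x ≈ 0# × E ≼ E′
      cases (yes Lx≈0) = E , Lx≈0 , λ eq → eq
      cases (no  Lx≉0) = E′ , trans (evalLin-cong composite′ (sym (*-identityˡ x))) (scaled (1↑n≈1 r)) , kernel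
        where
        combine : Carrier → Carrier → Carrier
        combine a w = a * x + w

        -- `L` reads off the scalar: as `L x` is nonzero, `a * x + w` determines `a`, so the new
        -- roots are pairwise distinct.
        L-combine : ∀ {a w} → a ∈ scalars → w ∈ roots E → L (combine a w) ≈ a * L x
        L-combine {a} {w} a∈ w∈ = begin
          L (a * x + w)          ≈⟨ evalLin-+ (composite E) (a * x) w ⟩
          L (a * x) + L w        ≈⟨ +-cong (evalLin-homogeneous (composite E) x (x∈F⇒x↑N≈x F a∈)) (roots-vanish E w∈) ⟩
          a * L x + 0#           ≈⟨ +-identityʳ _ ⟩
          a * L x                ∎

        newRoots : List Carrier
        newRoots = cartesianProductWith combine scalars (roots E)

        product⁻ : ∀ {y} → y ∈ newRoots → ∃₂ λ a w → a ∈ scalars × w ∈ roots E × y ≈ combine a w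
        product⁻ = Membershipₚ.∈-cartesianProductWith⁻ setoid setoid setoid combine scalars (roots E)

        unique : ∀ {as} → (∀ {a} → a ∈ as → a ∈ scalars) → Unique as → Unique (cartesianProductWith combine as (roots E))
        unique {[]}     _    _          = []
        unique {a ∷ as} as⊆ (a∉as ∷ u) = Uniqueₚ.++⁺ setoid
          (Uniqueₚ.map⁺ setoid setoid (λ {y} {z} eq → x-y≈0⇒x≈y y z (trans
            (solve 3 (λ b y z → y :- z := b :+ y :- (b :+ z)) refl (a * x) y z) (x≈y⇒x-y≈0 eq))) (roots-unique E))
          (unique (as⊆ ∘ there) u)
          λ (y∈map , y∈rest) →
            let w , w∈ , y≈ = Membershipₚ.∈-map⁻ setoid setoid y∈map
                b , w′ , b∈ , w′∈ , y≈′ = Membershipₚ.∈-cartesianProductWith⁻ setoid setoid setoid combine as (roots E) y∈rest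
            in Membershipₚ.All[≉]⇒∉ setoid a∉as (Membershipₚ.∈-resp-≈ setoid (*-cancelˡ Lx≉0 (begin
                 L x * b              ≈⟨ *-comm _ _ ⟩
                 b * L x              ≈⟨ L-combine (as⊆ (there b∈)) w′∈ ⟨
                 L (combine b w′)     ≈⟨ evalLin-cong (composite E) (trans (sym y≈′) y≈) ⟩
                 L (combine a w)      ≈⟨ L-combine (as⊆ (here refl)) w∈ ⟩
                 a * L x              ≈⟨ *-comm _ _ ⟩
                 L x * a              ∎)) b∈)

        length-newRoots : ∀ as → length (cartesianProductWith combine as (roots E)) ≡ length as ℕ.* length (roots E)
        length-newRoots []       = ≡.refl
        length-newRoots (a ∷ as) = ≡.trans (Listₚ.length-++ (map (combine a) (roots E)))
          (≡.cong₂ ℕ._+_ (Listₚ.length-map (combine a) (roots E)) (length-newRoots as))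

        γ∈C : C γ
        γ∈C = ↑-closed C-1 (r ℕ.∸ 1) (evalLin-closed (composite E) (composite-closed E) (V⊆C Vx))

        E′ : Extension
        E′ = record
          { outer             = outer′
          ; composite         = composite′
          ; outerDegree       = suc (outerDegree E)
          ; evalLin-composite = λ y → begin
              evalLin outer′ (evalLin as₀ y)
                ≈⟨ evalLin-frobeniusMinus γ (outer E) _ ⟩
              evalLin (outer E) (evalLin as₀ y) ↑ r - γ * evalLin (outer E) (evalLin as₀ y)
                ≈⟨ +-cong (^-congˡ r (evalLin-composite E y)) (-‿cong (*-congˡ (evalLin-composite E y))) ⟩
              L y ↑ r - γ * L y
                ≈⟨ step y ⟨
              evalLin composite′ y ∎
          ; outer-leading     = leading-frobeniusMinus γ (outer E) (outer-leading E)
          ; composite-leading = leading-frobeniusMinus γ (composite E) (composite-leading E)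
          ; outer-closed      = frobeniusMinus-closed γ (outer E) γ∈C (outer-closed E)
          ; composite-closed  = frobeniusMinus-closed γ (composite E) γ∈C (composite-closed E)
          ; roots             = newRoots
          ; roots-unique      = unique (λ a∈ → a∈) scalars-unique
          ; roots-length      = ≡.trans (length-newRoots scalars) (≡.cong₂ ℕ._*_ scalars-order (roots-length E))
          ; roots∈V           = λ y∈ → let a , w , a∈ , w∈ , y≈ = product⁻ y∈ in
              V-resp (sym y≈) (V-+ (V-· (x∈F⇒x↑N≈x F a∈) Vx) (roots∈V E w∈))
          ; roots-vanish      = λ {y} y∈ → let a , w , a∈ , w∈ , y≈ = product⁻ y∈ in begin
              evalLin composite′ y                               ≈⟨ evalLin-cong composite′ y≈ ⟩
              evalLin composite′ (a * x + w)                     ≈⟨ evalLin-+ composite′ (a * x) w ⟩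
              evalLin composite′ (a * x) + evalLin composite′ w  ≈⟨ +-cong (scaled (x∈F⇒x↑N≈x F a∈)) (kernel (roots-vanish E w∈)) ⟩
              0# + 0#                                            ≈⟨ +-identityˡ 0# ⟩
              0#                                                 ∎
          }

    extendAll : ∀ E xs → (∀ {x} → x ∈ xs → V x) → ∃ λ E′ → (∀ {x} → x ∈ xs → evalLin (composite E′) x ≈ 0#) × E ≼ E′
    extendAll E []       _    = E , (λ ()) , λ eq → eq
    extendAll E (x ∷ xs) xs⊆V =
      let E₁ , x-root , E≼E₁ = extend E (xs⊆V (here refl))
          E₂ , xs-roots , E₁≼E₂ = extendAll E₁ xs (xs⊆V ∘ there)
      in E₂ , (λ { (here y≈x) → trans (evalLin-cong (composite E₂) y≈x) (E₁≼E₂ x-root) ; (there y∈) → xs-roots y∈ }) , E₁≼E₂ ∘ E≼E₁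

-- Orbits of exponents under multiplication by `r`.

∤⇒>0 : ∀ {r e} → r ∤ e → 0 < e
∤⇒>0 {e = zero}  r∤0 = contradiction (_ ℕᵈ.∣0) r∤0
∤⇒>0 {e = suc e} _   = s≤s z≤n

n<r^n : ∀ {r} → 1 < r → ∀ n → n < r ℕ.^ n
n<r^n         1<r zero    = s≤s z≤n
n<r^n {r} 1<r (suc n) = ℕₚ.<-≤-trans
  (≡.subst (suc n <_) (≡.cong (r ℕ.^ n ℕ.+_) (≡.sym (ℕₚ.+-identityʳ _))) (ℕₚ.+-mono-≤-< (ℕₚ.≤-trans (s≤s z≤n) (n<r^n 1<r n)) (n<r^n 1<r n)))
  (ℕₚ.*-monoˡ-≤ (r ℕ.^ n) 1<r)

-- The factor `r` is divided out as often as possible. Since `r` need not be prime, representatives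
-- are the numbers not divisible by `r` itself; they may share factors with it.
orbitRepresentative : ∀ {r} → 1 < r → ∀ m → 0 < m → ∃₂ λ e i → r ∤ e × m ≡ e ℕ.* r ℕ.^ i
orbitRepresentative {r} 1<r m 0<m = bounded m m 0<m ℕₚ.≤-refl
  where
  bounded : ∀ n m → 0 < m → m ≤ n → ∃₂ λ e i → r ∤ e × m ≡ e ℕ.* r ℕ.^ i
  bounded zero    m 0<m m≤0 = contradiction 0<m (ℕₚ.≤⇒≯ m≤0)
  bounded (suc n) m 0<m m≤n with r ∣? m
  ... | no  r∤m = m , 0 , r∤m , ≡.sym (ℕₚ.*-identityʳ m)
  ... | yes (divides zero    ≡.refl) = contradiction 0<m λ ()
  ... | yes (divides l@(suc _) ≡.refl) with bounded n l (s≤s z≤n) (ℕₚ.≤-pred (ℕₚ.<-≤-trans (ℕₚ.m<m*n l r 1<r) m≤n))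
  ...   | e , i , r∤e , l≡ = e , suc i , r∤e , ≡.trans (≡.cong (ℕ._* r) l≡)
          (≡.trans (ℕₚ.*-assoc e (r ℕ.^ i) r) (≡.cong (e ℕ.*_) (ℕₚ.*-comm (r ℕ.^ i) r)))

e*r^[1+i]≡r*[e*r^i] : ∀ e r i → e ℕ.* r ℕ.^ suc i ≡ r ℕ.* (e ℕ.* r ℕ.^ i)
e*r^[1+i]≡r*[e*r^i] e r i = ≡.trans (≡.sym (ℕₚ.*-assoc e r (r ℕ.^ i)))
  (≡.trans (≡.cong (ℕ._* r ℕ.^ i) (ℕₚ.*-comm e r)) (ℕₚ.*-assoc r e (r ℕ.^ i)))

orbitRepresentative-unique : ∀ {r e e′} → 1 < r → r ∤ e → r ∤ e′ → ∀ i j → e ℕ.* r ℕ.^ i ≡ e′ ℕ.* r ℕ.^ j → e ≡ e′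
orbitRepresentative-unique 1<r r∤e r∤e′ zero zero eq =
  ≡.trans (≡.sym (ℕₚ.*-identityʳ _)) (≡.trans eq (ℕₚ.*-identityʳ _))
orbitRepresentative-unique {r} {e} {e′} 1<r r∤e r∤e′ zero (suc j) eq = contradiction
  (≡.subst (r ∣_) (≡.trans (≡.sym (e*r^[1+i]≡r*[e*r^i] e′ r j)) (≡.trans (≡.sym eq) (ℕₚ.*-identityʳ e))) (ℕᵈ.m∣m*n _)) r∤e
orbitRepresentative-unique {r} {e} {e′} 1<r r∤e r∤e′ (suc i) zero eq = contradiction
  (≡.subst (r ∣_) (≡.trans (≡.sym (e*r^[1+i]≡r*[e*r^i] e r i)) (≡.trans eq (ℕₚ.*-identityʳ e′))) (ℕᵈ.m∣m*n _)) r∤e′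
orbitRepresentative-unique {r@(suc _)} {e} {e′} 1<r r∤e r∤e′ (suc i) (suc j) eq = orbitRepresentative-unique 1<r r∤e r∤e′ i j
  (ℕₚ.*-cancelˡ-≡ _ _ r (≡.trans (≡.sym (e*r^[1+i]≡r*[e*r^i] e r i)) (≡.trans eq (e*r^[1+i]≡r*[e*r^i] e′ r j))))

-- Coefficients along an orbit, and composites of linearized polynomials with few terms.

module Orbits {c ℓ : Level} (K : Field c ℓ) (closed : Over.AlgebraicallyClosed K)
  {r : ℕ} (1<r : 1 < r) (frobenius : FieldProperties.Frobenius K r) where

  open Over K hiding (zero)
  open FieldProperties K
  open PolynomialProperties K
  open AlgebraicallyClosedField closed
  open FixedPoints K
  open LinearizedPolynomials K closed 1<r frobenius
  open import Relation.Binary.Reasoning.Setoid setoid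

  private
    0<r : 0 < r
    0<r = ℕₚ.<-trans (s≤s z≤n) 1<r

    suc[r-1]≡r : suc (r ℕ.∸ 1) ≡ r
    suc[r-1]≡r = ℕₚ.m+[n∸m]≡n 0<r

  shiftₚ : ℕ → Poly → Poly
  shiftₚ m P = replicate m 0# ++ P

  eval-shiftₚ : ∀ m P x → eval (shiftₚ m P) x ≈ x ↑ m * eval P x
  eval-shiftₚ zero    P x = sym (*-identityˡ _)
  eval-shiftₚ (suc m) P x = trans (+-identityˡ _) (trans (*-congˡ (eval-shiftₚ m P x)) (sym (*-assoc _ _ _)))

  coeff-shiftₚ-< : ∀ m P {i} → i < m → coeff (shiftₚ m P) i ≡ 0#
  coeff-shiftₚ-< (suc m) P {zero}  _         = ≡.refl
  coeff-shiftₚ-< (suc m) P {suc i} (s≤s i<m) = coeff-shiftₚ-< m P i<m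

  coeff-shiftₚ-+ : ∀ m P i → coeff (shiftₚ m P) (m ℕ.+ i) ≡ coeff P i
  coeff-shiftₚ-+ zero    P i = ≡.refl
  coeff-shiftₚ-+ (suc m) P i = coeff-shiftₚ-+ m P i

  -- This is the `r`-th power of the polynomial. `X^ r ∘ₚ P` takes the same values, but here the
  -- coefficients are visible: they are `r`-th powers at `r`-fold exponents. The shift is by `r ∸ 1`
  -- because the head of the list accounts for one place.
  frobₚ : Poly → Poly
  frobₚ []      = []
  frobₚ (a ∷ P) = a ↑ r ∷ shiftₚ (r ℕ.∸ 1) (frobₚ P)

  eval-frobₚ : ∀ P x → eval (frobₚ P) x ≈ eval P x ↑ r
  eval-frobₚ []      x = sym (0↑n≈0 0<r)
  eval-frobₚ (a ∷ P) x = begin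
    a ↑ r + x * eval (shiftₚ (r ℕ.∸ 1) (frobₚ P)) x       ≈⟨ +-congˡ (*-congˡ (eval-shiftₚ (r ℕ.∸ 1) (frobₚ P) x)) ⟩
    a ↑ r + x * (x ↑ (r ℕ.∸ 1) * eval (frobₚ P) x)        ≈⟨ +-congˡ (trans (sym (*-assoc _ _ _)) (*-cong (^-congʳ x suc[r-1]≡r) (eval-frobₚ P x))) ⟩
    a ↑ r + x ↑ r * eval P x ↑ r                          ≈⟨ +-congˡ (^-distrib-* x (eval P x) r) ⟨
    a ↑ r + (x * eval P x) ↑ r                            ≈⟨ frobenius a (x * eval P x) ⟨
    (a + x * eval P x) ↑ r                                ∎

  private
    coeff-frobₚ-shift : ∀ a P i → coeff (frobₚ (a ∷ P)) (r ℕ.+ i) ≡ coeff (frobₚ P) i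
    coeff-frobₚ-shift a P i = ≡.trans (≡.cong (λ m → coeff (frobₚ (a ∷ P)) (m ℕ.+ i)) (≡.sym suc[r-1]≡r))
      (coeff-shiftₚ-+ (r ℕ.∸ 1) (frobₚ P) i)

  coeff-frobₚ-multiple : ∀ P l → coeff (frobₚ P) (r ℕ.* l) ≈ coeff P l ↑ r
  coeff-frobₚ-multiple []      l       = sym (0↑n≈0 0<r)
  coeff-frobₚ-multiple (a ∷ P) zero    = reflexive (≡.cong (coeff (frobₚ (a ∷ P))) (ℕₚ.*-zeroʳ r))
  coeff-frobₚ-multiple (a ∷ P) (suc l) = trans (reflexive (≡.trans (≡.cong (coeff (frobₚ (a ∷ P))) (ℕₚ.*-suc r l)) (coeff-frobₚ-shift a P (r ℕ.* l))))
    (coeff-frobₚ-multiple P l)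

  SupportedOnMultiples : Poly → Set ℓ
  SupportedOnMultiples P = ∀ m → r ∤ m → coeff P m ≈ 0#

  frobₚ-supported : ∀ P → SupportedOnMultiples (frobₚ P)
  frobₚ-supported []      m r∤m = refl
  frobₚ-supported (a ∷ P) m r∤m = cases (ℕₚ.<-≤-connex m r)
    where
    small : ∀ m → r ∤ m → m < r → coeff (frobₚ (a ∷ P)) m ≈ 0#
    small zero    r∤0 _     = contradiction (r ℕᵈ.∣0) r∤0
    small (suc m) _   sm<r = reflexive (coeff-shiftₚ-< (r ℕ.∸ 1) (frobₚ P) (ℕₚ.≤-pred (≡.subst (suc m <_) (≡.sym suc[r-1]≡r) sm<r)))

    cases : m < r ⊎ r ≤ m → coeff (frobₚ (a ∷ P)) m ≈ 0#
    cases (inj₁ m<r) = small m r∤m m<r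
    cases (inj₂ r≤m) = trans (reflexive (≡.trans (≡.cong (coeff (frobₚ (a ∷ P))) (≡.sym (ℕₚ.m+[n∸m]≡n r≤m))) (coeff-frobₚ-shift a P (m ℕ.∸ r))))
      (frobₚ-supported P (m ℕ.∸ r) (λ r∣ → r∤m (≡.subst (r ∣_) (ℕₚ.m+[n∸m]≡n r≤m) (ℕᵈ.∣m∣n⇒∣m+n ℕᵈ.∣-refl r∣))))

  -- The composite of the encoded linearized polynomial with `F`, arranged so that every summand
  -- after the first comes from an `r`-th power. Only the first can contribute at exponents not
  -- divisible by `r`.
  applyₚ : List Carrier → Poly → Poly
  applyₚ []       F = []
  applyₚ (a ∷ as) F = a ·ₚ F +ₚ applyₚ as (frobₚ F)

  eval-applyₚ : ∀ as F x → eval (applyₚ as F) x ≈ evalLin as (eval F x)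
  eval-applyₚ []       F x = refl
  eval-applyₚ (a ∷ as) F x = trans (eval-+ (a ·ₚ F) (applyₚ as (frobₚ F)) x)
    (+-cong (eval-· a F x) (trans (eval-applyₚ as (frobₚ F) x) (evalLin-cong as (eval-frobₚ F x))))

  applyₚ-supported : ∀ as F → SupportedOnMultiples F → SupportedOnMultiples (applyₚ as F)
  applyₚ-supported []       F _    m r∤m = refl
  applyₚ-supported (a ∷ as) F supp m r∤m = trans (coeff-+ (a ·ₚ F) (applyₚ as (frobₚ F)) m)
    (trans (+-cong (trans (coeff-· a F m) (trans (*-congˡ (supp m r∤m)) (zeroʳ a)))
      (applyₚ-supported as (frobₚ F) (frobₚ-supported F) m r∤m)) (+-identityˡ 0#))

  coeff-applyₚ-∤ : ∀ as F m → r ∤ m → coeff F m ≈ 0# → coeff (applyₚ as F) m ≈ 0#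
  coeff-applyₚ-∤ []       F m r∤m Fm≈0 = refl
  coeff-applyₚ-∤ (a ∷ as) F m r∤m Fm≈0 = trans (coeff-+ (a ·ₚ F) (applyₚ as (frobₚ F)) m)
    (trans (+-cong (trans (coeff-· a F m) (trans (*-congˡ Fm≈0) (zeroʳ a)))
      (applyₚ-supported as (frobₚ F) (frobₚ-supported F) m r∤m)) (+-identityˡ 0#))

  composeLin : List Carrier → List Carrier → List Carrier
  composeLin []       bs = []
  composeLin (a ∷ as) bs = a ·ₚ bs +ₚ composeLin as (frobLin bs)

  evalLin-composeLin : ∀ as bs x → evalLin (composeLin as bs) x ≈ evalLin as (evalLin bs x)
  evalLin-composeLin []       bs x = refl
  evalLin-composeLin (a ∷ as) bs x = trans (evalLin-+ₚ (a ·ₚ bs) (composeLin as (frobLin bs)) x)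
    (+-cong (evalLin-·ₚ a bs x) (trans (evalLin-composeLin as (frobLin bs) x) (evalLin-cong as (evalLin-frobLin bs x))))

  -- The coefficients of P at the exponents e, e r, e r², … form a linearized polynomial, and
  -- applying a linearized polynomial to P composes it with each of these.
  IsOrbit : ℕ → Poly → List Carrier → Set ℓ
  IsOrbit e P bs = ∀ i → coeff bs i ≈ coeff P (e ℕ.* r ℕ.^ i)

  orbit : ℕ → Poly → List Carrier
  orbit e P = applyUpTo (λ i → coeff P (e ℕ.* r ℕ.^ i)) (length P)

  -- Cutting the orbit off after `length P` entries loses nothing: `i < r ^ i ≤ e * r ^ i`, so the
  -- later exponents lie beyond the end of `P`.
  orbit-isOrbit : ∀ {e} P → 0 < e → IsOrbit e P (orbit e P)
  orbit-isOrbit {e@(suc _)} P _ i = cases (ℕₚ.<-≤-connex i (length P))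
    where
    coeff-applyUpTo-< : ∀ (f : ℕ → Carrier) n {i} → i < n → coeff (applyUpTo f n) i ≡ f i
    coeff-applyUpTo-< f (suc n) {zero}  _         = ≡.refl
    coeff-applyUpTo-< f (suc n) {suc i} (s≤s i<n) = coeff-applyUpTo-< (f ∘ suc) n i<n

    cases : i < length P ⊎ length P ≤ i → coeff (orbit e P) i ≈ coeff P (e ℕ.* r ℕ.^ i)
    cases (inj₁ i<n) = reflexive (coeff-applyUpTo-< _ (length P) i<n)
    cases (inj₂ n≤i) = reflexive (≡.trans
      (coeff-≥length (orbit e P) (≡.subst (_≤ i) (≡.sym (Listₚ.length-applyUpTo _ (length P))) n≤i))
      (≡.sym (coeff-≥length P (ℕₚ.≤-trans n≤i (ℕₚ.≤-trans (ℕₚ.<⇒≤ (n<r^n 1<r i)) (ℕₚ.m≤n*m (r ℕ.^ i) e))))))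

  isOrbit-frob : ∀ {e P bs} → r ∤ e → IsOrbit e P bs → IsOrbit e (frobₚ P) (frobLin bs)
  isOrbit-frob {e} {P} {bs} r∤e orb zero    = sym (frobₚ-supported P (e ℕ.* 1) (r∤e ∘ ≡.subst (r ∣_) (ℕₚ.*-identityʳ e)))
  isOrbit-frob {e} {P} {bs} r∤e orb (suc i) = begin
    coeff (frobLin bs) (suc i)                         ≈⟨ coeff-frobLin bs i ⟩
    coeff bs i ↑ r                                     ≈⟨ ^-congˡ r (orb i) ⟩
    coeff P (e ℕ.* r ℕ.^ i) ↑ r                        ≈⟨ coeff-frobₚ-multiple P (e ℕ.* r ℕ.^ i) ⟨
    coeff (frobₚ P) (r ℕ.* (e ℕ.* r ℕ.^ i))            ≡⟨ ≡.cong (coeff (frobₚ P)) (e*r^[1+i]≡r*[e*r^i] e r i) ⟨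
    coeff (frobₚ P) (e ℕ.* r ℕ.^ suc i)                ∎

  isOrbit-apply : ∀ {e} as {P bs} → r ∤ e → IsOrbit e P bs → IsOrbit e (applyₚ as P) (composeLin as bs)
  isOrbit-apply     []                r∤e orb i = refl
  isOrbit-apply {e} (a ∷ as) {P} {bs} r∤e orb i = begin
    coeff (a ·ₚ bs +ₚ composeLin as (frobLin bs)) i                 ≈⟨ coeff-+ (a ·ₚ bs) (composeLin as (frobLin bs)) i ⟩
    coeff (a ·ₚ bs) i + coeff (composeLin as (frobLin bs)) i        ≈⟨ +-cong (trans (coeff-· a bs i) (*-congˡ (orb i)))
                                                                        (isOrbit-apply as {frobₚ P} {frobLin bs} r∤e (isOrbit-frob {e} {P} {bs} r∤e orb) i) ⟩
    a * coeff P m + coeff (applyₚ as (frobₚ P)) m                   ≈⟨ +-congʳ (coeff-· a P m) ⟨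
    coeff (a ·ₚ P) m + coeff (applyₚ as (frobₚ P)) m                ≈⟨ coeff-+ (a ·ₚ P) (applyₚ as (frobₚ P)) m ⟨
    coeff (a ·ₚ P +ₚ applyₚ as (frobₚ P)) m                         ∎
    where
    m = e ℕ.* r ℕ.^ i

  module _ (as : List Carrier) (A1≈0 : evalLin as 1# ≈ 0#) where

    private
      A : Carrier → Carrier
      A = evalLin as

    -- If `Φ` is constant it is zero, and so is `A ∘ Φ`. Otherwise `Φ` takes the value `1#` at some
    -- `x`; then `A 1# ≈ 0#` makes the monomial vanish there, so `x` is zero, against `Φ(0) = 0`.
    composite≉monomial : ∀ bs {η} m → η ≉ 0# → ¬ (∀ x → A (evalLin bs x) ≈ η * x ↑ m)
    composite≉monomial bs {η} m η≉0 eq = cases (constant⊎surjective (linearized bs))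
      where
      Φ≈ : ∀ x → eval (linearized bs) x ≈ evalLin bs x
      Φ≈ = eval-linearized bs

      cases : (∀ x → eval (linearized bs) x ≈ coeff (linearized bs) 0) ⊎ (∀ z → ∃ λ x → eval (linearized bs) x ≈ z) → ⊥
      cases (inj₁ const) = η≉0 (begin
        η                          ≈⟨ *-identityʳ η ⟨
        η * 1#                     ≈⟨ *-congˡ (1↑n≈1 m) ⟨
        η * 1# ↑ m                 ≈⟨ eq 1# ⟨
        A (evalLin bs 1#)          ≈⟨ evalLin-cong as (trans (sym (Φ≈ 1#)) (trans (const 1#) (trans (sym (const 0#)) (trans (Φ≈ 0#) (evalLin-0 bs))))) ⟩
        A 0#                       ≈⟨ evalLin-0 as ⟩
        0#                         ∎)
      cases (inj₂ surj) = let x , Φx≈1 = surj 1# in 1≉0 (begin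
        1#                         ≈⟨ trans (sym Φx≈1) (Φ≈ x) ⟩
        evalLin bs x               ≈⟨ evalLin-cong bs (x↑n≈0⇒x≈0 m (xy≈0⇒y≈0 η≉0 (trans (sym (eq x))
                                        (trans (evalLin-cong as (trans (sym (Φ≈ x)) Φx≈1)) A1≈0)))) ⟩
        evalLin bs 0#              ≈⟨ evalLin-0 bs ⟩
        0#                         ∎)

    -- S(x) = x - Φ(η₀⁻¹ A(x)) satisfies A(S(x)) = κ A(x)^T, so 0 is its only root and S(x) = x^m
    -- (the scalar is 1 because S fixes the roots of A, among them 1). Comparing leading terms in
    -- A(x^m) = κ A(x)^T gives m = T and κ = 1.
    composite≈binomial : ∀ {s} → HasLeadingTerm as s 1# → ∀ bs {η₀ η T} → η₀ ≉ 0# → η ≉ 0# →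
      (∀ x → A (evalLin bs x) ≈ η₀ * x + η * x ↑ T) → Frobenius T → 0 < T →
      (∀ {u} → A u ≈ 0# → Fixed T u) × η ≈ - η₀ ↑ T
    composite≈binomial {s} monic bs {η₀} {η} {T} η₀≉0 η≉0 eq frobT 0<T = fixes , η≈
      where
      z = proj₁ (inverse η₀ η₀≉0)
      η₀z≈1 : η₀ * z ≈ 1#
      η₀z≈1 = proj₂ (inverse η₀ η₀≉0)

      z≉0 : z ≉ 0#
      z≉0 z≈0 = 1≉0 (trans (sym η₀z≈1) (trans (*-congˡ z≈0) (zeroʳ η₀)))

      κ = - (η * z ↑ T)

      κ≉0 : κ ≉ 0#
      κ≉0 eq = *-≉0 η≉0 (λ z^T≈0 → z≉0 (x↑n≈0⇒x≈0 T z^T≈0)) (trans (sym (-‿involutive _)) (trans (-‿cong eq) -0≈0))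

      Aₚ = linearized as
      Φₚ = linearized bs ∘ₚ (z ·ₚ Aₚ)
      S = X -ₚ Φₚ

      eval-S : ∀ x → eval S x ≈ x - evalLin bs (z * A x)
      eval-S x = trans (eval-- X Φₚ x) (+-cong (eval-X x) (-‿cong (trans (eval-∘ (linearized bs) (z ·ₚ Aₚ) x)
        (trans (eval-linearized bs _) (evalLin-cong bs (trans (eval-· z Aₚ x) (*-congˡ (eval-linearized as x))))))))

      A∘S : ∀ x → A (eval S x) ≈ κ * A x ↑ T
      A∘S x = begin
        A (eval S x)                                          ≈⟨ evalLin-cong as (eval-S x) ⟩
        A (x - evalLin bs (z * A x))                          ≈⟨ evalLin-- as x _ ⟩
        A x - A (evalLin bs (z * A x))                        ≈⟨ +-congˡ (-‿cong (eq (z * A x))) ⟩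
        A x - (η₀ * (z * A x) + η * (z * A x) ↑ T)            ≈⟨ +-congˡ (-‿cong (+-cong (trans (sym (*-assoc _ _ _)) (trans (*-congʳ η₀z≈1) (*-identityˡ _)))
                                                                    (*-congˡ (^-distrib-* z (A x) T)))) ⟩
        A x - (A x + η * (z ↑ T * A x ↑ T))                   ≈⟨ solve 4 (λ a η z t → a :- (a :+ η :* (z :* t)) := :- (η :* z) :* t) refl (A x) η (z ↑ T) (A x ↑ T) ⟩
        - (η * z ↑ T) * A x ↑ T                               ∎

      fixesRoots : ∀ {u} → A u ≈ 0# → eval S u ≈ u
      fixesRoots {u} Au≈0 = begin
        eval S u                        ≈⟨ eval-S u ⟩
        u - evalLin bs (z * A u)        ≈⟨ +-congˡ (-‿cong (trans (evalLin-cong bs (trans (*-congˡ Au≈0) (zeroʳ z))) (evalLin-0 bs))) ⟩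
        u - 0#                          ≈⟨ trans (+-congˡ -0≈0) (+-identityʳ u) ⟩
        u                               ∎

      onlyZero : ∀ x → eval S x ≈ 0# → x ≈ 0#
      onlyZero x Sx≈0 = trans (sym (fixesRoots (x↑n≈0⇒x≈0 T (xy≈0⇒y≈0 κ≉0 (trans (sym (A∘S x))
        (trans (evalLin-cong as Sx≈0) (evalLin-0 as))))))) Sx≈0

      monomial : Monomial S
      monomial = onlyZeroRoot⇒monomial S onlyZero
      σ = proj₁ monomial
      m = proj₁ (proj₂ monomial)

      σ≈1 : σ ≈ 1#
      σ≈1 = begin
        σ              ≈⟨ *-identityʳ σ ⟨
        σ * 1#         ≈⟨ *-congˡ (1↑n≈1 m) ⟨
        σ * 1# ↑ m     ≈⟨ proj₂ (proj₂ monomial) 1# ⟨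
        eval S 1#      ≈⟨ fixesRoots A1≈0 ⟩
        1#             ∎

      S≈x^m : ∀ x → eval S x ≈ x ↑ m
      S≈x^m x = trans (proj₂ (proj₂ monomial) x) (trans (*-congʳ σ≈1) (*-identityˡ _))

      -- The exponent zero would give `S(0) = 1`, whereas `0#` is a root of `A` and therefore fixed
      -- by `S`.
      0<m : 0 < m
      0<m = positive m S≈x^m
        where
        positive : ∀ m → (∀ x → eval S x ≈ x ↑ m) → 0 < m
        positive zero    S≈ = ⊥-elim (1≉0 (trans (sym (S≈ 0#)) (fixesRoots (evalLin-0 as))))
        positive (suc m) _  = s≤s z≤n

      polynomials≈ : Aₚ ∘ₚ X^ m ≈ₚ κ ·ₚ (X^ T ∘ₚ Aₚ)
      polynomials≈ = eval-injective (Aₚ ∘ₚ X^ m) (κ ·ₚ (X^ T ∘ₚ Aₚ)) λ x → begin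
        eval (Aₚ ∘ₚ X^ m) x              ≈⟨ trans (eval-∘ Aₚ (X^ m) x) (eval-linearized as _) ⟩
        A (eval (X^ m) x)                ≈⟨ evalLin-cong as (trans (eval-X^ m x) (sym (S≈x^m x))) ⟩
        A (eval S x)                     ≈⟨ A∘S x ⟩
        κ * A x ↑ T                     ≈⟨ *-congˡ (^-congˡ T (eval-linearized as x)) ⟨
        κ * eval Aₚ x ↑ T               ≈⟨ *-congˡ (eval-X^∘ T Aₚ x) ⟨
        κ * eval (X^ T ∘ₚ Aₚ) x         ≈⟨ eval-· κ (X^ T ∘ₚ Aₚ) x ⟨
        eval (κ ·ₚ (X^ T ∘ₚ Aₚ)) x      ∎

      leadingTerms : r ℕ.^ s ℕ.* m ≡ T ℕ.* r ℕ.^ s × 1# ≈ κ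
      leadingTerms = leading-unique {κ ·ₚ (X^ T ∘ₚ Aₚ)}
        (leading-≈ₚ {Aₚ ∘ₚ X^ m} {κ ·ₚ (X^ T ∘ₚ Aₚ)} polynomials≈ (leading-≈ {Aₚ ∘ₚ X^ m} (trans (*-identityˡ _) (1↑n≈1 (r ℕ.^ s)))
          (leading-∘ Aₚ (X^ m) 0<m (leading-linearized as monic) (leading-X^ m))))
        (leading-≈ {κ ·ₚ (X^ T ∘ₚ Aₚ)} (trans (*-congˡ (trans (*-identityˡ _) (1↑n≈1 T))) (*-identityʳ κ))
          (leading-· {X^ T ∘ₚ Aₚ} κ (leading-∘ (X^ T) Aₚ (ℕₚ.≤-trans (s≤s z≤n) (n<r^n 1<r s)) (leading-X^ T) (leading-linearized as monic))))
        1≉0 κ≉0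

      m≡T : m ≡ T
      m≡T = ℕₚ.*-cancelˡ-≡ m T (r ℕ.^ s) {{ℕ.>-nonZero (ℕₚ.≤-trans (s≤s z≤n) (n<r^n 1<r s))}}
        (≡.trans (proj₁ leadingTerms) (ℕₚ.*-comm T (r ℕ.^ s)))

      fixes : ∀ {u} → A u ≈ 0# → Fixed T u
      fixes {u} Au≈0 = trans (^-congʳ u (≡.sym m≡T)) (trans (sym (S≈x^m u)) (fixesRoots Au≈0))

      η≈ : η ≈ - η₀ ↑ T
      η≈ = begin
        η                                   ≈⟨ *-identityʳ η ⟨
        η * 1#                              ≈⟨ *-congˡ (trans (^-congˡ T η₀z≈1) (1↑n≈1 T)) ⟨
        η * (η₀ * z) ↑ T                    ≈⟨ *-congˡ (^-distrib-* η₀ z T) ⟩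
        η * (η₀ ↑ T * z ↑ T)                ≈⟨ solve 3 (λ η a b → η :* (a :* b) := :- a :* :- (η :* b)) refl η (η₀ ↑ T) (z ↑ T) ⟩
        - η₀ ↑ T * κ                       ≈⟨ *-congˡ (proj₂ leadingTerms) ⟨
        - η₀ ↑ T * 1#                       ≈⟨ *-identityʳ _ ⟩
        - η₀ ↑ T                            ∎

-- Writing `y` in the form `f^Q - f`.

module ArtinSchreier {c ℓ : Level} (K : Field c ℓ) (closed : Over.AlgebraicallyClosed K)
  {r : ℕ} (1<r : 1 < r) (frobenius : FieldProperties.Frobenius K r) where

  open Over K hiding (zero)
  open FieldProperties K
  open PolynomialProperties K
  open AlgebraicallyClosedField closed
  open FixedPoints K
  open LinearizedPolynomials K closed 1<r frobenius
  open Orbits K closed 1<r frobenius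
  open import Relation.Binary.Reasoning.Setoid setoid

  private
    0<r : 0 < r
    0<r = ℕₚ.<-trans (s≤s z≤n) 1<r

    instance
      r≢0 : NonZero r
      r≢0 = ℕ.>-nonZero 0<r

  module Support (as : List Carrier) (F B : Poly) {D q : ℕ} (0<D : 0 < D) (D<q : D < q) (r∣q : r ∣ q)
    (F-high : ∀ m → D < m → coeff F m ≈ 0#) (B-high : ∀ m → D ≤ m → coeff B m ≈ 0#)
    (factored : ∀ x → eval (applyₚ as F) x ≈ (x ↑ q - x) * eval B x) where

    y : Poly
    y = applyₚ as F

    y≈ : y ≈ₚ shiftₚ q B -ₚ shiftₚ 1 B
    y≈ = eval-injective y (shiftₚ q B -ₚ shiftₚ 1 B) λ x → begin
      eval y x                                               ≈⟨ factored x ⟩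
      (x ↑ q - x) * eval B x                                 ≈⟨ solve 3 (λ e x b → (e :- x) :* b := e :* b :- x :* b) refl (x ↑ q) x (eval B x) ⟩
      x ↑ q * eval B x - x * eval B x                        ≈⟨ +-cong (eval-shiftₚ q B x) (-‿cong (+-identityˡ _)) ⟨
      eval (shiftₚ q B) x - eval (shiftₚ 1 B) x              ≈⟨ eval-- (shiftₚ q B) (shiftₚ 1 B) x ⟨
      eval (shiftₚ q B -ₚ shiftₚ 1 B) x                      ∎

    coeff-y-low : ∀ {m} → suc m < q → coeff y (suc m) ≈ - coeff B m
    coeff-y-low {m} sm<q = begin
      coeff y (suc m)                                                  ≈⟨ y≈ (suc m) ⟩
      coeff (shiftₚ q B -ₚ shiftₚ 1 B) (suc m)                         ≈⟨ coeff-- (shiftₚ q B) (shiftₚ 1 B) (suc m) ⟩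
      coeff (shiftₚ q B) (suc m) - coeff B m                           ≡⟨ ≡.cong (_- coeff B m) (coeff-shiftₚ-< q B sm<q) ⟩
      0# - coeff B m                                                   ≈⟨ +-identityˡ _ ⟩
      - coeff B m                                                      ∎

    coeff-y-high : ∀ m → coeff y (q ℕ.+ m) ≈ coeff B m
    coeff-y-high m = begin
      coeff y (q ℕ.+ m)                                                ≈⟨ y≈ (q ℕ.+ m) ⟩
      coeff (shiftₚ q B -ₚ shiftₚ 1 B) (q ℕ.+ m)                       ≈⟨ coeff-- (shiftₚ q B) (shiftₚ 1 B) (q ℕ.+ m) ⟩
      coeff (shiftₚ q B) (q ℕ.+ m) - coeff (shiftₚ 1 B) (q ℕ.+ m)      ≈⟨ +-cong (reflexive (coeff-shiftₚ-+ q B m)) (-‿cong (shift-high (q ℕ.+ m) (ℕₚ.<-≤-trans D<q (ℕₚ.m≤m+n q m)))) ⟩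
      coeff B m - 0#                                                   ≈⟨ trans (+-congˡ -0≈0) (+-identityʳ _) ⟩
      coeff B m                                                        ∎
      where
      shift-high : ∀ i → D < i → coeff (shiftₚ 1 B) i ≈ 0#
      shift-high (suc i) (s≤s D≤i) = B-high i D≤i

    -- The coefficient of `B` at `m` reappears in `y` at `q + m`. If `r` does not divide `m` it does
    -- not divide `q + m` either, so only the linear term of `A` could contribute there, and `q + m`
    -- exceeds the degree of `F`.
    B-supported : SupportedOnMultiples B
    B-supported m r∤m = trans (sym (coeff-y-high m)) (coeff-applyₚ-∤ as F (q ℕ.+ m)
      (λ r∣q+m → r∤m (ℕᵈ.∣m+n∣m⇒∣n r∣q+m r∣q)) (F-high (q ℕ.+ m) (ℕₚ.<-≤-trans D<q (ℕₚ.m≤m+n q m))))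

    -- Below `q` the polynomial `y` agrees with `- x B`, and `B-supported` confines its exponents to
    -- those congruent to 1 modulo `r`. From `q` on it agrees with `x^q B`, of degree below `q + D`.
    r∣m⇒q≤m<2q : ∀ m → r ∣ m → coeff y m ≉ 0# → q ≤ m × m < q ℕ.+ q
    r∣m⇒q≤m<2q m r∣m ym≉0 = cases (ℕₚ.<-≤-connex m q)
      where
      small : ∀ m → r ∣ m → m < q → coeff y m ≈ 0#
      small zero _ 0<q = begin
        coeff y 0                                        ≈⟨ y≈ 0 ⟩
        coeff (shiftₚ q B -ₚ shiftₚ 1 B) 0               ≈⟨ coeff-- (shiftₚ q B) (shiftₚ 1 B) 0 ⟩
        coeff (shiftₚ q B) 0 - 0#                        ≈⟨ +-cong (reflexive (coeff-shiftₚ-< q B 0<q)) -0≈0 ⟩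
        0# + 0#                                          ≈⟨ +-identityˡ 0# ⟩
        0#                                               ∎
      small (suc m) r∣sm sm<q = trans (coeff-y-low sm<q) (trans (-‿cong (B-supported m λ r∣m →
        ℕₚ.<⇒≢ 1<r (≡.sym (ℕᵈ.∣1⇒≡1 (ℕᵈ.∣m+n∣m⇒∣n (≡.subst (r ∣_) (ℕₚ.+-comm 1 m) r∣sm) r∣m))))) -0≈0)

      cases : m < q ⊎ q ≤ m → q ≤ m × m < q ℕ.+ q
      cases (inj₁ m<q) = ⊥-elim (ym≉0 (small m r∣m m<q))
      cases (inj₂ q≤m) = q≤m , large (ℕₚ.<-≤-connex (m ℕ.∸ q) D)
        where
        q+[m∸q]≡m : q ℕ.+ (m ℕ.∸ q) ≡ m
        q+[m∸q]≡m = ℕₚ.m+[n∸m]≡n q≤m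
        large : m ℕ.∸ q < D ⊎ D ≤ m ℕ.∸ q → m < q ℕ.+ q
        large (inj₁ small) = ≡.subst (_< q ℕ.+ q) q+[m∸q]≡m (ℕₚ.+-monoʳ-< q (ℕₚ.<-trans small D<q))
        large (inj₂ D≤)    = ⊥-elim (ym≉0 (trans (reflexive (≡.cong (coeff y) (≡.sym q+[m∸q]≡m)))
          (trans (coeff-y-high (m ℕ.∸ q)) (B-high _ D≤))))

    degreeB-coefficient : ∀ {b} → HasDegree B b → r ∤ suc b × coeff y (suc b) ≉ 0#
    degreeB-coefficient {b} (lead , high) =
      (λ r∣sb → ℕₚ.<⇒≱ sb<q (proj₁ (r∣m⇒q≤m<2q (suc b) r∣sb y≉0))) , y≉0
      where
      b<D : b < D
      b<D = ℕₚ.≰⇒> (lead ∘ B-high b)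
      sb<q : suc b < q
      sb<q = ℕₚ.≤-<-trans b<D D<q
      y≉0 : coeff y (suc b) ≉ 0#
      y≉0 eq = lead (trans (sym (-‿involutive _)) (trans (-‿cong (trans (sym (coeff-y-low sb<q)) eq)) -0≈0))

  -- Read as a list of linearized coefficients, `X^ j` encodes the `j`-fold iterate of `x ↦ x ↑ r`.
  evalLin-X^ : ∀ j x → evalLin (X^ j) x ≈ x ↑ (r ℕ.^ j)
  evalLin-X^ zero    x = trans (+-identityʳ _) (*-comm 1# x)
  evalLin-X^ (suc j) x = trans (+-cong (zeroˡ x) (evalLin-X^ j (x ↑ r))) (trans (+-identityˡ _) (^-assocʳ x r (r ℕ.^ j)))

  OrbitVanishes : Poly → ℕ → Set ℓ
  OrbitVanishes y e = ∀ i → coeff y (e ℕ.* r ℕ.^ i) ≈ 0#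

  -- The part of y on the orbit of e is g - g^(Q^h) for a monomial g of degree e, where Q = r^d.
  OrbitBinomial : ℕ → Poly → ℕ → Set ℓ
  OrbitBinomial d y e = ∃ λ h → 0 < h
    × coeff y (e ℕ.* r ℕ.^ (h ℕ.* d)) ≈ - coeff y e ↑ (r ℕ.^ (h ℕ.* d))
    × (∀ i → i ≢ 0 → i ≢ h ℕ.* d → coeff y (e ℕ.* r ℕ.^ i) ≈ 0#)

  module _ (as : List Carrier) {s : ℕ} (monic : HasLeadingTerm as s 1#) (A1≈0 : evalLin as 1# ≈ 0#) {d : ℕ}
    (d∣ : ∀ j → 0 < j → (∀ {u} → evalLin as u ≈ 0# → Fixed (r ℕ.^ j) u) → d ∣ j)
    (F : Poly) {q : ℕ} (support : ∀ m → r ∣ m → coeff (applyₚ as F) m ≉ 0# → q ≤ m × m < q ℕ.+ q) where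

    private
      y = applyₚ as F

    -- The list `H` of coefficients of `y` along the orbit encodes `A ∘ Φ`. Its entries after the
    -- first sit at exponents divisible by `r`, so `support` leaves room for one of them. A single
    -- term in all is excluded by `composite≉monomial`; two terms are handled by
    -- `composite≈binomial`, and `d∣` turns the resulting exponent into a multiple of `d`.
    orbitShape : ∀ e → r ∤ e → OrbitVanishes y e ⊎ OrbitBinomial d y e
    orbitShape e r∤e = shape H isOrbit (λ x → sym (evalLin-composeLin as Φ x))
      where
      Φ H : List Carrier
      Φ = orbit e F
      H = composeLin as Φ

      isOrbit : IsOrbit e y H
      isOrbit = isOrbit-apply as {F} {Φ} r∤e (orbit-isOrbit F (∤⇒>0 r∤e))

      e*1≡e : e ℕ.* 1 ≡ e
      e*1≡e = ℕₚ.*-identityʳ e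

      shape : ∀ H → IsOrbit e y H → (∀ x → evalLin as (evalLin Φ x) ≈ evalLin H x) → OrbitVanishes y e ⊎ OrbitBinomial d y e
      shape []       orb _  = inj₁ λ i → sym (orb i)
      shape (η₀ ∷ t) orb eq = byTail (≈[]⊎degree t)
        where
        byTail : t ≈ₚ [] ⊎ ∃ (HasDegree t) → OrbitVanishes y e ⊎ OrbitBinomial d y e
        byTail (inj₁ t≈[]) = byHead (η₀ ≟ 0#)
          where
          byHead : Dec (η₀ ≈ 0#) → OrbitVanishes y e ⊎ OrbitBinomial d y e
          byHead (yes η₀≈0) = inj₁ λ { zero → trans (sym (orb 0)) η₀≈0 ; (suc i) → trans (sym (orb (suc i))) (t≈[] i) }
          byHead (no  η₀≉0) = ⊥-elim (composite≉monomial as A1≈0 Φ 1 η₀≉0 λ x → trans (eq x)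
            (trans (+-cong (*-congˡ (sym (*-identityʳ x))) (evalLin-≈[] t (x ↑ r) t≈[])) (+-identityʳ _)))
        byTail (inj₂ (j′ , η≉0 , high)) = byHead (η₀ ≟ 0#)
          where
          j = suc j′
          η = coeff t j′

          r∣orbit : ∀ i → r ∣ e ℕ.* r ℕ.^ suc i
          r∣orbit i = ≡.subst (r ∣_) (≡.sym (e*r^[1+i]≡r*[e*r^i] e r i)) (ℕᵈ.m∣m*n _)

          -- A nonzero entry here would give `q ≤ e * r ^ suc i ≤ e * r ^ j′`. Then `e * r ^ j` is
          -- at least `r * q ≥ q + q`, outside the range that `support` permits for the top entry.
          below : ∀ i → i < j′ → coeff t i ≈ 0#
          below i i<j′ = byValue (coeff t i ≟ 0#)
            where
            byValue : Dec (coeff t i ≈ 0#) → coeff t i ≈ 0#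
            byValue (yes ≈0) = ≈0
            byValue (no  ≉0) = contradiction 2q≤m (ℕₚ.<⇒≱ m<2q)
              where
              q≤n : q ≤ e ℕ.* r ℕ.^ suc i
              q≤n = proj₁ (support _ (r∣orbit i) (≉0 ∘ trans (orb (suc i))))
              m<2q : e ℕ.* r ℕ.^ j < q ℕ.+ q
              m<2q = proj₂ (support _ (r∣orbit j′) (η≉0 ∘ trans (orb j)))
              2q≤m : q ℕ.+ q ≤ e ℕ.* r ℕ.^ j
              2q≤m = ≡.subst (q ℕ.+ q ≤_) (≡.sym (e*r^[1+i]≡r*[e*r^i] e r j′))
                (ℕₚ.≤-trans (≡.subst (q ℕ.+ q ≤_) (≡.cong (e ℕ.* r ℕ.^ j′ ℕ.+_) (≡.sym (ℕₚ.+-identityʳ (e ℕ.* r ℕ.^ j′)))) (ℕₚ.+-mono-≤ q≤n′ q≤n′))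
                  (ℕₚ.*-monoˡ-≤ (e ℕ.* r ℕ.^ j′) 1<r))
                where
                q≤n′ : q ≤ e ℕ.* r ℕ.^ j′
                q≤n′ = ℕₚ.≤-trans q≤n (ℕₚ.*-monoʳ-≤ e (ℕₚ.^-monoʳ-≤ r i<j′))

          others : ∀ i → i ≢ j′ → coeff t i ≈ 0#
          others i i≢j′ = compare (ℕₚ.<-cmp i j′)
            where
            compare : _ → coeff t i ≈ 0#
            compare (tri< i<j′ _ _) = below i i<j′
            compare (tri≈ _ i≡j′ _) = contradiction i≡j′ i≢j′
            compare (tri> _ _ j′<i) = high i j′<i

          t≈monomial : t ≈ₚ η ·ₚ (X^ j′)
          t≈monomial i = compare (i ℕₚ.≟ j′)
            where
            compare : Dec (i ≡ j′) → coeff t i ≈ coeff (η ·ₚ (X^ j′)) i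
            compare (yes ≡.refl) = sym (trans (coeff-· η (X^ j′) i) (trans (*-congˡ (reflexive (coeff-X^-≡ j′))) (*-identityʳ η)))
            compare (no  i≢j′)   = trans (others i i≢j′) (sym (trans (coeff-· η (X^ j′) i) (trans (*-congˡ (reflexive (coeff-X^-≢ j′ i i≢j′))) (zeroʳ η))))

          binomial : ∀ x → evalLin as (evalLin Φ x) ≈ η₀ * x + η * x ↑ (r ℕ.^ j)
          binomial x = trans (eq x) (+-congˡ (trans (evalLin-≈ₚ t (η ·ₚ (X^ j′)) (x ↑ r) t≈monomial)
            (trans (evalLin-·ₚ η (X^ j′) (x ↑ r)) (*-congˡ (trans (evalLin-X^ j′ (x ↑ r)) (^-assocʳ x r (r ℕ.^ j′)))))))

          byHead : Dec (η₀ ≈ 0#) → OrbitVanishes y e ⊎ OrbitBinomial d y e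
          byHead (yes η₀≈0) = ⊥-elim (composite≉monomial as A1≈0 Φ (r ℕ.^ j) η≉0 λ x →
            trans (binomial x) (trans (+-congʳ (trans (*-congʳ η₀≈0) (zeroˡ x))) (+-identityˡ _)))
          byHead (no  η₀≉0) = inj₂ (result (d∣ j (s≤s z≤n) (proj₁ fixes×η≈)))
            where
            fixes×η≈ : (∀ {u} → evalLin as u ≈ 0# → Fixed (r ℕ.^ j) u) × η ≈ - η₀ ↑ (r ℕ.^ j)
            fixes×η≈ = composite≈binomial as A1≈0 monic Φ η₀≉0 η≉0 binomial (frobenius-^ {r} frobenius j)
              (ℕₚ.≤-trans (s≤s z≤n) (n<r^n 1<r j))

            result : d ∣ j → OrbitBinomial d y e
            result (divides h j≡hd) = h , 0<h h j≡hd ,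
              ≡.subst (λ i → coeff y (e ℕ.* r ℕ.^ i) ≈ - coeff y e ↑ (r ℕ.^ i)) j≡hd
                (trans (sym (orb j)) (trans (proj₂ fixes×η≈) (-‿cong (^-congˡ (r ℕ.^ j) (trans (orb 0) (reflexive (≡.cong (coeff y) e*1≡e))))))) ,
              λ { zero 0≢0 _ → contradiction ≡.refl 0≢0
                ; (suc i) _ i≢hd → trans (sym (orb (suc i))) (others i (λ i≡j′ → i≢hd (≡.trans (≡.cong suc i≡j′) j≡hd))) }
              where
              0<h : ∀ h → j ≡ h ℕ.* d → 0 < h
              0<h (suc h) _ = s≤s z≤n

  module Peeling {s : Level} {d : ℕ} (0<d : 0 < d)
    (C : Pred Carrier s) (C-resp : ∀ {x y} → x ≈ y → C x → C y) (C-0 : C 0#) (C-1 : C 1#)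
    (C-+ : ∀ {x y} → C x → C y → C (x + y)) (C-* : ∀ {x y} → C x → C y → C (x * y))
    (C-neg : ∀ {x} → C x → C (- x)) where

    open ClosedCoefficients C C-resp C-0 C-+ C-*

    private
      Q = r ℕ.^ d

      0<Q : 0 < Q
      0<Q = ℕₚ.≤-trans (s≤s z≤n) (n<r^n 1<r d)

      frobQ : Frobenius Q
      frobQ = frobenius-^ frobenius d

    neg-closed : ∀ P → P HasCoefficientsIn C → map -_ P HasCoefficientsIn C
    neg-closed P CP i = C-resp (sym (coeff-neg P i)) (C-neg (CP i))

    Difference : Poly → Set (c ⊔ ℓ ⊔ s)
    Difference y = ∃ λ f → f HasCoefficientsIn C × (∀ x → eval y x ≈ eval f x ↑ Q - eval f x)

    -- The witness is the sum of the powers `P ^ (Q ^ i)` for `i < h`, whose difference with its own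
    -- `Q`-th power telescopes.
    telescoping : ∀ P → P HasCoefficientsIn C → ∀ h → ∃ λ g → g HasCoefficientsIn C × (∀ x → eval P x ↑ (Q ℕ.^ h) - eval P x ≈ eval g x ↑ Q - eval g x)
    telescoping P CP zero    = [] , []-closed , λ x → trans (x≈y⇒x-y≈0 (*-identityʳ _)) (sym (x≈y⇒x-y≈0 (0↑n≈0 0<Q)))
    telescoping P CP (suc h) =
      let g , Cg , eq = telescoping P CP h
          R = X^ (Q ℕ.^ h) ∘ₚ P
          CR = ∘ₚ-closed (X^ (Q ℕ.^ h)) P (X^-closed C-1 (Q ℕ.^ h)) CP
      in g +ₚ R , +ₚ-closed g R Cg CR , λ x → begin
        eval P x ↑ (Q ℕ.* Q ℕ.^ h) - eval P x
          ≈⟨ +-congʳ (trans (^-congʳ (eval P x) (ℕₚ.*-comm Q (Q ℕ.^ h))) (sym (^-assocʳ (eval P x) (Q ℕ.^ h) Q))) ⟩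
        (eval P x ↑ (Q ℕ.^ h)) ↑ Q - eval P x
          ≈⟨ solve 3 (λ a b c → a :- c := (b :- c) :+ (a :- b)) refl ((eval P x ↑ (Q ℕ.^ h)) ↑ Q) (eval P x ↑ (Q ℕ.^ h)) (eval P x) ⟩
        (eval P x ↑ (Q ℕ.^ h) - eval P x) + ((eval P x ↑ (Q ℕ.^ h)) ↑ Q - eval P x ↑ (Q ℕ.^ h))
          ≈⟨ +-cong (eq x) (+-cong (^-congˡ Q (sym (eval-X^∘ (Q ℕ.^ h) P x))) (-‿cong (sym (eval-X^∘ (Q ℕ.^ h) P x)))) ⟩
        (eval g x ↑ Q - eval g x) + (eval R x ↑ Q - eval R x)
          ≈⟨ solve 4 (λ a b c d → (a :- b) :+ (c :- d) := (a :+ c) :- (b :+ d)) refl (eval g x ↑ Q) (eval g x) (eval R x ↑ Q) (eval R x) ⟩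
        (eval g x ↑ Q + eval R x ↑ Q) - (eval g x + eval R x)
          ≈⟨ +-cong (frobQ _ _) (-‿cong refl) ⟨
        (eval g x + eval R x) ↑ Q - (eval g x + eval R x)
          ≈⟨ +-cong (^-congˡ Q (eval-+ g R x)) (-‿cong (eval-+ g R x)) ⟨
        eval (g +ₚ R) x ↑ Q - eval (g +ₚ R) x ∎

    Shape : Poly → ℕ → Set ℓ
    Shape y e = OrbitVanishes y e ⊎ OrbitBinomial d y e

    -- Subtracting `g - g^T` clears the orbit of `e` and leaves all other orbits unchanged. Since
    -- `T` is a power of `Q`, `telescoping` shows that the removed part is itself, up to sign, of
    -- the desired form.
    module Peel (y : Poly) (Cy : y HasCoefficientsIn C) {e : ℕ} (r∤e : r ∤ e) (binomial : OrbitBinomial d y e) where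

      h = proj₁ binomial
      T = r ℕ.^ (h ℕ.* d)
      η = coeff y e
      g = η ·ₚ (X^ e)
      gT = η ↑ T ·ₚ (X^ (e ℕ.* T))
      rest = y -ₚ (g -ₚ gT)

      1<T : 1 < T
      1<T = ℕₚ.≤-<-trans (ℕₚ.*-mono-≤ (proj₁ (proj₂ binomial)) 0<d) (n<r^n 1<r (h ℕ.* d))

      e≢eT : e ≢ e ℕ.* T
      e≢eT = ℕₚ.<⇒≢ (ℕₚ.m<m*n e T {{ℕ.>-nonZero (∤⇒>0 r∤e)}} 1<T)

      coeff-monomial-≡ : ∀ a m → coeff (a ·ₚ (X^ m)) m ≈ a
      coeff-monomial-≡ a m = trans (coeff-· a (X^ m) m) (trans (*-congˡ (reflexive (coeff-X^-≡ m))) (*-identityʳ a))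

      coeff-monomial-≢ : ∀ a m {i} → i ≢ m → coeff (a ·ₚ (X^ m)) i ≈ 0#
      coeff-monomial-≢ a m {i} i≢m = trans (coeff-· a (X^ m) i) (trans (*-congˡ (reflexive (coeff-X^-≢ m i i≢m))) (zeroʳ a))

      coeff-rest : ∀ i → coeff rest i ≈ coeff y i - (coeff g i - coeff gT i)
      coeff-rest i = trans (coeff-- y (g -ₚ gT) i) (+-congˡ (-‿cong (coeff-- g gT i)))

      rest-e : coeff rest e ≈ 0#
      rest-e = trans (coeff-rest e) (trans (+-congˡ (-‿cong (+-cong (coeff-monomial-≡ η e) (-‿cong (coeff-monomial-≢ (η ↑ T) (e ℕ.* T) e≢eT)))))
        (solve 1 (λ η → η :- (η :- con (0 , 0)) := con (0 , 0)) refl η))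

      rest-eT : coeff rest (e ℕ.* T) ≈ 0#
      rest-eT = trans (coeff-rest (e ℕ.* T)) (trans (+-cong (proj₁ (proj₂ (proj₂ binomial)))
          (-‿cong (+-cong (coeff-monomial-≢ η e (e≢eT ∘ ≡.sym)) (-‿cong (coeff-monomial-≡ (η ↑ T) (e ℕ.* T))))))
        (solve 1 (λ t → :- t :- (con (0 , 0) :- t) := con (0 , 0)) refl (η ↑ T)))

      rest-other : ∀ {i} → i ≢ e → i ≢ e ℕ.* T → coeff rest i ≈ coeff y i
      rest-other {i} i≢e i≢eT = trans (coeff-rest i) (trans (+-congˡ (-‿cong (+-cong (coeff-monomial-≢ η e i≢e)
          (-‿cong (coeff-monomial-≢ (η ↑ T) (e ℕ.* T) i≢eT)))))
        (solve 1 (λ t → t :- (con (0 , 0) :- con (0 , 0)) := t) refl (coeff y i)))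

      rest-vanishes : ∀ {i} → coeff y i ≈ 0# → coeff rest i ≈ 0#
      rest-vanishes {i} yi≈0 = compare (i ℕₚ.≟ e) (i ℕₚ.≟ e ℕ.* T)
        where
        compare : Dec (i ≡ e) → Dec (i ≡ e ℕ.* T) → coeff rest i ≈ 0#
        compare (yes ≡.refl) _            = rest-e
        compare (no _)       (yes ≡.refl) = rest-eT
        compare (no i≢e)     (no i≢eT)    = trans (rest-other i≢e i≢eT) yi≈0

      rest-orbit : OrbitVanishes rest e
      rest-orbit i = compare (i ℕₚ.≟ 0) (i ℕₚ.≟ h ℕ.* d)
        where
        compare : Dec (i ≡ 0) → Dec (i ≡ h ℕ.* d) → coeff rest (e ℕ.* r ℕ.^ i) ≈ 0#
        compare (yes ≡.refl) _            = trans (reflexive (≡.cong (coeff rest) (ℕₚ.*-identityʳ e))) rest-e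
        compare (no _)       (yes ≡.refl) = rest-eT
        compare (no i≢0)     (no i≢hd)    = rest-vanishes (proj₂ (proj₂ (proj₂ binomial)) i i≢0 i≢hd)

      rest-otherOrbit : ∀ {e′} → r ∤ e′ → e′ ≢ e → ∀ i → coeff rest (e′ ℕ.* r ℕ.^ i) ≈ coeff y (e′ ℕ.* r ℕ.^ i)
      rest-otherOrbit r∤e′ e′≢e i = rest-other
        (λ eq → e′≢e (orbitRepresentative-unique 1<r r∤e′ r∤e i 0 (≡.trans eq (≡.sym (ℕₚ.*-identityʳ e)))))
        (λ eq → e′≢e (orbitRepresentative-unique 1<r r∤e′ r∤e i (h ℕ.* d) eq))

      rest-shape : (∀ e′ → r ∤ e′ → Shape y e′) → ∀ e′ → r ∤ e′ → Shape rest e′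
      rest-shape shape e′ r∤e′ = compare (e′ ℕₚ.≟ e)
        where
        compare : Dec (e′ ≡ e) → Shape rest e′
        compare (yes ≡.refl) = inj₁ rest-orbit
        compare (no e′≢e) = Sum.map
          (λ vanishes i → trans (same i) (vanishes i))
          (λ (h , 0<h , top , others) → h , 0<h ,
            trans (same (h ℕ.* d)) (trans top (-‿cong (^-congˡ (r ℕ.^ (h ℕ.* d))
              (trans (reflexive (≡.cong (coeff y) (≡.sym (ℕₚ.*-identityʳ e′)))) (trans (sym (same 0)) (reflexive (≡.cong (coeff rest) (ℕₚ.*-identityʳ e′)))))))) ,
            λ i i≢0 i≢hd → trans (same i) (others i i≢0 i≢hd))
          (shape e′ r∤e′)
          where
          same = rest-otherOrbit r∤e′ e′≢e

      g-closed : g HasCoefficientsIn C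
      g-closed = ·ₚ-closed (X^ e) (Cy e) (X^-closed C-1 e)

      rest-closed : rest HasCoefficientsIn C
      rest-closed = +ₚ-closed y (map -_ (g -ₚ gT)) Cy (neg-closed (g -ₚ gT) (+ₚ-closed g (map -_ gT) g-closed
        (neg-closed gT (·ₚ-closed (X^ (e ℕ.* T)) (↑-closed C-1 T (Cy e)) (X^-closed C-1 (e ℕ.* T))))))

      eval-gT : ∀ x → eval gT x ≈ eval g x ↑ (Q ℕ.^ h)
      eval-gT x = begin
        eval gT x                        ≈⟨ trans (eval-· (η ↑ T) (X^ (e ℕ.* T)) x) (*-congˡ (eval-X^ (e ℕ.* T) x)) ⟩
        η ↑ T * x ↑ (e ℕ.* T)            ≈⟨ *-congˡ (^-assocʳ x e T) ⟨
        η ↑ T * (x ↑ e) ↑ T              ≈⟨ ^-distrib-* η (x ↑ e) T ⟨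
        (η * x ↑ e) ↑ T                  ≈⟨ ^-congˡ T (trans (eval-· η (X^ e) x) (*-congˡ (eval-X^ e x))) ⟨
        eval g x ↑ T                     ≡⟨ ≡.cong (eval g x ↑_) (≡.trans (≡.cong (r ℕ.^_) (ℕₚ.*-comm h d)) (≡.sym (ℕₚ.^-*-assoc r d h))) ⟩
        eval g x ↑ (Q ℕ.^ h)             ∎

      difference : Difference rest → Difference y
      difference (f , Cf , f-eq) =
        let g₁ , Cg₁ , g-eq = telescoping g g-closed h
        -- `g₁` enters with a minus sign: `telescoping` yields `g^(Q^h) - g`, while `y` exceeds
        -- `rest` by `g - g^(Q^h)`.
        in f -ₚ g₁ , +ₚ-closed f (map -_ g₁) Cf (neg-closed g₁ Cg₁) , λ x → begin
          eval y x
            ≈⟨ solve 3 (λ y a b → y := y :- (a :- b) :- (b :- a)) refl (eval y x) (eval g x) (eval gT x) ⟩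
          eval y x - (eval g x - eval gT x) - (eval gT x - eval g x)
            ≈⟨ +-cong (trans (eval-- y (g -ₚ gT) x) (+-congˡ (-‿cong (eval-- g gT x)))) (-‿cong (+-congʳ (sym (eval-gT x)))) ⟨
          eval rest x - (eval g x ↑ (Q ℕ.^ h) - eval g x)
            ≈⟨ +-cong (f-eq x) (-‿cong (g-eq x)) ⟩
          (eval f x ↑ Q - eval f x) - (eval g₁ x ↑ Q - eval g₁ x)
            ≈⟨ solve 4 (λ a b c d → (a :- b) :- (c :- d) := (a :- c) :- (b :- d)) refl (eval f x ↑ Q) (eval f x) (eval g₁ x ↑ Q) (eval g₁ x) ⟩
          (eval f x ↑ Q - eval g₁ x ↑ Q) - (eval f x - eval g₁ x)
            ≈⟨ +-congʳ (frobenius-- 0<Q frobQ _ _) ⟨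
          (eval f x - eval g₁ x) ↑ Q - (eval f x - eval g₁ x)
            ≈⟨ +-cong (^-congˡ Q (eval-- f g₁ x)) (-‿cong (eval-- f g₁ x)) ⟨
          eval (f -ₚ g₁) x ↑ Q - eval (f -ₚ g₁) x ∎

    -- A scan over the representatives: orbits below `e₀` are already cleared, and `n` bounds the
    -- exponents still ahead. Peeling never creates a nonzero coefficient where `y` had none, so
    -- both invariants persist. At `n = 0` every positive exponent lies in a cleared orbit or beyond
    -- the bound; exponent 0 belongs to no orbit and needs its own premise.
    artinSchreier : ∀ n e₀ y → coeff y 0 ≈ 0# → y HasCoefficientsIn C → (∀ e → r ∤ e → Shape y e) →
      (∀ e → e < e₀ → r ∤ e → OrbitVanishes y e) → (∀ m → e₀ ℕ.+ n ≤ m → coeff y m ≈ 0#) → Difference y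
    artinSchreier zero e₀ y y0≈0 Cy shape below high = [] , []-closed , λ x →
      trans (eval-≈[] y x y≈[]) (sym (x≈y⇒x-y≈0 (0↑n≈0 0<Q)))
      where
      y≈[] : y ≈ₚ []
      y≈[] zero    = y0≈0
      y≈[] m@(suc _) = byOrbit (orbitRepresentative 1<r m (s≤s z≤n))
        where
        byOrbit : (∃₂ λ e i → r ∤ e × m ≡ e ℕ.* r ℕ.^ i) → coeff y m ≈ 0#
        byOrbit (e , i , r∤e , m≡) = compare (ℕₚ.<-≤-connex e e₀)
          where
          compare : e < e₀ ⊎ e₀ ≤ e → coeff y m ≈ 0#
          compare (inj₁ e<e₀) = trans (reflexive (≡.cong (coeff y) m≡)) (below e e<e₀ r∤e i)
          compare (inj₂ e₀≤e) = high m (≡.subst (_≤ m) (≡.sym (ℕₚ.+-identityʳ e₀))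
            (ℕₚ.≤-trans e₀≤e (≡.subst (e ≤_) (≡.sym m≡) (ℕₚ.m≤m*n e (r ℕ.^ i) {{ℕ.>-nonZero (ℕₚ.≤-trans (s≤s z≤n) (n<r^n 1<r i))}}))))
    artinSchreier (suc n) e₀ y y0≈0 Cy shape below high = byDivisibility (r ∣? e₀)
      where
      below′ : ∀ z → (∀ e → e < e₀ → r ∤ e → OrbitVanishes z e) → (r ∤ e₀ → OrbitVanishes z e₀) → ∀ e → e < suc e₀ → r ∤ e → OrbitVanishes z e
      below′ z b b₀ e e<1+e₀ r∤e = compare (ℕₚ.m≤n⇒m<n∨m≡n (ℕₚ.≤-pred e<1+e₀))
        where
        compare : e < e₀ ⊎ e ≡ e₀ → OrbitVanishes z e
        compare (inj₁ e<e₀)   = b e e<e₀ r∤e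
        compare (inj₂ ≡.refl) = b₀ r∤e

      high′ : ∀ m → suc e₀ ℕ.+ n ≤ m → coeff y m ≈ 0#
      high′ m le = high m (≡.subst (_≤ m) (≡.sym (ℕₚ.+-suc e₀ n)) le)

      byShape : r ∤ e₀ → Shape y e₀ → Difference y
      byShape r∤e₀ (inj₁ vanishes) = artinSchreier n (suc e₀) y y0≈0 Cy shape (below′ y below (λ _ → vanishes)) high′
      byShape r∤e₀ (inj₂ binomial) = difference (artinSchreier n (suc e₀) rest (rest-vanishes y0≈0) rest-closed (rest-shape shape)
          (below′ rest (λ e e<e₀ r∤e i → rest-vanishes (below e e<e₀ r∤e i)) (λ _ → rest-orbit))
          (λ m le → rest-vanishes (high′ m le)))
        where
        open Peel y Cy r∤e₀ binomial

      byDivisibility : Dec (r ∣ e₀) → Difference y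
      byDivisibility (yes r∣e₀) = artinSchreier n (suc e₀) y y0≈0 Cy shape (below′ y below (λ r∤e₀ → contradiction r∣e₀ r∤e₀)) high′
      byDivisibility (no  r∤e₀) = byShape r∤e₀ (shape e₀ r∤e₀)

-- Minimal value sets, and the polynomials `A` and `M`.

quotient-unique : ∀ {m} n o .{{_ : NonZero o}} → n ℕ.* o ≤ m → m < suc n ℕ.* o → m / o ≡ n
quotient-unique {m} n o no≤m m<[1+n]o = ℕₚ.≤-antisym (ℕₚ.≤-pred (ℕᵐ.m<n*o⇒m/o<n {m} {suc n} {o} m<[1+n]o))
  (≡.subst (_≤ m / o) (ℕᵐ.m*n/n≡m n o) (ℕᵐ./-monoˡ-≤ o no≤m))

m<[1+m/n]*n : ∀ m n .{{_ : NonZero n}} → m < suc (m / n) ℕ.* n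
m<[1+m/n]*n m n = ≡.subst (_< suc (m / n) ℕ.* n) (≡.sym (ℕᵐ.m≡m%n+[m/n]*n m n)) (ℕₚ.+-monoˡ-< (m / n ℕ.* n) (ℕᵐ.m%n<n m n))

module MinimalValueSets {c ℓ : Level} (K : Field c ℓ) where

  open Over K hiding (zero)
  open Membership setoid using (_∈_)
  open Uniqueness setoid using (Unique)
  open FieldProperties K
  open PolynomialProperties K
  open FixedPoints K
  open import Relation.Binary.Reasoning.Setoid setoid

  module Main {u : Level} (closed : AlgebraicallyClosed)
    {r : ℕ} (1<r : 1 < r) (frobenius : Frobenius r) (Fr : Subfield r)
    {d : ℕ} (0<d : 0 < d) (FQ : Subfield (r ℕ.^ d))
    {h : ℕ} (0<h : 0 < h) {q : ℕ} (q≡Q^h : q ≡ (r ℕ.^ d) ℕ.^ h) (Fq : Subfield q)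
    (U : Pred Carrier u) (E : Enumeration U) (subspace : IsSubspace (𝔽 r) U) (U1 : U 1#)
    (U⊆FQ : ∀ {x} → U x → Fixed (r ℕ.^ d) x)
    (d∣ : ∀ j → 0 < j → (∀ {x} → U x → Fixed (r ℕ.^ j) x) → d ∣ j) where

    open AlgebraicallyClosedField closed
    open LinearizedPolynomials K closed 1<r frobenius
    open Orbits K closed 1<r frobenius
    open ArtinSchreier K closed 1<r frobenius

    Q : ℕ
    Q = r ℕ.^ d

    private
      0<r : 0 < r
      0<r = ℕₚ.<-trans (s≤s z≤n) 1<r

      0<Q : 0 < Q
      0<Q = ℕₚ.≤-trans (s≤s z≤n) (n<r^n 1<r d)

      frobQ : Frobenius Q
      frobQ = frobenius-^ {r} frobenius d

      us : List Carrier
      us = Enumeration.elements E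

      us-unique : Unique us
      us-unique = Enumeration.unique E

      ∈⇒U : ∀ {x} → x ∈ us → U x
      ∈⇒U {x} = Equivalence.to (Enumeration.correct E x)

      U⇒∈ : ∀ {x} → U x → x ∈ us
      U⇒∈ {x} = Equivalence.from (Enumeration.correct E x)

      U-resp : ∀ {x y} → x ≈ y → U x → U y
      U-resp x≈y Ux = ∈⇒U (Membershipₚ.∈-resp-≈ setoid x≈y (U⇒∈ Ux))

      N : ℕ
      N = length us

    module S = IsSubspace subspace
    module CQ = ClosedCoefficients (Fixed Q) (λ {x} → Fixed-resp {Q}) (Fixed-0 0<Q frobQ) (Fixed-+ 0<Q frobQ) (Fixed-* {Q})
    module Cq = ClosedCoefficients ⟦ Fq ⟧ (Membershipₚ.∈-resp-≈ setoid) (Subfield.0-closed Fq) (Subfield.+-closed Fq) (Subfield.*-closed Fq)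

    -- Coefficients are tracked in the fixed points of `x ↦ x ↑ Q` so that `A` commutes with this
    -- power map, which `A∘M` relies on.
    module ExtendU = Extend Fr U U-resp S.+-closed (λ fa Ux → S.·-closed (Fixed⇒𝔽 Fr fa) Ux)
      (Fixed Q) (Fixed-resp {Q}) (Fixed-0 0<Q frobQ) (Fixed-1 0<Q frobQ) (Fixed-+ 0<Q frobQ) (Fixed-* {Q}) (Fixed-neg 0<Q frobQ) U⊆FQ
      (1# ∷ []) 0

    private
      identity-leading : HasLeadingTerm (1# ∷ []) 0 1#
      identity-leading = leading-constant 1#

      identity-closed : (1# ∷ []) HasCoefficientsIn Fixed Q
      identity-closed = CQ.∷-closed (Fixed-1 0<Q frobQ) CQ.[]-closed

      evalLin-identity : ∀ x → evalLin (1# ∷ []) x ≈ x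
      evalLin-identity x = trans (+-identityʳ _) (*-identityˡ x)

      trivialU : ExtendU.Extension
      trivialU = record
        { outer             = 1# ∷ []
        ; composite         = 1# ∷ []
        ; outerDegree       = 0
        ; evalLin-composite = λ x → evalLin-identity _
        ; outer-leading     = identity-leading
        ; composite-leading = identity-leading
        ; outer-closed      = identity-closed
        ; composite-closed  = identity-closed
        ; roots             = 0# ∷ []
        ; roots-unique      = [] ∷ []
        ; roots-length      = ≡.refl
        ; roots∈V           = λ { (here x≈0) → U-resp (sym x≈0) S.0-closed }
        ; roots-vanish      = λ { {x} (here x≈0) → trans (evalLin-identity x) x≈0 }
        }

      extendedU = ExtendU.extendAll trivialU us ∈⇒U

    module A-ext = ExtendU.Extension (proj₁ extendedU)

    as : List Carrier
    as = A-ext.composite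

    s : ℕ
    s = A-ext.outerDegree ℕ.+ 0

    A : Poly
    A = vanishing E

    -- All `N` elements of `U` are roots of a polynomial of degree `r ^ s`; conversely the extension
    -- has listed `r ^ s` distinct roots inside `U`.
    N≡r^s : N ≡ r ℕ.^ s
    N≡r^s = ℕₚ.≤-antisym
      (rootCount≤degree (linearized as) (leading⇒degree {linearized as} 1≉0 (leading-linearized as A-ext.composite-leading)) us-unique
        (λ x∈ → trans (eval-linearized as _) (proj₁ (proj₂ extendedU) x∈)))
      (≡.subst (_≤ N) A-ext.roots-length (unique⊆⇒length≤ A-ext.roots-unique (U⇒∈ ∘ A-ext.roots∈V)))

    -- Both polynomials are monic of degree `N` and vanish on the `N` elements of `U`.
    eval-A : ∀ x → eval A x ≈ evalLin as x
    eval-A x = trans (eval-≈ₚ A (linearized as) x (leadingTerms-agree⇒≈ₚ A (linearized as)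
        (leading-∏X- us) (≡.subst (λ m → HasLeadingTerm (linearized as) m 1#) (≡.sym N≡r^s) (leading-linearized as A-ext.composite-leading)) us-unique ℕₚ.≤-refl
        λ x∈ → trans (root-∏X- x∈) (sym (trans (eval-linearized as _) (proj₁ (proj₂ extendedU) x∈)))))
      (eval-linearized as x)

    U⇒root : ∀ {x} → U x → evalLin as x ≈ 0#
    U⇒root Ux = proj₁ (proj₂ extendedU) (U⇒∈ Ux)

    root⇒U : ∀ {x} → evalLin as x ≈ 0# → U x
    root⇒U {x} root = ∈⇒U (root-∏X-⁻ us (trans (eval-A x) root))

    module ExtendFQ = Extend Fr (Fixed Q) (Fixed-resp {Q}) (Fixed-+ 0<Q frobQ) (λ fa fx → Fixed-* {Q} (Fixed-^ d fa) fx)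
      (Fixed Q) (Fixed-resp {Q}) (Fixed-0 0<Q frobQ) (Fixed-1 0<Q frobQ) (Fixed-+ 0<Q frobQ) (Fixed-* {Q}) (Fixed-neg 0<Q frobQ) (λ fx → fx)
      as s

    private
      trivialFQ : ExtendFQ.Extension
      trivialFQ = record
        { outer             = 1# ∷ []
        ; composite         = as
        ; outerDegree       = 0
        ; evalLin-composite = λ x → evalLin-identity _
        ; outer-leading     = identity-leading
        ; composite-leading = A-ext.composite-leading
        ; outer-closed      = identity-closed
        ; composite-closed  = A-ext.composite-closed
        ; roots             = A-ext.roots
        ; roots-unique      = A-ext.roots-unique
        ; roots-length      = A-ext.roots-length
        ; roots∈V           = U⊆FQ ∘ A-ext.roots∈V
        ; roots-vanish      = A-ext.roots-vanish
        }

      extendedFQ = ExtendFQ.extendAll trivialFQ (Subfield.elements FQ) (x∈F⇒x↑N≈x FQ)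

    module M-ext = ExtendFQ.Extension (proj₁ extendedFQ)

    ms : List Carrier
    ms = M-ext.outer

    M : Poly
    M = linearized ms

    R : ℕ
    R = r ℕ.^ M-ext.outerDegree

    0<R : 0 < R
    0<R = ℕₚ.≤-trans (s≤s z≤n) (n<r^n 1<r M-ext.outerDegree)

    M-leading : HasLeadingTerm M R 1#
    M-leading = leading-linearized ms M-ext.outer-leading

    private
      composite-leading : HasLeadingTerm (linearized M-ext.composite) (r ℕ.^ (M-ext.outerDegree ℕ.+ s)) 1#
      composite-leading = leading-linearized M-ext.composite M-ext.composite-leading

      Q≡r^ : Q ≡ r ℕ.^ (M-ext.outerDegree ℕ.+ s)
      Q≡r^ = ℕₚ.≤-antisym
        (≡.subst (_≤ r ℕ.^ (M-ext.outerDegree ℕ.+ s)) (Subfield.order FQ) (rootCount≤degree (linearized M-ext.composite)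
          (leading⇒degree {linearized M-ext.composite} 1≉0 composite-leading) (Subfield.unique FQ)
          (λ x∈ → trans (eval-linearized M-ext.composite _) (proj₁ (proj₂ extendedFQ) x∈))))
        (≡.subst₂ _≤_ M-ext.roots-length (Subfield.order FQ)
          (unique⊆⇒length≤ M-ext.roots-unique (λ x∈ → Fixed⇒∈ FQ (M-ext.roots∈V x∈))))

    Q≡R*N : Q ≡ R ℕ.* N
    Q≡R*N = ≡.trans Q≡r^ (≡.trans (ℕₚ.^-distribˡ-+-* r M-ext.outerDegree s) (≡.cong (R ℕ.*_) (≡.sym N≡r^s)))

    M∘A : ∀ x → evalLin ms (evalLin as x) ≈ x ↑ Q - x
    M∘A x = begin
      evalLin ms (evalLin as x)           ≈⟨ M-ext.evalLin-composite x ⟩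
      evalLin M-ext.composite x           ≈⟨ eval-linearized M-ext.composite x ⟨
      eval (linearized M-ext.composite) x ≈⟨ eval-≈ₚ (linearized M-ext.composite) (X^ Q -ₚ X) x (leadingTerms-agree⇒≈ₚ (linearized M-ext.composite) (X^ Q -ₚ X)
                                               (≡.subst (λ m → HasLeadingTerm (linearized M-ext.composite) m 1#) (≡.sym Q≡r^) composite-leading)
                                               (leading-X^-X (1<order FQ)) (Subfield.unique FQ) (ℕₚ.≤-reflexive (≡.sym (Subfield.order FQ)))
                                               λ x∈ → trans (trans (eval-linearized M-ext.composite _) (proj₁ (proj₂ extendedFQ) x∈))
                                                            (sym (Fixed⇒X^-X-root {Q} (x∈F⇒x↑N≈x FQ x∈)))) ⟩
      eval (X^ Q -ₚ X) x                  ≈⟨ eval-X^-X Q x ⟩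
      x ↑ Q - x                           ∎

    private
      0<r^ : ∀ t → 0 < r ℕ.^ t
      0<r^ t = ℕₚ.≤-trans (s≤s z≤n) (n<r^n 1<r t)

      linearized-surjective : ∀ bs {t} → HasLeadingTerm bs t 1# → ∀ z → ∃ λ x → evalLin bs x ≈ z
      linearized-surjective bs {t} lead z =
        let x , eq = degree⇒surjective (linearized bs) (0<r^ t) (leading⇒degree {linearized bs} 1≉0 (leading-linearized bs lead)) z
        in x , trans (sym (eval-linearized bs x)) eq

      evalLin-↑Q : ∀ bs x → bs HasCoefficientsIn Fixed Q → evalLin bs (x ↑ Q) ≈ evalLin bs x ↑ Q
      evalLin-↑Q []       x Cbs = sym (0↑n≈0 0<Q)
      evalLin-↑Q (b ∷ bs) x Cbs = begin
        b * x ↑ Q + evalLin bs ((x ↑ Q) ↑ r)        ≈⟨ +-cong (*-congʳ (sym (Cbs 0))) (evalLin-cong bs (↑-↑-comm x Q r)) ⟩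
        b ↑ Q * x ↑ Q + evalLin bs ((x ↑ r) ↑ Q)    ≈⟨ +-cong (sym (^-distrib-* b x Q)) (evalLin-↑Q bs (x ↑ r) (Cbs ∘ suc)) ⟩
        (b * x) ↑ Q + evalLin bs (x ↑ r) ↑ Q        ≈⟨ frobQ _ _ ⟨
        (b * x + evalLin bs (x ↑ r)) ↑ Q            ∎

    -- A(M(A(x))) = A(x^Q - x) = A(x)^Q - A(x), and A is surjective.
    A∘M : ∀ z → evalLin as (evalLin ms z) ≈ z ↑ Q - z
    A∘M z = let x , Ax≈z = linearized-surjective as A-ext.composite-leading z in begin
      evalLin as (evalLin ms z)                         ≈⟨ evalLin-cong as (evalLin-cong ms Ax≈z) ⟨
      evalLin as (evalLin ms (evalLin as x))            ≈⟨ evalLin-cong as (M∘A x) ⟩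
      evalLin as (x ↑ Q - x)                            ≈⟨ evalLin-- as (x ↑ Q) x ⟩
      evalLin as (x ↑ Q) - evalLin as x                 ≈⟨ +-congʳ (evalLin-↑Q as x A-ext.composite-closed) ⟩
      evalLin as x ↑ Q - evalLin as x                   ≈⟨ +-cong (^-congˡ Q Ax≈z) (-‿cong Ax≈z) ⟩
      z ↑ Q - z                                         ∎

    FQ⊆Fq : ∀ {x} → Fixed Q x → ⟦ Fq ⟧ x
    FQ⊆Fq {x} fx = Fixed⇒∈ Fq (≡.subst (λ m → Fixed m x) (≡.sym q≡Q^h) (Fixed-^ h fx))

    linearized-closed : ∀ bs → bs HasCoefficientsIn Fixed Q → linearized bs HasCoefficientsIn Fixed Q
    linearized-closed []       Cbs = CQ.[]-closed
    linearized-closed (b ∷ bs) Cbs = CQ.+ₚ-closed (b ·ₚ X) (linearized bs ∘ₚ X^ r) (CQ.·ₚ-closed X (Cbs 0) (CQ.X^-closed (Fixed-1 0<Q frobQ) 1))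
      (CQ.∘ₚ-closed (linearized bs) (X^ r) (linearized-closed bs (Cbs ∘ suc)) (CQ.X^-closed (Fixed-1 0<Q frobQ) r))

    M-coefficients : M HasCoefficientsIn ⟦ Fq ⟧
    M-coefficients i = FQ⊆Fq (linearized-closed ms M-ext.outer-closed i)

    M-properties : M HasCoefficientsIn ⟦ Fq ⟧ × Monic M × Linearized r M × A ∘ₚ M ≈ₚ X^ Q -ₚ X × M ∘ₚ A ≈ₚ X^ Q -ₚ X
    M-properties = M-coefficients , (R , leading⇒degree {M} 1≉0 M-leading , proj₁ M-leading) , linearized-Linearized ms ,
      eval-injective (A ∘ₚ M) (X^ Q -ₚ X) (λ x → begin
        eval (A ∘ₚ M) x               ≈⟨ eval-∘ A M x ⟩
        eval A (eval M x)             ≈⟨ eval-A _ ⟩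
        evalLin as (eval M x)         ≈⟨ evalLin-cong as (eval-linearized ms x) ⟩
        evalLin as (evalLin ms x)     ≈⟨ A∘M x ⟩
        x ↑ Q - x                     ≈⟨ eval-X^-X Q x ⟨
        eval (X^ Q -ₚ X) x            ∎) ,
      eval-injective (M ∘ₚ A) (X^ Q -ₚ X) (λ x → begin
        eval (M ∘ₚ A) x               ≈⟨ eval-∘ M A x ⟩
        eval M (eval A x)             ≈⟨ eval-linearized ms _ ⟩
        evalLin ms (eval A x)         ≈⟨ evalLin-cong ms (eval-A x) ⟩
        evalLin ms (evalLin as x)     ≈⟨ M∘A x ⟩
        x ↑ Q - x                     ≈⟨ eval-X^-X Q x ⟨
        eval (X^ Q -ₚ X) x            ∎)

    private
      sameCardinality : ∀ {v w} {V : Pred Carrier v} {W : Pred Carrier w} {xs ys} → Unique xs → Unique ys →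
        (∀ {x} → x ∈ xs → V x) → (∀ {x} → V x → x ∈ xs) → (∀ {x} → x ∈ ys → W x) → (∀ {x} → W x → x ∈ ys) →
        V ≐ W → length xs ≡ length ys
      sameCardinality uxs uys ∈⇒V V⇒∈ ∈⇒W W⇒∈ (V⊆W , W⊆V) =
        ℕₚ.≤-antisym (unique⊆⇒length≤ uxs (λ x∈ → W⇒∈ (V⊆W (∈⇒V x∈)))) (unique⊆⇒length≤ uys (λ x∈ → V⇒∈ (W⊆V (∈⇒W x∈))))

      1≤q : 1 ≤ q
      1≤q = ℕₚ.<⇒≤ (1<order Fq)

      suc[q∸1]≡q : suc (q ℕ.∸ 1) ≡ q
      suc[q∸1]≡q = ℕₚ.m+[n∸m]≡n 1≤q

      enumerationLength : ∀ {v w} {V : Pred Carrier v} {W : Pred Carrier w} {n} {ys} → HasCardinality V n → Unique ys →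
        (∀ {x} → x ∈ ys → W x) → (∀ {x} → W x → x ∈ ys) → V ≐ W → length ys ≡ n
      enumerationLength (EV , size) uys ∈⇒W W⇒∈ V≐W = ≡.trans
        (≡.sym (sameCardinality (Enumeration.unique EV) uys (λ {x} → Equivalence.to (Enumeration.correct EV x))
          (λ {x} → Equivalence.from (Enumeration.correct EV x)) ∈⇒W W⇒∈ V≐W)) size

      hasCardinality : ∀ {v w} {V : Pred Carrier v} {W : Pred Carrier w} {n} {ys} → Unique ys →
        (∀ {x} → x ∈ ys → W x) → (∀ {x} → W x → x ∈ ys) → V ≐ W → length ys ≡ n → HasCardinality V n
      hasCardinality {ys = ys} uys ∈⇒W W⇒∈ (V⊆W , W⊆V) size =
        record { elements = ys ; unique = uys ; correct = λ x → mk⇔ (W⊆V ∘ ∈⇒W) (W⇒∈ ∘ V⊆W) } , size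

    -- Composites `M ∘ f` are minimal with value set `U`.

    composition∈𝒫 : ∀ {F} f → 𝒫 Fq (𝔽 Q) f → F ≈ₚ M ∘ₚ f → 𝒫 Fq U F
    composition∈𝒫 {F} f (mvsp , Vf≐FQ) F≈ = record
      { coefficients = λ i → Membershipₚ.∈-resp-≈ setoid (sym (F≈ i)) (Cq.∘ₚ-closed M f M-coefficients f.coefficients i)
      ; degree       = R ℕ.* f.degree
      ; hasDegree    = leading⇒degree {F} (*-≉0 1≉0 (λ eq → proj₁ f.hasDegree (x↑n≈0⇒x≈0 R eq)))
                         (leading-≈ₚ {M ∘ₚ f} {F} (λ i → sym (F≈ i)) (leading-∘ M f (ℕ.>-nonZero⁻¹ f.degree) M-leading (degree⇒leading {f} f.hasDegree)))
      ; degree>0     = RD≢0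
      ; minimal      = hasCardinality us-unique ∈⇒U U⇒∈ VF≐U N≡
      } , VF≐U
      where
      module f = IsMVSP mvsp
      instance
        RD≢0 : NonZero (R ℕ.* f.degree)
        RD≢0 = ℕₚ.m*n≢0 R f.degree {{ℕ.>-nonZero 0<R}}

      eval-F : ∀ x → eval F x ≈ evalLin ms (eval f x)
      eval-F x = trans (eval-≈ₚ F (M ∘ₚ f) x F≈) (trans (eval-∘ M f x) (eval-linearized ms _))

      VF≐U : ValueSet Fq F ≐ U
      VF≐U = (λ (x , x∈ , Fx≈y) → U-resp (trans (sym (eval-F x)) Fx≈y) (root⇒U (trans (A∘M _)
               (x≈y⇒x-y≈0 (𝔽⇒Fixed (proj₁ Vf≐FQ (x , x∈ , refl)))))))
           , λ {y} Uy →
               let z , Mz≈y = linearized-surjective ms M-ext.outer-leading y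
                   fixed = x-y≈0⇒x≈y _ _ (trans (sym (A∘M z)) (trans (evalLin-cong as Mz≈y) (U⇒root Uy)))
                   x , x∈ , fx≈z = proj₂ Vf≐FQ (Fixed⇒𝔽 FQ fixed)
               in x , x∈ , trans (eval-F x) (trans (evalLin-cong ms fx≈z) Mz≈y)

      Q≡quotient+1 : Q ≡ (q ℕ.∸ 1) / f.degree ℕ.+ 1
      Q≡quotient+1 = ≡.trans (≡.sym (Subfield.order FQ)) (enumerationLength f.minimal (Subfield.unique FQ)
        (λ x∈ → FQ , x∈) (λ fx → Fixed⇒∈ FQ (𝔽⇒Fixed fx)) Vf≐FQ)

      -- With `N = n + 1`, minimality of `f` reads `v + 1 = R (n + 1)`, so `n R ≤ v < (n + 1) R`.
      -- Multiplying by the degree of `f` brackets `q - 1` between consecutive multiples of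
      -- `R * f.degree`.
      N≡ : N ≡ (q ℕ.∸ 1) / (R ℕ.* f.degree) ℕ.+ 1
      N≡ = result N Q≡R*N
        where
        v = (q ℕ.∸ 1) / f.degree

        result : ∀ N → Q ≡ R ℕ.* N → N ≡ (q ℕ.∸ 1) / (R ℕ.* f.degree) ℕ.+ 1
        result zero    Q≡0  = contradiction 0<Q (ℕₚ.≤⇒≯ (ℕₚ.≤-reflexive (≡.trans Q≡0 (ℕₚ.*-zeroʳ R))))
        result (suc n) Q≡RN = ≡.trans (ℕₚ.+-comm 1 n) (≡.cong (ℕ._+ 1) (≡.sym (quotient-unique n (R ℕ.* f.degree) lower upper)))
          where
          suc-v≡R*[1+n] : suc v ≡ R ℕ.* suc n
          suc-v≡R*[1+n] = ≡.trans (ℕₚ.+-comm 1 v) (≡.trans (≡.sym Q≡quotient+1) Q≡RN)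

          n*R≤v : n ℕ.* R ≤ v
          n*R≤v = ℕₚ.≤-pred (≡.subst (n ℕ.* R <_) (≡.sym suc-v≡R*[1+n])
            (≡.subst (n ℕ.* R <_) (ℕₚ.*-comm (suc n) R) (ℕₚ.m<n+m (n ℕ.* R) 0<R)))

          lower : n ℕ.* (R ℕ.* f.degree) ≤ q ℕ.∸ 1
          lower = ℕₚ.≤-trans (≡.subst (_≤ v ℕ.* f.degree) (ℕₚ.*-assoc n R f.degree) (ℕₚ.*-monoˡ-≤ f.degree n*R≤v)) (ℕᵐ.m/n*n≤m (q ℕ.∸ 1) f.degree)

          upper : q ℕ.∸ 1 < suc n ℕ.* (R ℕ.* f.degree)
          upper = ≡.subst (q ℕ.∸ 1 <_) (≡.trans (≡.cong (ℕ._* f.degree) (≡.trans suc-v≡R*[1+n] (ℕₚ.*-comm R (suc n)))) (ℕₚ.*-assoc (suc n) R f.degree))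
            (m<[1+m/n]*n (q ℕ.∸ 1) f.degree)

    -- Every minimal polynomial with value set `U` is a composite `M ∘ f`.

    module Decomposition (F : Poly) (mvsp : IsMVSP Fq F) (VF≐U : ValueSet Fq F ≐ U) where

      open IsMVSP mvsp renaming (degree to D; coefficients to F-coefficients; hasDegree to F-degree; minimal to F-minimal)

      private
        v : ℕ
        v = (q ℕ.∸ 1) / D

        0<D : 0 < D
        0<D = ℕ.>-nonZero⁻¹ D

        N≡v+1 : N ≡ v ℕ.+ 1
        N≡v+1 = enumerationLength F-minimal us-unique ∈⇒U U⇒∈ VF≐U

        1<N : 1 < N
        1<N = unique⊆⇒length≤ {us} {0# ∷ 1# ∷ []} ((0≉1 ∷ []) ∷ [] ∷ [])
          λ { (here x≈0) → U⇒∈ (U-resp (sym x≈0) S.0-closed) ; (there (here x≈1)) → U⇒∈ (U-resp (sym x≈1) U1) }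

        vD≤q∸1 : v ℕ.* D ≤ q ℕ.∸ 1
        vD≤q∸1 = ℕᵐ.m/n*n≤m (q ℕ.∸ 1) D

        ND≡D+vD : N ℕ.* D ≡ D ℕ.+ v ℕ.* D
        ND≡D+vD = ≡.cong (ℕ._* D) (≡.trans N≡v+1 (ℕₚ.+-comm v 1))

        -- `U` contains both `0#` and `1#`, so `v` is at least 1 and `D ≤ v D ≤ q - 1`.
        D<q : D < q
        D<q = ≡.subst (D <_) suc[q∸1]≡q (s≤s (ℕₚ.≤-trans D≤vD vD≤q∸1))
          where
          D≤vD : D ≤ v ℕ.* D
          D≤vD = ℕₚ.m≤n*m D v {{ℕ.>-nonZero (ℕₚ.≤-pred (≡.subst (1 <_) (≡.trans N≡v+1 (ℕₚ.+-comm v 1)) 1<N))}}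

      y : Poly
      y = applyₚ as F

      eval-y : ∀ x → eval y x ≈ evalLin as (eval F x)
      eval-y = eval-applyₚ as F

      y≈ : linearized as ∘ₚ F ≈ₚ y
      y≈ = eval-injective (linearized as ∘ₚ F) y λ x →
        trans (eval-∘ (linearized as) F x) (trans (eval-linearized as _) (sym (eval-y x)))

      leadingCoefficient : Carrier
      leadingCoefficient = 1# * coeff F D ↑ (r ℕ.^ s)

      leadingCoefficient≉0 : leadingCoefficient ≉ 0#
      leadingCoefficient≉0 = *-≉0 1≉0 λ eq → proj₁ F-degree (x↑n≈0⇒x≈0 (r ℕ.^ s) eq)

      y-leading : HasLeadingTerm y (N ℕ.* D) leadingCoefficient
      y-leading = ≡.subst (λ m → HasLeadingTerm y (m ℕ.* D) leadingCoefficient) (≡.sym N≡r^s)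
        (leading-≈ₚ {linearized as ∘ₚ F} {y} y≈ (leading-∘ (linearized as) F 0<D (leading-linearized as A-ext.composite-leading) (degree⇒leading {F} F-degree)))

      y≉[] : ¬ (∀ x → eval y x ≈ 0#)
      y≉[] y≈0 = leadingCoefficient≉0 (trans (sym (proj₁ y-leading)) (eval≈0⇒≈[] y y≈0 (N ℕ.* D)))

      y-coefficients : y HasCoefficientsIn ⟦ Fq ⟧
      y-coefficients i = Membershipₚ.∈-resp-≈ setoid (y≈ i)
        (Cq.∘ₚ-closed (linearized as) F (λ j → FQ⊆Fq (linearized-closed as A-ext.composite-closed j)) F-coefficients i)

      y-root : ∀ {x} → ⟦ Fq ⟧ x → eval y x ≈ 0#
      y-root {x} x∈ = trans (eval-y x) (U⇒root (proj₁ VF≐U (x , x∈ , refl)))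

      ∏Fq : ∀ x → prodₗ (map (λ b → x - b) (Subfield.elements Fq)) ≈ x ↑ q - x
      ∏Fq x = trans (sym (eval-∏X- (Subfield.elements Fq) x)) (trans (eval-≈ₚ (∏X- (Subfield.elements Fq)) (X^ q -ₚ X) x
        (leadingTerms-agree⇒≈ₚ (∏X- (Subfield.elements Fq)) (X^ q -ₚ X)
          (≡.subst (λ m → HasLeadingTerm (∏X- (Subfield.elements Fq)) m 1#) (Subfield.order Fq) (leading-∏X- (Subfield.elements Fq)))
          (leading-X^-X (1<order Fq)) (Subfield.unique Fq) (ℕₚ.≤-reflexive (≡.sym (Subfield.order Fq)))
          (λ x∈ → trans (root-∏X- x∈) (sym (Fixed⇒X^-X-root {q} (x∈F⇒x↑N≈x Fq x∈))))))
        (eval-X^-X q x))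

      private
        factorization : ∃ λ B → ∀ x → eval y x ≈ prodₗ (map (λ b → x - b) (Subfield.elements Fq)) * eval B x
        factorization = roots⇒factors y (Subfield.unique Fq) y-root

      B : Poly
      B = proj₁ factorization

      y-factored : ∀ x → eval y x ≈ (x ↑ q - x) * eval B x
      y-factored x = trans (proj₂ factorization x) (*-congʳ (∏Fq x))

      B-degree : ∃ (HasDegree B)
      B-degree = cases (≈[]⊎degree B)
        where
        cases : B ≈ₚ [] ⊎ ∃ (HasDegree B) → ∃ (HasDegree B)
        cases (inj₁ B≈[]) = ⊥-elim (y≉[] λ x → trans (y-factored x) (trans (*-congˡ (eval-≈[] B x B≈[])) (zeroʳ _)))
        cases (inj₂ deg)  = deg

      b : ℕ
      b = proj₁ B-degree

      q+b≡ND : q ℕ.+ b ≡ N ℕ.* D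
      q+b≡ND = proj₁ (leading-unique {y}
        (leading-≈ₚ {(X^ q -ₚ X) *ₚ B} {y} (eval-injective ((X^ q -ₚ X) *ₚ B) y λ x →
            trans (eval-* (X^ q -ₚ X) B x) (trans (*-congʳ (eval-X^-X q x)) (sym (y-factored x))))
          (leading-* (X^ q -ₚ X) B (leading-X^-X (1<order Fq)) (degree⇒leading {B} (proj₂ B-degree))))
        y-leading (*-≉0 1≉0 (proj₁ (proj₂ B-degree))) leadingCoefficient≉0)

      -- Minimality of `F` in the form used from here on: `N = v + 1` and `v D < q` give
      -- `N D < D + q`, while `B` has degree `N D - q`.
      b<D : b < D
      b<D = ℕₚ.+-cancelˡ-< q b D (≡.subst₂ _<_ (≡.sym q+b≡ND) (ℕₚ.+-comm D q)
        (≡.subst (_< D ℕ.+ q) (≡.sym ND≡D+vD) (ℕₚ.+-monoʳ-< D (≡.subst (v ℕ.* D <_) suc[q∸1]≡q (s≤s vD≤q∸1)))))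

      r∣q : r ∣ q
      r∣q = ≡.subst (r ∣_) (≡.sym q≡Q^h) (ℕᵈ.∣-trans (divides-^ 0<d) (divides-^ 0<h))
        where
        divides-^ : ∀ {a n} → 0 < n → a ∣ a ℕ.^ n
        divides-^ {a} {suc n} _ = ℕᵈ.m∣m*n (a ℕ.^ n)

      open Support as F B {D} {q} 0<D D<q r∣q (proj₂ F-degree) (λ m D≤m → proj₂ (proj₂ B-degree) m (ℕₚ.<-≤-trans b<D D≤m)) y-factored
        using (r∣m⇒q≤m<2q; degreeB-coefficient)

      module Peel-Fq = Peeling {d = d} 0<d ⟦ Fq ⟧ (Membershipₚ.∈-resp-≈ setoid) (Subfield.0-closed Fq) (Subfield.1-closed Fq)
        (Subfield.+-closed Fq) (Subfield.*-closed Fq) (Subfield.neg-closed Fq)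

      private
        difference : Peel-Fq.Difference y
        -- The scan starts at `e₀ = 0`, where nothing needs to be cleared yet, with `length y`
        -- exponents ahead. The constant term of `y` vanishes because `0#` lies in `Fq`.
        difference = Peel-Fq.artinSchreier (length y) 0 y (trans (sym (eval-0 y)) (y-root (Subfield.0-closed Fq))) y-coefficients
          (orbitShape as A-ext.composite-leading (U⇒root U1) (λ j 0<j fixed → d∣ j 0<j (λ Ux → fixed (U⇒root Ux))) F r∣m⇒q≤m<2q)
          (λ _ ()) (λ m len≤m → reflexive (coeff-≥length y len≤m))

        f₀ : Poly
        f₀ = proj₁ difference

      -- F and M ∘ f₀ have the same image under A, so they differ by a constant of U = M(𝔽 Q).
      private
        P : Poly
        P = F -ₚ M ∘ₚ f₀

        eval-P : ∀ x → eval P x ≈ eval F x - evalLin ms (eval f₀ x)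
        eval-P x = trans (eval-- F (M ∘ₚ f₀) x) (+-congˡ (-‿cong (trans (eval-∘ M f₀ x) (eval-linearized ms _))))

        P∈U : ∀ x → U (eval P x)
        P∈U x = root⇒U (begin
          evalLin as (eval P x)                                            ≈⟨ evalLin-cong as (eval-P x) ⟩
          evalLin as (eval F x - evalLin ms (eval f₀ x))                   ≈⟨ evalLin-- as _ _ ⟩
          evalLin as (eval F x) - evalLin as (evalLin ms (eval f₀ x))      ≈⟨ +-cong (sym (eval-y x)) (-‿cong (A∘M _)) ⟩
          eval y x - (eval f₀ x ↑ Q - eval f₀ x)                           ≈⟨ x≈y⇒x-y≈0 (proj₂ (proj₂ difference) x) ⟩
          0#                                                               ∎)

        P-constant : ∀ x → eval P x ≈ coeff P 0
        P-constant = cases (constant⊎surjective P)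
          where
          cases : (∀ x → eval P x ≈ coeff P 0) ⊎ (∀ z → ∃ λ x → eval P x ≈ z) → ∀ x → eval P x ≈ coeff P 0
          cases (inj₁ const) = const
          -- A surjective `P` would attain a value outside the finite list `us`, although all its
          -- values lie in `U`.
          cases (inj₂ surj)  =
            let z , z∉ = ∃∉ us
                x , Px≈z = surj z
            in ⊥-elim (z∉ (U⇒∈ (U-resp Px≈z (P∈U x))))

        preimage : ∃ λ β → evalLin ms β ≈ coeff P 0
        preimage = linearized-surjective ms M-ext.outer-leading (coeff P 0)

        β : Carrier
        β = proj₁ preimage

        β-fixed : Fixed Q β
        β-fixed = x-y≈0⇒x≈y _ _ (trans (sym (A∘M β)) (trans (evalLin-cong as (trans (proj₂ preimage) (sym (P-constant 0#)))) (U⇒root (P∈U 0#))))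

      f : Poly
      f = f₀ +ₚ constant β

      eval-f : ∀ x → eval f x ≈ eval f₀ x + β
      eval-f x = trans (eval-+ f₀ (constant β) x) (+-congˡ (eval-constant β x))

      f-coefficients : f HasCoefficientsIn ⟦ Fq ⟧
      f-coefficients = Cq.+ₚ-closed f₀ (constant β) (proj₁ (proj₂ difference)) (Cq.∷-closed (FQ⊆Fq β-fixed) Cq.[]-closed)

      M∘f : ∀ x → evalLin ms (eval f x) ≈ eval F x
      M∘f x = begin
        evalLin ms (eval f x)                                         ≈⟨ evalLin-cong ms (eval-f x) ⟩
        evalLin ms (eval f₀ x + β)                                    ≈⟨ evalLin-+ ms _ _ ⟩
        evalLin ms (eval f₀ x) + evalLin ms β                         ≈⟨ +-congˡ (trans (proj₂ preimage) (trans (sym (P-constant x)) (eval-P x))) ⟩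
        evalLin ms (eval f₀ x) + (eval F x - evalLin ms (eval f₀ x))  ≈⟨ solve 2 (λ a b → a :+ (b :- a) := b) refl (evalLin ms (eval f₀ x)) (eval F x) ⟩
        eval F x                                                      ∎

      F≈M∘f : F ≈ₚ M ∘ₚ f
      F≈M∘f = eval-injective F (M ∘ₚ f) λ x → sym (trans (eval-∘ M f x) (trans (eval-linearized ms _) (M∘f x)))

      y≈f^Q-f : ∀ x → eval y x ≈ eval f x ↑ Q - eval f x
      y≈f^Q-f x = trans (eval-y x) (trans (evalLin-cong as (sym (M∘f x))) (A∘M _))

      private
        -- Encodes `x^Q - x` as a linearized polynomial, so that `y = f^Q - f` becomes an instance
        -- of `applyₚ` and `coeff-applyₚ-∤` can be applied to `f` in place of `F`.
        τ^d-1 : List Carrier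
        τ^d-1 = (X^ d) -ₚ constant 1#

        evalLin-τ^d-1 : ∀ x → evalLin τ^d-1 x ≈ x ↑ Q - x
        evalLin-τ^d-1 x = trans (evalLin-+ₚ (X^ d) (- 1# ∷ []) x) (+-cong (evalLin-X^ d x)
          (trans (+-identityʳ _) (trans (sym (-‿distribˡ-* 1# x)) (-‿cong (*-identityˡ x)))))

        y≈applyₚ : applyₚ τ^d-1 f ≈ₚ y
        y≈applyₚ = eval-injective (applyₚ τ^d-1 f) y λ x → trans (eval-applyₚ τ^d-1 f x) (trans (evalLin-τ^d-1 _) (sym (y≈f^Q-f x)))

      -- At exponents not divisible by r, the coefficients of y = f^Q - f are those of - f.
      f-coeff≉0 : coeff f (suc b) ≉ 0#
      f-coeff≉0 f≈0 =
        let r∤ , y≉0 = degreeB-coefficient (proj₂ B-degree)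
        in y≉0 (trans (sym (y≈applyₚ (suc b))) (coeff-applyₚ-∤ τ^d-1 f (suc b) r∤ f≈0))

      f-degree : ∃ (HasDegree f)
      f-degree = cases (≈[]⊎degree f)
        where
        cases : f ≈ₚ [] ⊎ ∃ (HasDegree f) → ∃ (HasDegree f)
        cases (inj₁ f≈[]) = ⊥-elim (f-coeff≉0 (f≈[] (suc b)))
        cases (inj₂ deg)  = deg

      D′ : ℕ
      D′ = proj₁ f-degree

      b<D′ : b < D′
      b<D′ = ℕₚ.≮⇒≥ (λ D′<1+b → f-coeff≉0 (proj₂ (proj₂ f-degree) (suc b) D′<1+b))

      instance
        D′≢0 : NonZero D′
        D′≢0 = ℕ.>-nonZero (ℕₚ.≤-<-trans z≤n b<D′)

      D≡RD′ : D ≡ R ℕ.* D′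
      D≡RD′ = proj₁ (leading-unique {F} (degree⇒leading {F} F-degree)
        (leading-≈ₚ {M ∘ₚ f} {F} (λ i → sym (F≈M∘f i)) (leading-∘ M f (ℕ.>-nonZero⁻¹ D′) M-leading (degree⇒leading {f} (proj₂ f-degree))))
        (proj₁ F-degree) (*-≉0 1≉0 (λ eq → proj₁ (proj₂ f-degree) (x↑n≈0⇒x≈0 R eq))))

      QD′≡q+b : Q ℕ.* D′ ≡ q ℕ.+ b
      QD′≡q+b = ≡.trans (≡.cong (ℕ._* D′) (≡.trans Q≡R*N (ℕₚ.*-comm R N)))
        (≡.trans (ℕₚ.*-assoc N R D′) (≡.trans (≡.cong (N ℕ.*_) (≡.sym D≡RD′)) (≡.sym q+b≡ND)))

      private
        suc[Q∸1]≡Q : suc (Q ℕ.∸ 1) ≡ Q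
        suc[Q∸1]≡Q = ℕₚ.m+[n∸m]≡n 0<Q

      -- Since `Q D′ = q + b`, this is where `b < D′` pays off. It serves twice: a product of
      -- `Q - 1` factors `f - w` is too short to vanish on `Fq`, and the quotient of `q - 1` by `D′`
      -- is `Q - 1`.
      [Q-1]D′<q : (Q ℕ.∸ 1) ℕ.* D′ < q
      [Q-1]D′<q = ℕₚ.+-cancelˡ-< D′ _ q (≡.subst (_< D′ ℕ.+ q) (≡.trans (≡.sym QD′≡q+b) (≡.cong (ℕ._* D′) (≡.sym suc[Q∸1]≡Q)))
        (≡.subst (_< D′ ℕ.+ q) (ℕₚ.+-comm b q) (ℕₚ.+-monoˡ-< q b<D′)))

      Vf⊆FQ : ValueSet Fq f ⊆ 𝔽 Q
      Vf⊆FQ (x , x∈ , fx≈z) = Fixed⇒𝔽 FQ (Fixed-resp {Q} fx≈z (x-y≈0⇒x≈y _ _ (trans (sym (y≈f^Q-f x)) (y-root x∈))))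

      -- If z ∈ 𝔽 Q were not a value of f, the product of f - w over the other w ∈ 𝔽 Q would vanish on Fq.
      FQ⊆Vf : 𝔽 Q ⊆ ValueSet Fq f
      FQ⊆Vf {z} fz = cases (Any.any? (λ x → eval f x ≟ z) (Subfield.elements Fq))
        where
        z∈ : z ∈ Subfield.elements FQ
        z∈ = Fixed⇒∈ FQ (𝔽⇒Fixed fz)

        ws : List Carrier
        ws = proj₁ (∈⇒↭∷ z∈)

        length-ws : length ws ≡ Q ℕ.∸ 1
        length-ws = ≡.cong ℕ.pred (≡.trans (≡.sym (Permutationₚ.xs↭ys⇒|xs|≡|ys| setoid (proj₂ (∈⇒↭∷ z∈)))) (Subfield.order FQ))

        W : Poly
        W = ∏X- ws ∘ₚ f

        W-degree : HasDegree W (length ws ℕ.* D′)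
        W-degree = leading⇒degree {W} (*-≉0 1≉0 (λ eq → proj₁ (proj₂ f-degree) (x↑n≈0⇒x≈0 (length ws) eq)))
          (leading-∘ (∏X- ws) f (ℕ.>-nonZero⁻¹ D′) (leading-∏X- ws) (degree⇒leading {f} (proj₂ f-degree)))

        cases : Dec (Any.Any (λ x → eval f x ≈ z) (Subfield.elements Fq)) → ValueSet Fq f z
        cases (yes p) = Membership.find setoid p
        cases (no ¬p) = contradiction
          (≡.subst₂ _≤_ (Subfield.order Fq) (≡.cong (ℕ._* D′) length-ws) (rootCount≤degree W W-degree (Subfield.unique Fq) root))
          (ℕₚ.<⇒≱ [Q-1]D′<q)
          where
          root : ∀ {x} → x ∈ Subfield.elements Fq → eval W x ≈ 0#
          root {x} x∈ = trans (eval-∘ (∏X- ws) f x) (root-∏X- (other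
            (Permutationₚ.∈-resp-↭ setoid (proj₂ (∈⇒↭∷ z∈)) (Fixed⇒∈ FQ (𝔽⇒Fixed (Vf⊆FQ (x , x∈ , refl)))))))
            where
            other : eval f x ∈ z ∷ ws → eval f x ∈ ws
            other (here fx≈z) = ⊥-elim (¬p (Membership.lose setoid (λ x≈x′ eq → trans (eval-cong f (sym x≈x′)) eq) x∈ fx≈z))
            other (there fx∈) = fx∈

      f∈𝒫 : 𝒫 Fq (𝔽 Q) f
      f∈𝒫 = record
        { coefficients = f-coefficients
        ; degree       = D′
        ; hasDegree    = proj₂ f-degree
        ; degree>0     = D′≢0
        ; minimal      = hasCardinality (Subfield.unique FQ) (λ x∈ → FQ , x∈) (λ fx → Fixed⇒∈ FQ (𝔽⇒Fixed fx)) (Vf⊆FQ , FQ⊆Vf)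
            (≡.trans (Subfield.order FQ) (≡.trans (≡.sym suc[Q∸1]≡Q) (≡.trans (ℕₚ.+-comm 1 (Q ℕ.∸ 1)) (≡.cong (ℕ._+ 1) (≡.sym quotient≡)))))
        } , Vf⊆FQ , FQ⊆Vf
        where
        quotient≡ : (q ℕ.∸ 1) / D′ ≡ Q ℕ.∸ 1
        quotient≡ = quotient-unique (Q ℕ.∸ 1) D′
          (ℕₚ.≤-pred (≡.subst ((Q ℕ.∸ 1) ℕ.* D′ <_) (≡.sym suc[q∸1]≡q) [Q-1]D′<q))
          (≡.subst (q ℕ.∸ 1 <_) (≡.trans (≡.sym QD′≡q+b) (≡.cong (ℕ._* D′) (≡.sym suc[Q∸1]≡Q)))
            (≡.subst (_≤ q ℕ.+ b) (≡.sym suc[q∸1]≡q) (ℕₚ.m≤m+n q b)))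

    𝒫-characterization : 𝒫 Fq U ≐ (λ F → ∃ λ f → 𝒫 Fq (𝔽 Q) f × F ≈ₚ M ∘ₚ f)
    𝒫-characterization =
      (λ {F} (mvsp , VF≐U) → let open Decomposition F mvsp VF≐U in f , f∈𝒫 , F≈M∘f) ,
      (λ {F} (f , f∈𝒫 , F≈) → composition∈𝒫 {F} f f∈𝒫 F≈)

-- Passage from `p`, `k`, `n` to powers of `r = p ^ k`, and the divisibility properties of `d`.

theorem2p4 : {c ℓ u : Level} (K : Field c ℓ) → let open Over K in
    (p n k : ℕ) → Prime p → .{{_ : NonZero k}} → k ∣ n →
    (Fq : Subfield (p ^ n)) → IsAlgebraicClosureOf ⟦ Fq ⟧ →
    (U : Pred Carrier u) (E : Enumeration U) →
    U ⊆ ⟦ Fq ⟧ → IsSubspace (𝔽 (p ^ k)) U → U 1# → 2 < ∣ E ∣ →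
    (d : ℕ) → 0 < d → d ≤ n / k →
    U ⊆ 𝔽 (p ^ (d ℕ.* k)) →
    (∀ e → 0 < e → U ⊆ 𝔽 (p ^ (e ℕ.* k)) → d ≤ e) →
    let A = vanishing E
        Q = p ^ (d ℕ.* k) in
    ∃ λ (M : Poly) →
      (M HasCoefficientsIn ⟦ Fq ⟧ × Monic M × Linearized (p ^ k) M
        × A ∘ₚ M ≈ₚ X^ Q -ₚ X
        × M ∘ₚ A ≈ₚ X^ Q -ₚ X)
      × 𝔽 Q ⊆ ⟦ Fq ⟧
      × 𝒫 Fq U ≐ (λ F → ∃ λ f → 𝒫 Fq (𝔽 Q) f × F ≈ₚ M ∘ₚ f)
theorem2p4 {c} {ℓ} {u} K p n k p-prime  (divides n′ n≡n′k) Fq (closed , _) U E U⊆Fq subspace U1 _ d 0<d _ U⊆𝔽Q minimal =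
  ≡.subst Conclusion (r^e≡p^ek d)
    (Core.M , Core.M-properties , (λ x∈ → Core.FQ⊆Fq (𝔽⇒Fixed x∈)) , Core.𝒫-characterization)
  where
  open Over K hiding (zero)
  open FieldProperties K
  open FixedPoints K

  Conclusion : ℕ → Set _
  Conclusion Q = ∃ λ (M : Poly) →
    (M HasCoefficientsIn ⟦ Fq ⟧ × Monic M × Linearized (p ^ k) M
      × vanishing E ∘ₚ M ≈ₚ X^ Q -ₚ X
      × M ∘ₚ vanishing E ≈ₚ X^ Q -ₚ X)
    × 𝔽 Q ⊆ ⟦ Fq ⟧
    × 𝒫 Fq U ≐ (λ F → ∃ λ f → 𝒫 Fq (𝔽 Q) f × F ≈ₚ M ∘ₚ f)

  r : ℕ
  r = p ^ k

  r^e≡p^ek : ∀ e → r ^ e ≡ p ^ (e ℕ.* k)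
  r^e≡p^ek e = ≡.trans (ℕₚ.^-*-assoc p k e) (≡.cong (p ^_) (ℕₚ.*-comm k e))

  1<p : 1 < p
  1<p = ℕ.nonTrivial⇒n>1 p {{prime⇒nonTrivial p-prime}}

  1<p^ : ∀ {m} → 0 < m → 1 < p ^ m
  1<p^ {m} 0<m = ℕₚ.^-monoʳ-< p 1<p {0} {m} 0<m

  1<r : 1 < r
  1<r = 1<p^ (ℕ.>-nonZero⁻¹ k)

  frobenius-r^ : ∀ e → Frobenius (r ^ e)
  frobenius-r^ e = ≡.subst Frobenius (≡.sym (ℕₚ.^-*-assoc p k e))
    (frobenius-^ {p} (frobenius-prime p-prime (p^n×1≈0⇒p×1≈0 p n (order×1≈0 Fq))) (k ℕ.* e))

  frobenius : Frobenius r
  frobenius = ≡.subst Frobenius (ℕₚ.*-identityʳ r) (frobenius-r^ 1)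

  q≡r^n′ : p ^ n ≡ r ^ n′
  q≡r^n′ = ≡.trans (≡.cong (p ^_) n≡n′k) (≡.sym (r^e≡p^ek n′))

  0<n′ : 0 < n′
  0<n′ = positive n′ (≡.subst (1 <_) q≡r^n′ (1<order Fq))
    where
    positive : ∀ m → 1 < r ^ m → 0 < m
    positive zero    (s≤s ())
    positive (suc m) _ = s≤s z≤n

  FQ : Subfield (r ^ d)
  -- The element `1#` of `U` lies in `𝔽 Q`, and its membership proof carries a subfield of the
  -- required order.
  FQ = ≡.subst Subfield (≡.sym (r^e≡p^ek d)) (proj₁ (U⊆𝔽Q U1))

  U-fixed : ∀ {x} → U x → Fixed (r ^ d) x
  U-fixed {x} Ux = ≡.subst (λ m → Fixed m x) (≡.sym (r^e≡p^ek d)) (𝔽⇒Fixed (U⊆𝔽Q Ux))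

  -- `U` is fixed by the power maps for `r ^ d` and `r ^ j`, hence by that for `r ^ g` with `g` the
  -- gcd. `FQ` contains a subfield of order `r ^ g`, so `U ⊆ 𝔽 (r ^ g)`, and minimality of `d`
  -- forces `g ≡ d`.
  d∣ : ∀ j → (∀ {x} → U x → Fixed (r ^ j) x) → d ∣ j
  d∣ j fixed = ≡.subst (_∣ j) g≡d (gcd[m,n]∣n d j)
    where
    g = gcd d j

    0<g : 0 < g
    0<g = ℕₚ.n≢0⇒n>0 (gcd[m,n]≢0 d j (inj₁ (ℕₚ.m<n⇒n≢0 0<d)))

    Fg : Subfield (r ^ g)
    Fg = subfield (gcd[m,n]∣m d j)
      where
      subfield : g ∣ d → Subfield (r ^ g)
      subfield (divides h d≡hg) = subfieldOfPower (≡.subst (1 <_) (≡.sym (r^e≡p^ek g)) (1<p^ (ℕₚ.*-mono-≤ 0<g (ℕ.>-nonZero⁻¹ k))))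
        (frobenius-r^ g) closed h (0<h h d≡hg)
        (≡.trans (≡.cong (r ^_) (≡.trans d≡hg (ℕₚ.*-comm h g))) (≡.sym (ℕₚ.^-*-assoc r g h))) FQ
        where
        0<h : ∀ h → d ≡ h ℕ.* g → 0 < h
        0<h zero    d≡0 = ⊥-elim (ℕₚ.<⇒≢ 0<d (≡.sym d≡0))
        0<h (suc h) _   = s≤s z≤n

    g≡d : g ≡ d
    g≡d = ℕₚ.≤-antisym (ℕᵈ.∣⇒≤ {{ℕ.>-nonZero 0<d}} (gcd[m,n]∣m d j))
      (minimal g 0<g λ {x} Ux → ≡.subst (λ m → 𝔽 m x) (r^e≡p^ek g) (Fixed⇒𝔽 Fg (Fixed-gcd {r} d j (U-fixed Ux) (fixed Ux))))

  -- Elements of `U` lie in `Fq` and are fixed by the power `q = r ^ n′`, so `d∣` applies to `n′`.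
  -- This makes `q` a power of `Q`, which puts the field of order `Q` inside `Fq`.
  d∣n′ : d ∣ n′
  d∣n′ = d∣ n′ λ {x} Ux → ≡.subst (λ m → Fixed m x) q≡r^n′ (x∈F⇒x↑N≈x Fq (U⊆Fq Ux))

  h : ℕ
  h = ℕᵈ.quotient d∣n′

  n′≡dh : n′ ≡ d ℕ.* h
  n′≡dh = ℕᵈ.m∣n⇒n≡m*quotient d∣n′

  0<h : 0 < h
  0<h = ℕₚ.n≢0⇒n>0 λ h≡0 → ℕₚ.<⇒≢ 0<n′ (≡.sym (≡.trans n′≡dh (≡.trans (≡.cong (d ℕ.*_) h≡0) (ℕₚ.*-zeroʳ d))))

  module Core = MinimalValueSets.Main K closed 1<r frobenius (subfieldOfPower 1<r frobenius closed n′ 0<n′ q≡r^n′ Fq) 0<d FQ 0<h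
    (≡.trans q≡r^n′ (≡.trans (≡.cong (r ^_) n′≡dh) (≡.sym (ℕₚ.^-*-assoc r d h)))) Fq U E subspace U1 U-fixed (λ j _ → d∣ j)
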